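{- There is a hereditary $3$-graph property $\mathcal{H}$ which admits binary $\mathrm{disc}_{2,3}$-error, and which contains $\overline{U}(k)$ for all $k\geq1$.
   Context: For distinct $x,y,z$ write $xy=\{x,y\}$, $xyz=\{x,y,z\}$; $[n]=\{1,\dots,n\}$. $K_2[X,Y]=\{xy: x\in X,y\in Y,x\neq y\}$. A $3$-graph is a pair $H=(V,F)$ with $F\subseteq\binom{V}{3}$. A hereditary $3$-graph property is a class of finite $3$-graphs closed under isomorphism and induced sub-$3$-graphs. $\overline{U}(k)$ is the $3$-partite $3$-graph with vertex set $\{a_1,\dots,a_k\}\cup\{b_S:S\subseteq[k]\}\cup\{c_1,\dots,c_k\}$ and edge set $\{a_ib_Sc_j:j\in S\}$. A bipartite graph $(U\cup W,E)$ with $|E|=d|U||W|$ has $\mathrm{disc}_2(\epsilon)$ if for all $U'\subseteq U$, $W'\subseteq W$, $\big||E\cap K_2[U',W']|-d|U'||W'|\big|\leq\epsilon|U||W|$; it has $\mathrm{disc}_2(\epsilon;d')$ if moreover $\big||E|-d'|U||W|\big|\leq\epsilon|U||W|$. For a graph $G$, $K_3^{(2)}(G)$ is the set of vertex sets of triangles of $G$. If $G=(V_1\cup V_2\cup V_3,E)$ is a $3$-partite graph and $H'=(V_1\cup V_2\cup V_3,F')$ is a $3$-graph with $F'\subseteq K_3^{(2)}(G)$ and $|F'|=d_3|K_3^{(2)}(G)|$, then $(H',G)$ has $\mathrm{disc}_{2,3}(\epsilon_1,\epsilon_2)$ if there is $d_2\in(0,1]$ such that each bipartite graph $G[V_i,V_j]$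 ($1\leq i<j\leq3$) has $\mathrm{disc}_2(\epsilon_2;d_2)$ and for every (not necessarily induced) subgraph $G'\subseteq G$, $\big||F'\cap K_3^{(2)}(G')|-d_3|K_3^{(2)}(G')|\big|\leq\epsilon_1d_2^3|V_1||V_2||V_3|$. A $(t,\ell,\epsilon_1,\epsilon_2)$-decomposition $\mathcal{P}$ of a set $V$ consists of a partition $V=V_1\cup\dots\cup V_t$ with $|V_1|\leq\dots\leq|V_t|\leq|V_1|+1$ and for each $ij\in\binom{[t]}{2}$ a partition $K_2[V_i,V_j]=\bigcup_{\alpha\leq\ell}P_{ij}^\alpha$, such that for all but at most $\epsilon_1|V|^3$ triples $xyz\in\binom V3$ there are $ijk\in\binom{[t]}{3}$ and $\alpha,\beta,\gamma\in[\ell]$ with $xy\in P^\alpha_{ij}$, $xz\in P^\beta_{ik}$, $yz\in P^\gamma_{jk}$, and each of $P^\alpha_{ij},P^\beta_{ik},P^\gamma_{jk}$ (as bipartite graphs) has $\mathrm{disc}_2(\epsilon_2;1/\ell)$. A triad of $\mathcal{P}$ is a $3$-partite graph $G_{ijk}^{\alpha,\beta,\gamma}=(V_i\cup V_j\cup V_k,P_{ij}^\alpha\cup P_{ik}^\beta\cup P_{jk}^\gamma)$ with $ijk\in\binom{[t]}{3}$, $\alpha,\beta,\gamma\in[\ell]$. For $H=(V,F)$, a triad $G$ of $\mathcal{P}$ has $\mathrm{disc}_{2,3}(\epsilon_1,\epsilon_2)$ with respect to $H$ if $(H',G)$ does, where $H'=(V_i\cup V_j\cup V_k,F\cap K_3^{(2)}(G))$.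 $\mathcal{H}$ admits binary $\mathrm{disc}_{2,3}$-error if for all $t_0,\ell_0\geq1$, $\epsilon_1>0$, $\epsilon_2:\mathbb{N}\to(0,1]$ there are $N,T,L$ such that for every $H=(V,F)\in\mathcal{H}$ with $|V|\geq N$ there are $t_0\leq t\leq T$, $\ell_0\leq\ell\leq L$, a $(t,\ell,\epsilon_1,\epsilon_2(\ell))$-decomposition $\mathcal{P}$ of $V$, and $\Gamma\subseteq\binom{[t]}{2}$ with $|\Gamma|\leq\epsilon_1t^2$ such that every triad $G_{ijk}^{\alpha,\beta,\gamma}$ of $\mathcal{P}$ with $ij,ik,jk\notin\Gamma$ has $\mathrm{disc}_{2,3}(\epsilon_1,\epsilon_2(\ell))$ with respect to $H$. -}

module Defs where

open import Data.Bool using (Bool; true; false; _∧_; _∨_; not; if_then_else_)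
open import Data.Bool.Properties using (∧-comm; ∧-assoc; ∨-comm; ∨-assoc)
open import Data.Fin using (Fin; _≟_; _<?_; splitAt; finToFun)
import Data.Fin as Fin
open import Data.Fin.Properties using (2↔Bool; nonZeroIndex)
open import Data.Fin.Subset using (Subset; _⊆_) renaming (∣_∣ to card)
open import Data.Integer using (+_)
open import Data.Nat using (ℕ; suc; _≥_; NonZero)
import Data.Nat as ℕ
open import Data.Nat.Properties using (+-*-semiring)
open import Data.Product using (Σ-syntax; ∃-syntax; _×_; _,_)
open import Data.Rational using (ℚ; 0ℚ; 1ℚ; _/_; _*_; _-_; ∣_∣; _≤_; _<_)
open import Data.Sum using (inj₁; inj₂; [_,_]′)
open import Data.Vec using (lookup; tabulate)
open import Function using (_∘_; _↣_; _↔_; Injection; Inverse)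
open import Relation.Binary.PropositionalEquality
  using (_≡_; _≢_; refl; sym; trans; cong; cong₂)
open import Relation.Nullary using (does; yes; no; contradiction)
open import Algebra.Properties.Semiring.Sum +-*-semiring using (sum-syntax)

private
  variable
    m n : ℕ

↑ : ℕ → ℚ
↑ k = + k / 1

𝟙 : Bool → ℕ
𝟙 b = if b then 1 else 0

------------------------------------------------------------------------
-- Graphs

record Graph (n : ℕ) : Set where
  field
    adj     : Fin n → Fin n → Bool
    adj-sym : ∀ x y → adj x y ≡ adj y x
    irrefl  : ∀ x → adj x x ≡ false

open Graph public using (adj)

-- Each edge xy is counted once, through its ordering x < y.
edgeCount : Graph n → ℕ
edgeCount {n} G = ∑[ x < n ] ∑[ y < n ] 𝟙 (does (x <? y) ∧ adj G x y)

-- Vertices outside a subgraph can be taken to be isolated in it, as far as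
-- edges and triangles are concerned, so only the edge sets are compared.
_⊆ᴳ_ : Graph n → Graph n → Set
G′ ⊆ᴳ G = ∀ x y → adj G′ x y ≡ true → adj G x y ≡ true

_∩ᴳ_ : Graph n → Graph n → Graph n
G ∩ᴳ G′ = record
  { adj     = λ x y → adj G x y ∧ adj G′ x y
  ; adj-sym = λ x y → cong₂ _∧_ (Graph.adj-sym G x y) (Graph.adj-sym G′ x y)
  ; irrefl  = λ x → cong (_∧ adj G′ x x) (Graph.irrefl G x)
  }

_∪ᴳ_ : Graph n → Graph n → Graph n
G ∪ᴳ G′ = record
  { adj     = λ x y → adj G x y ∨ adj G′ x y
  ; adj-sym = λ x y → cong₂ _∨_ (Graph.adj-sym G x y) (Graph.adj-sym G′ x y)
  ; irrefl  = λ x → cong₂ _∨_ (Graph.irrefl G x) (Graph.irrefl G′ x)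
  }

private
  ≢-sym : (x y : Fin n) → not (does (x ≟ y)) ≡ not (does (y ≟ x))
  ≢-sym x y with x ≟ y | y ≟ x
  ... | yes _ | yes _ = refl
  ... | no  _ | no  _ = refl
  ... | yes p | no  q = contradiction (sym p) q
  ... | no  p | yes q = contradiction (sym q) p

  ≢-irrefl : (x : Fin n) → not (does (x ≟ x)) ≡ false
  ≢-irrefl x with x ≟ x
  ... | yes _ = refl
  ... | no  p = contradiction refl p

K₂ : Subset n → Subset n → Graph n
K₂ X Y = record
  { adj     = λ x y → not (does (x ≟ y)) ∧
                (lookup X x ∧ lookup Y y ∨ lookup Y x ∧ lookup X y)
  ; adj-sym = λ x y → cong₂ _∧_ (≢-sym x y)
                (trans (∨-comm (lookup X x ∧ lookup Y y) (lookup Y x ∧ lookup X y))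
                  (cong₂ _∨_ (∧-comm (lookup Y x) (lookup X y))
                             (∧-comm (lookup X x) (lookup Y y))))
  ; irrefl  = λ x → cong (_∧ (lookup X x ∧ lookup Y x ∨ lookup Y x ∧ lookup X x))
                      (≢-irrefl x)
  }

_[_,_] : Graph n → Subset n → Subset n → Graph n
G [ X , Y ] = G ∩ᴳ K₂ X Y

------------------------------------------------------------------------
-- 3-graphs

-- A set F of 3-element subsets of Fin n, presented as a symmetric relation
-- that holds only for distinct x, y, z.
record ThreeGraph (n : ℕ) : Set where
  field
    edge   : Fin n → Fin n → Fin n → Bool
    swap₁₂ : ∀ x y z → edge x y z ≡ edge y x z
    swap₂₃ : ∀ x y z → edge x y z ≡ edge x z y
    irrefl : ∀ x z → edge x x z ≡ false

open ThreeGraph public using (edge)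

-- Each triple xyz is counted once, through its ordering x < y < z.
tripleCount : ThreeGraph n → ℕ
tripleCount {n} H =
  ∑[ x < n ] ∑[ y < n ] ∑[ z < n ]
    𝟙 (does (x <? y) ∧ does (y <? z) ∧ edge H x y z)

_∩³_ : ThreeGraph n → ThreeGraph n → ThreeGraph n
H ∩³ H′ = record
  { edge   = λ x y z → edge H x y z ∧ edge H′ x y z
  ; swap₁₂ = λ x y z → cong₂ _∧_ (ThreeGraph.swap₁₂ H x y z) (ThreeGraph.swap₁₂ H′ x y z)
  ; swap₂₃ = λ x y z → cong₂ _∧_ (ThreeGraph.swap₂₃ H x y z) (ThreeGraph.swap₂₃ H′ x y z)
  ; irrefl = λ x z → cong (_∧ edge H′ x x z) (ThreeGraph.irrefl H x z)
  }

-- K₃⁽²⁾(G), the vertex sets of triangles of G.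
K₃ : Graph n → ThreeGraph n
K₃ G = record
  { edge   = λ x y z → adj G x y ∧ (adj G x z ∧ adj G y z)
  ; swap₁₂ = λ x y z → cong₂ _∧_ (Graph.adj-sym G x y) (∧-comm (adj G x z) (adj G y z))
  ; swap₂₃ = λ x y z →
      trans (sym (∧-assoc (adj G x y) (adj G x z) (adj G y z)))
        (trans (cong₂ _∧_ (∧-comm (adj G x y) (adj G x z)) (Graph.adj-sym G y z))
          (∧-assoc (adj G x z) (adj G x y) (adj G z y)))
  ; irrefl = λ x z → cong (_∧ (adj G x z ∧ adj G x z)) (Graph.irrefl G x)
  }

_≅_ : ThreeGraph m → ThreeGraph n → Set
_≅_ {m} {n} H H′ = Σ[ f ∈ (Fin m ↔ Fin n) ]
  (let φ = Inverse.to f in ∀ x y z → edge H x y z ≡ edge H′ (φ x) (φ y) (φ z))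

-- H is, up to the labelling of its vertices by Fin m, the sub-3-graph of H′
-- induced on the image of the injection.
_InducedIn_ : ThreeGraph m → ThreeGraph n → Set
_InducedIn_ {m} {n} H H′ = Σ[ f ∈ (Fin m ↣ Fin n) ]
  (let φ = Injection.to f in ∀ x y z → edge H x y z ≡ edge H′ (φ x) (φ y) (φ z))

record HereditaryProperty : Set₁ where
  field
    Member         : ThreeGraph n → Set
    closed-≅       : {H : ThreeGraph m} {H′ : ThreeGraph n} →
                     H ≅ H′ → Member H → Member H′
    closed-induced : {H : ThreeGraph m} {H′ : ThreeGraph n} →
                     H InducedIn H′ → Member H′ → Member H

infix 4 _∈ᴾ_

_∈ᴾ_ : ThreeGraph n → HereditaryProperty → Set
H ∈ᴾ 𝓗 = HereditaryProperty.Member 𝓗 H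

------------------------------------------------------------------------
-- The 3-graph Ū(k)

data Vertex (k : ℕ) : Set where
  a : Fin k → Vertex k
  b : Subset k → Vertex k
  c : Fin k → Vertex k

private
  subsetOf : ∀ k → Fin (2 ℕ.^ k) → Subset k
  subsetOf k s = tabulate (Inverse.to 2↔Bool ∘ finToFun s)

-- A bijective labelling of the vertices.
vertex : ∀ k → Fin (k ℕ.+ (2 ℕ.^ k ℕ.+ k)) → Vertex k
vertex k = [ a , [ b ∘ subsetOf k , c ]′ ∘ splitAt (2 ℕ.^ k) ]′ ∘ splitAt k

abcEdge : ∀ {k} → Vertex k → Vertex k → Vertex k → Bool
abcEdge (a i) (b S) (c j) = lookup S j
abcEdge _     _     _     = false

symmetrise : {A : Set} → (A → A → A → Bool) → A → A → A → Bool
symmetrise g x y z =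
  (g x y z ∨ g x z y) ∨ ((g y x z ∨ g y z x) ∨ (g z x y ∨ g z y x))

private
  module _ {A : Set} (g : A → A → A → Bool) where

    symmetrise₁₂ : ∀ x y z → symmetrise g x y z ≡ symmetrise g y x z
    symmetrise₁₂ x y z =
      trans (sym (∨-assoc p q r))
        (trans (cong₂ _∨_ (∨-comm p q) (∨-comm (g z x y) (g z y x)))
          (∨-assoc q p (g z y x ∨ g z x y)))
      where
      p = g x y z ∨ g x z y
      q = g y x z ∨ g y z x
      r = g z x y ∨ g z y x

    symmetrise₂₃ : ∀ x y z → symmetrise g x y z ≡ symmetrise g x z y
    symmetrise₂₃ x y z = cong₂ _∨_ (∨-comm (g x y z) (g x z y))
      (∨-comm (g y x z ∨ g y z x) (g z x y ∨ g z y x))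

  abcEdge-irrefl : ∀ {k} (x z : Vertex k) → symmetrise abcEdge x x z ≡ false
  abcEdge-irrefl (a _) (a _) = refl
  abcEdge-irrefl (a _) (b _) = refl
  abcEdge-irrefl (a _) (c _) = refl
  abcEdge-irrefl (b _) (a _) = refl
  abcEdge-irrefl (b _) (b _) = refl
  abcEdge-irrefl (b _) (c _) = refl
  abcEdge-irrefl (c _) (a _) = refl
  abcEdge-irrefl (c _) (b _) = refl
  abcEdge-irrefl (c _) (c _) = refl

Ū : ∀ k → ThreeGraph (k ℕ.+ (2 ℕ.^ k ℕ.+ k))
Ū k = record
  { edge   = λ x y z → symmetrise abcEdge (v x) (v y) (v z)
  ; swap₁₂ = λ x y z → symmetrise₁₂ abcEdge (v x) (v y) (v z)
  ; swap₂₃ = λ x y z → symmetrise₂₃ abcEdge (v x) (v y) (v z)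
  ; irrefl = λ x z → abcEdge-irrefl (v x) (v z)
  }
  where v = vertex k

------------------------------------------------------------------------
-- Discrepancy

-- Throughout, the real parameters are taken in ℚ.  For the universally
-- quantified ones this loses nothing, as every notion below is monotone in
-- them; densities are ratios of integers.

-- For a bipartite graph (U ∪ W, E), i.e. U and W disjoint and E ⊆ K₂ U W.
-- The density d is determined unless U or W is empty, in which case every
-- choice of d makes all the conditions hold.
disc₂ : ℚ → (U W : Subset n) → Graph n → Set
disc₂ {n} ε U W E = ∃[ d ]
  ↑ (edgeCount E) ≡ d * ↑ (card U ℕ.* card W) ×
  ((U′ W′ : Subset n) → U′ ⊆ U → W′ ⊆ W →
    ∣ ↑ (edgeCount (E ∩ᴳ K₂ U′ W′)) - d * ↑ (card U′ ℕ.* card W′) ∣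
      ≤ ε * ↑ (card U ℕ.* card W))

disc₂-at : ℚ → ℚ → (U W : Subset n) → Graph n → Set
disc₂-at ε d′ U W E = disc₂ ε U W E ×
  ∣ ↑ (edgeCount E) - d′ * ↑ (card U ℕ.* card W) ∣ ≤ ε * ↑ (card U ℕ.* card W)

-- For a 3-partite graph G on V₁ ∪ V₂ ∪ V₃ and F′ ⊆ K₃ G.  The density d₃ is
-- determined unless G has no triangles, in which case it plays no role.  If
-- some real d₂ is admissible then so is a rational one: the lower bounds on
-- d₂ and the last condition only improve as d₂ grows, and the largest d₂ not
-- exceeding 1 or any of the three densities plus ε₂ is rational.
disc₂,₃ : ℚ → ℚ → (V₁ V₂ V₃ : Subset n) → Graph n → ThreeGraph n → Set
disc₂,₃ {n} ε₁ ε₂ V₁ V₂ V₃ G F′ = ∃[ d₃ ]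
  ↑ (tripleCount F′) ≡ d₃ * ↑ (tripleCount (K₃ G)) ×
  (∃[ d₂ ] 0ℚ < d₂ × d₂ ≤ 1ℚ ×
    disc₂-at ε₂ d₂ V₁ V₂ (G [ V₁ , V₂ ]) ×
    disc₂-at ε₂ d₂ V₁ V₃ (G [ V₁ , V₃ ]) ×
    disc₂-at ε₂ d₂ V₂ V₃ (G [ V₂ , V₃ ]) ×
    ((G′ : Graph n) → G′ ⊆ᴳ G →
      ∣ ↑ (tripleCount (F′ ∩³ K₃ G′)) - d₃ * ↑ (tripleCount (K₃ G′)) ∣
        ≤ ε₁ * (d₂ * d₂ * d₂) * ↑ (card V₁ ℕ.* card V₂ ℕ.* card V₃)))

------------------------------------------------------------------------
-- Decompositions

Distinct : {A : Set} → A → A → A → Set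
Distinct x y z = x ≢ y × x ≢ z × y ≢ z

-- The partition of Fin n is given by the index of the part containing each
-- vertex, and the partitions of all the K₂[Vᵢ,Vⱼ] by one symmetric colouring
-- of pairs; its values on pairs inside a part are irrelevant.
record Decomposition (n t ℓ : ℕ) (ε₁ ε₂ : ℚ) : Set where
  field
    part       : Fin n → Fin t
    colour     : Fin n → Fin n → Fin ℓ
    colour-sym : ∀ x y → colour x y ≡ colour y x

  V : Fin t → Subset n
  V i = tabulate λ x → does (part x ≟ i)

  P : Fin t → Fin t → Fin ℓ → Graph n
  P i j α = record
    { adj     = λ x y → adj (K₂ (V i) (V j)) x y ∧ does (colour x y ≟ α)
    ; adj-sym = λ x y → cong₂ _∧_ (Graph.adj-sym (K₂ (V i) (V j)) x y)
                  (cong (λ χ → does (χ ≟ α)) (colour-sym x y))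
    ; irrefl  = λ x → cong (_∧ does (colour x x ≟ α)) (Graph.irrefl (K₂ (V i) (V j)) x)
    }

  1/ℓ : .{{NonZero ℓ}} → ℚ
  1/ℓ = + 1 / ℓ

  Regular : Fin t → Fin t → Fin ℓ → Set
  Regular i j α = disc₂-at ε₂ (1/ℓ {{nonZeroIndex α}}) (V i) (V j) (P i j α)

  field
    sorted      : ∀ i j → i Fin.≤ j → card (V i) ℕ.≤ card (V j)
    balanced    : ∀ i j → card (V j) ℕ.≤ suc (card (V i))
    exceptional : ThreeGraph n
    fewExceptions : ↑ (tripleCount exceptional) ≤ ε₁ * ↑ (n ℕ.^ 3)
    regular     : ∀ x y z → Distinct x y z → edge exceptional x y z ≡ false →
      ∃[ i ] ∃[ j ] ∃[ k ] Distinct i j k ×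
      (∃[ α ] ∃[ β ] ∃[ γ ]
        (adj (P i j α) x y ≡ true × adj (P i k β) x z ≡ true × adj (P j k γ) y z ≡ true) ×
        (Regular i j α × Regular i k β × Regular j k γ))

  triad : (i j k : Fin t) (α β γ : Fin ℓ) → Graph n
  triad i j k α β γ = P i j α ∪ᴳ (P i k β ∪ᴳ P j k γ)

  TriadDisc : ThreeGraph n → (i j k : Fin t) (α β γ : Fin ℓ) → Set
  TriadDisc H i j k α β γ = disc₂,₃ ε₁ ε₂ (V i) (V j) (V k) G (H ∩³ K₃ G)
    where G = triad i j k α β γ

AdmitsBinaryDisc₂,₃Error : HereditaryProperty → Set
AdmitsBinaryDisc₂,₃Error 𝓗 =
  (t₀ ℓ₀ : ℕ) → t₀ ≥ 1 → ℓ₀ ≥ 1 →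
  (ε₁ : ℚ) → 0ℚ < ε₁ →
  (ε₂ : ℕ → ℚ) → (∀ ℓ → 0ℚ < ε₂ ℓ × ε₂ ℓ ≤ 1ℚ) →
  ∃[ N ] ∃[ T ] ∃[ L ] (∀ {n} (H : ThreeGraph n) → H ∈ᴾ 𝓗 → n ≥ N →
    ∃[ t ] ∃[ ℓ ] (t₀ ℕ.≤ t × t ℕ.≤ T) × (ℓ₀ ℕ.≤ ℓ × ℓ ℕ.≤ L) ×
    (Σ[ 𝓟 ∈ Decomposition n t ℓ ε₁ (ε₂ ℓ) ] Σ[ Γ ∈ Graph t ]
      ↑ (edgeCount Γ) ≤ ε₁ * ↑ (t ℕ.^ 2) ×
      (∀ i j k → Distinct i j k →
        adj Γ i j ≡ false → adj Γ i k ≡ false → adj Γ j k ≡ false →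
        ∀ α β γ → Decomposition.TriadDisc 𝓟 H i j k α β γ)))

{-# OPTIONS --safe #-}
-- The property consists of the 3-graphs A × E, where A is a set of vertices and
-- E a graph on the other vertices.  A triad with one part inside A
-- and two outside has the required discrepancy if its colour class between the
-- latter lies almost inside or almost outside E, for then few of its triangles are
-- edges, or few are non-edges, of A × E.  On a
-- regular pair the density of E is arbitrary, so the ℓ colour classes cannot all
-- be pure, but all impurity amounts to less than one class and, spread evenly
-- over ℓ/2 classes, is a fraction at most 2/ℓ of each.  Hence ℓ of order 1/ε₁ can
-- be fixed first, and E be regularised to an accuracy depending on ε₂(ℓ).
--
-- To split E into quasirandom classes, all pairs are beforehand given one of many
-- hues, each of low density on every large rectangle; E and its complement are
-- regularised simultaneously on all hues, and the hues are then grouped.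
--
-- The regularity lemma is proved without densities: every pair of parts carries
-- an integer weight g, and as long as the sum of F - g over some rectangle U × W in
-- Vᵢ × Vⱼ exceeds |Vᵢ||Vⱼ| in absolute value, moving g by ±1 on U × W lowers the
-- sum of the (F - g)² by at least |Vᵢ||Vⱼ|.

module Submission where

open import Defs hiding (a; b; c)
open import Algebra.Bundles using (Semiring)
open import Data.Bool using (Bool; true; false; _∧_; _∨_; not; if_then_else_)
import Data.Bool.Properties as 𝔹ₚ
open import Data.Empty using (⊥)
open import Data.Fin using (Fin; zero; suc; _≟_; _<?_; _↑ˡ_; _↑ʳ_; combine; remQuot; funToFin; finToFun; splitAt; toℕ; fromℕ<)
import Data.Fin as Fin
open import Data.Fin.Properties using (any?; 2↔Bool)
import Data.Fin.Properties as Finₚ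
open import Data.Fin.Subset using (Subset; _⊆_) renaming (∣_∣ to card)
open import Data.Fin.Subset.Properties using (anySubset?)
open import Data.Integer using (ℤ; +_; -_; +[1+_]; -[1+_]; 0ℤ; 1ℤ; -1ℤ)
  renaming (_+_ to _+ᶻ_; _*_ to _*ᶻ_; _-_ to _-ᶻ_; _≤_ to _≤ᶻ_)
import Data.Integer as ℤ
import Data.Integer.Properties as ℤₚ
open import Data.Integer.Tactic.RingSolver using () renaming (solve-∀ to solveᶻ-∀)
open import Data.Nat using (ℕ; zero; suc; _+_; _*_; _∸_; _^_; _/_; _%_; _⊔_; _≤_; _<_; _≥_; _≤?_; _<ᵇ_;
  z≤n; s≤s; NonZero; >-nonZero; >-nonZero⁻¹)
import Data.Nat as ℕ
open import Data.Nat.Divisibility using (∣-refl)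
import Data.Nat.DivMod as DivMod
import Data.Nat.Properties as ℕₚ
open import Data.Nat.Tactic.RingSolver using (solve-∀)
open import Data.Product using (Σ-syntax; ∃-syntax; _×_; _,_; proj₁; proj₂)
open import Data.Rational using (ℚ; mkℚ; 0ℚ; 1ℚ; toℚᵘ; Positive; NonNegative; positive; nonNegative)
import Data.Rational as ℚ
import Data.Rational.Properties as ℚₚ
open import Data.Rational.Solver using (module +-*-Solver)
open import Data.Rational.Unnormalised using (mkℚᵘ; *≡*)
import Data.Rational.Unnormalised as ℚᵘ
import Data.Rational.Unnormalised.Properties as ℚᵘₚ
open import Data.Sum using (_⊎_; inj₁; inj₂; [_,_]′)
import Data.Sum as Sum
open import Data.Vec using (lookup; tabulate; []; _∷_)
open import Data.Vec.Properties using (lookup∘tabulate; lookup⇒[]=; []=⇒lookup)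
open import Function using (_∘_; flip; Injection; Inverse)
open import Relation.Binary.Definitions using (tri<; tri≈; tri>)
open import Relation.Binary.PropositionalEquality hiding ([_])
open import Relation.Nullary using (Dec; does; yes; no; ¬_; contradiction)
open import Relation.Nullary.Decidable using (_×-dec_; _⊎-dec_; dec-true; dec-false)

-- The obstacle is that outside `Γ` no triad may fail, whatever its three colours, so every single
-- colour class has to be almost pure. With pair densities `1/ℓ` and `v` the product of the part
-- sizes, a triad has about `v/ℓ³` triangles and is allowed an error `ε₁ v/ℓ³`. If one side of a
-- class (inside or outside `E`) has density `O(1/ℓ²)`, there are only `O(v/ℓ⁴)` unwanted triangles;
-- the spare factor `ℓ` has to beat `1/ε₁`.
--
-- The remaining constants come in an order free of circularity: the precision `p` from `ε₂ ℓ`, the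
-- number `lam` of hues from `p` and `ℓ`, the bound `T` on the number of parts from these, and only
-- then the quality `η` of the hues from `T`. This works because the regularity lemma depends on how
-- many functions it is given and on how large they are, but not on what they are. As the hues
-- precede the partition, they have to be spread on all large rectangles at once; an explicit
-- colouring achieves this, with a second moment in place of a random choice.

private variable n t R ℓ : ℕ

-- Finite sums

module FibreSum {c ℓ} (S : Semiring c ℓ) where
  open Semiring S hiding (zero; refl)
    renaming (Carrier to C; _+_ to _⊕_; _*_ to _⊗_; trans to ≈-trans; sym to ≈-sym)
  open import Algebra.Properties.Semiring.Sum S

  δ : Bool → C
  δ b = if b then 1# else 0#

  sum-δ : ∀ {n} (a : Fin n) (f : Fin n → C) → sum (λ i → δ (does (a ≟ i)) ⊗ f i) ≈ f a
  sum-δ {suc n} zero f =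
    ≈-trans (+-cong (*-identityˡ _)
            (≈-trans (sum-cong-≋ {n} (λ i → zeroˡ (f (suc i)))) (sum-replicate-zero n)))
          (+-identityʳ _)
  sum-δ {suc n} (suc a) f =
    ≈-trans (+-cong (zeroˡ _) (sum-δ a (f ∘ suc))) (+-identityˡ _)

  -- Insert `φ (p x) x = Σᵢ δ (p x = i) φ i x` and exchange the sums. The semiring is arbitrary
  -- because counts in `ℕ` and energies in `ℤ` are both split along cells.
  sum-fibre : ∀ {n t} (p : Fin n → Fin t) (φ : Fin t → Fin n → C) →
    sum (λ x → φ (p x) x) ≈ sum (λ i → sum (λ x → δ (does (p x ≟ i)) ⊗ φ i x))
  sum-fibre {n} {t} p φ =
    ≈-trans (sum-cong-≋ {n} (λ x → ≈-sym (sum-δ (p x) (λ i → φ i x))))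
          (∑-comm {n} {t} (λ x i → δ (does (p x ≟ i)) ⊗ φ i x))

  sum-fibre₂ : ∀ {n m s t} (p : Fin n → Fin s) (q : Fin m → Fin t) (φ : Fin s → Fin t → Fin n → Fin m → C) →
    sum (λ x → sum (λ y → φ (p x) (q y) x y)) ≈
    sum (λ i → sum (λ j → sum (λ x → sum (λ y →
      δ (does (p x ≟ i)) ⊗ (δ (does (q y ≟ j)) ⊗ φ i j x y)))))
  sum-fibre₂ {n} {m} {s} {t} p q φ =
    ≈-trans (sum-fibre p (λ i x → sum (λ y → φ i (q y) x y)))
      (sum-cong-≋ {s} (λ i → ≈-trans
        (sum-cong-≋ {n} (λ x → ≈-trans (*-congˡ (sum-fibre q (λ j y → φ i j x y)))
          (≈-trans (*-distribˡ-sum _ (λ j → sum (λ y → δ (does (q y ≟ j)) ⊗ φ i j x y)))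
            (sum-cong-≋ {t} (λ j → *-distribˡ-sum _ (λ y → δ (does (q y ≟ j)) ⊗ φ i j x y))))))
        (∑-comm {n} {t} (λ x j → sum (λ y → δ (does (p x ≟ i)) ⊗ (δ (does (q y ≟ j)) ⊗ φ i j x y))))))

open import Algebra.Properties.Semiring.Sum ℕₚ.+-*-semiring
  using (sum; sum-syntax; ∑-distrib-+; ∑-comm; sum-cong-≗; *-distribˡ-sum; *-distribʳ-sum)
open ℕₚ using (≤-trans; *-monoʳ-≤; ≤-reflexive; m≤n+m; +-monoʳ-≤; m*n≢0; *-cancelˡ-≤; *-monoˡ-≤;
  m≤m+n; +-mono-≤; m≤n*m; *-zeroʳ; *-mono-≤; *-identityʳ; *-comm; *-identityˡ;
  +-monoˡ-≤; +-identityʳ; *-assoc; m≤n⊔m; m≤m⊔n; +-comm; *-distribˡ-+; n≢0⇒n>0)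
open FibreSum ℕₚ.+-*-semiring using (sum-δ; sum-fibre; sum-fibre₂)


sum-mono : {f g : Fin n → ℕ} → (∀ i → f i ≤ g i) → sum f ≤ sum g
sum-mono {zero}  f≤g = z≤n
sum-mono {suc n} f≤g = +-mono-≤ (f≤g zero) (sum-mono (f≤g ∘ suc))

sum-const : ∀ n (c : ℕ) → ∑[ i < n ] c ≡ n * c
sum-const zero    c = refl
sum-const (suc n) c = cong (_+_ c) (sum-const n c)

sum-bound : {f : Fin n → ℕ} {c : ℕ} → (∀ i → f i ≤ c) → sum f ≤ n * c
sum-bound {n} {c = c} f≤c = ≤-trans (sum-mono f≤c) (≤-reflexive (sum-const n c))

term≤sum : (f : Fin n → ℕ) (i : Fin n) → f i ≤ sum f
term≤sum f zero    = m≤m+n _ _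
term≤sum f (suc i) = ≤-trans (term≤sum (f ∘ suc) i) (m≤n+m _ _)

sum-mono-< : {f g : Fin n → ℕ} → (∀ i → f i ≤ g i) → ∀ i → f i < g i → sum f < sum g
sum-mono-< f≤g zero    f<g = ℕₚ.+-mono-<-≤ f<g (sum-mono (f≤g ∘ suc))
sum-mono-< f≤g (suc i) f<g = ℕₚ.+-mono-≤-< (f≤g zero) (sum-mono-< (f≤g ∘ suc) i f<g)

sum-↑ : ∀ a {b} (φ : Fin (a + b) → ℕ) →
  sum φ ≡ ∑[ i < a ] φ (i ↑ˡ b) + ∑[ j < b ] φ (a ↑ʳ j)
sum-↑ zero    φ = refl
sum-↑ (suc a) φ = trans (cong (_+_ (φ zero)) (sum-↑ a (φ ∘ suc))) (sym (ℕₚ.+-assoc (φ zero) _ _))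

-- Both sides are the sum of `φ` over `0, …, n` with one end term split off; this shifts the sum in
-- `hermite` by one place.
sum-snoc : ∀ n (φ : ℕ → ℕ) →
  ∑[ i < n ] φ (suc (toℕ i)) + φ 0 ≡ ∑[ i < n ] φ (toℕ i) + φ n
sum-snoc zero    φ = refl
sum-snoc (suc n) φ = trans (lem (φ 1) _ (φ 0))
    (trans (cong (_+_ (φ 0)) (sum-snoc n (φ ∘ suc))) (sym (ℕₚ.+-assoc (φ 0) _ _)))
  where
  lem : ∀ x y z → x + y + z ≡ z + (y + x)
  lem = solve-∀

sum-∑∑ : (f : Fin n → ℕ) (g : Fin t → ℕ) →
  ∑[ x < n ] ∑[ y < t ] (f x * g y) ≡ sum f * sum g
sum-∑∑ {n} f g = trans (sum-cong-≗ {n} (λ x → sym (*-distribˡ-sum (f x) g)))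
                       (sym (*-distribʳ-sum (sum g) f))

∑≡n⇒all≡1 : (f : Fin n → ℕ) → (∀ i → f i ≤ 1) → sum f ≡ n → ∀ i → f i ≡ 1
∑≡n⇒all≡1 {n} f f≤1 Σ≡n i with f i in eq
... | suc zero    = refl
... | suc (suc k) = contradiction (subst (_≤ 1) eq (f≤1 i)) λ { (s≤s ()) }
... | zero        = contradiction Σ≡n (ℕₚ.<⇒≢ (ℕₚ.<-≤-trans
      (sum-mono-< f≤1 i (subst (_< 1) (sym eq) (s≤s z≤n)))
      (≤-reflexive (trans (sum-const n 1) (*-identityʳ n)))))

𝟙≤1 : ∀ b → 𝟙 b ≤ 1
𝟙≤1 true  = s≤s z≤n
𝟙≤1 false = z≤n

𝟙-∧ : ∀ a b → 𝟙 (a ∧ b) ≡ 𝟙 a * 𝟙 b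
𝟙-∧ true  b = sym (+-identityʳ _)
𝟙-∧ false b = refl

𝟙-∨ : ∀ a b → 𝟙 (a ∨ b) ≤ 𝟙 a + 𝟙 b
𝟙-∨ true  b = s≤s z≤n
𝟙-∨ false b = ℕₚ.≤-refl

∑𝟙≤n : (f : Fin n → Bool) → ∑[ x < n ] 𝟙 (f x) ≤ n
∑𝟙≤n {n} f = ≤-trans (sum-bound (𝟙≤1 ∘ f)) (≤-reflexive (*-identityʳ n))

sum-≡𝟙 : (a : Fin n) → ∑[ i < n ] 𝟙 (does (a ≟ i)) ≡ 1
sum-≡𝟙 {n} a = trans (sum-cong-≗ {n} (λ i → sym (*-identityʳ _))) (sum-δ a (λ _ → 1))

module _ {p} {P : Set p} where

  does⇒ : (P? : Dec P) → does P? ≡ true → P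
  does⇒ (yes p) _ = p

  does⇒¬ : (P? : Dec P) → does P? ≡ false → ¬ P
  does⇒¬ (no ¬p) _ = ¬p

  𝟙-yes : (P? : Dec P) → P → 𝟙 (does P?) ≡ 1
  𝟙-yes P? p = cong 𝟙 (dec-true P? p)

  𝟙-no : (P? : Dec P) → ¬ P → 𝟙 (does P?) ≡ 0
  𝟙-no P? ¬p = cong 𝟙 (dec-false P? ¬p)

  𝟙-mono : ∀ {q} {Q : Set q} (P? : Dec P) (Q? : Dec Q) → (P → Q) → 𝟙 (does P?) ≤ 𝟙 (does Q?)
  𝟙-mono (no _)  Q? f = z≤n
  𝟙-mono (yes p) Q? f = ≤-reflexive (sym (cong 𝟙 (dec-true Q? (f p))))

-- Equitable partitions

size : (Fin n → Fin t) → Fin t → ℕ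
size {n} p i = ∑[ x < n ] 𝟙 (does (p x ≟ i))

record Equitable (p : Fin n → Fin t) : Set where
  field
    sorted   : ∀ i j → i Fin.≤ j → size p i ≤ size p j
    balanced : ∀ i j → size p j ≤ suc (size p i)

∑size≡n : (p : Fin n → Fin t) → sum (size p) ≡ n
∑size≡n {n} {t} p = trans (∑-comm {t} {n} (λ i x → 𝟙 (does (p x ≟ i))))
  (trans (sum-cong-≗ {n} (λ x → sum-≡𝟙 (p x))) (trans (sum-const n 1) (*-identityʳ n)))

module _ {p : Fin n → Fin t} (eq : Equitable p) where
  open Equitable eq

  size-upper : ∀ j → t * size p j ≤ n + t
  size-upper j = begin
    t * size p j                      ≡⟨ sum-const t _ ⟨
    ∑[ i < t ] size p j               ≤⟨ sum-mono {t} (λ i → balanced i j) ⟩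
    ∑[ i < t ] (1 + size p i)         ≡⟨ ∑-distrib-+ {t} (λ _ → 1) (size p) ⟩
    ∑[ i < t ] 1 + sum (size p)       ≡⟨ cong₂ _+_ (trans (sum-const t 1) (*-identityʳ t)) (∑size≡n p) ⟩
    t + n                             ≡⟨ +-comm t n ⟩
    n + t                             ∎
    where open ℕₚ.≤-Reasoning

  size-lower : ∀ i → n ≤ t * suc (size p i)
  size-lower i = begin
    n                                 ≡⟨ ∑size≡n p ⟨
    sum (size p)                      ≤⟨ sum-bound {t} (λ j → balanced i j) ⟩
    t * suc (size p i)                ∎
    where open ℕₚ.≤-Reasoning

-- Consecutive intervals of lengths `σ 0`, `σ 1`, ...: applied to ranks, it gives parts of
-- prescribed sizes that are intervals of the ranking.
block : (σ : Fin t → ℕ) → Fin (sum σ) → Fin t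
block {suc t} σ q with splitAt (σ zero) q
... | inj₁ _  = zero
... | inj₂ q′ = suc (block (σ ∘ suc) q′)

block-size : (σ : Fin t → ℕ) → ∀ i → size (block σ) i ≡ σ i
block-size {suc t} σ i = trans (sum-↑ (σ zero) _) (lem i)
  where
  left : ∀ q → block σ (q ↑ˡ sum (σ ∘ suc)) ≡ zero
  left q rewrite Finₚ.splitAt-↑ˡ (σ zero) q (sum (σ ∘ suc)) = refl
  right : ∀ q → block σ (σ zero ↑ʳ q) ≡ suc (block (σ ∘ suc) q)
  right q rewrite Finₚ.splitAt-↑ʳ (σ zero) (sum (σ ∘ suc)) q = refl
  lem : ∀ i → ∑[ q < σ zero ] 𝟙 (does (block σ (q ↑ˡ sum (σ ∘ suc)) ≟ i))
            + ∑[ q < sum (σ ∘ suc) ] 𝟙 (does (block σ (σ zero ↑ʳ q) ≟ i)) ≡ σ i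
  lem zero = trans (cong₂ _+_
      (trans (sum-cong-≗ {σ zero} (λ q → cong (λ j → 𝟙 (does (j ≟ zero))) (left q)))
             (trans (sum-const (σ zero) 1) (*-identityʳ _)))
      (trans (sum-cong-≗ {sum (σ ∘ suc)} (λ q → cong (λ j → 𝟙 (does (j ≟ zero))) (right q)))
             (trans (sum-const (sum (σ ∘ suc)) 0) (*-zeroʳ (sum (σ ∘ suc))))))
    (+-identityʳ _)
  lem (suc i) = cong₂ _+_
      (trans (sum-cong-≗ {σ zero} (λ q → cong (λ j → 𝟙 (does (j ≟ suc i))) (left q)))
             (trans (sum-const (σ zero) 0) (*-zeroʳ (σ zero))))
      (trans (sum-cong-≗ {sum (σ ∘ suc)} (λ q → cong (λ j → 𝟙 (does (j ≟ suc i))) (right q)))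
             (block-size (σ ∘ suc) i))

block-mono : (σ : Fin t → ℕ) → ∀ q q′ → q Fin.≤ q′ → block σ q Fin.≤ block σ q′
block-mono {suc t} σ q q′ q≤q′ with splitAt (σ zero) q in eq | splitAt (σ zero) q′ in eq′
... | inj₁ _ | _      = z≤n
... | inj₂ r | inj₂ r′ = s≤s (block-mono (σ ∘ suc) r r′ (ℕₚ.+-cancelˡ-≤ (σ zero) _ _
        (subst₂ _≤_ (trans (cong toℕ (sym (Finₚ.splitAt⁻¹-↑ʳ eq))) (Finₚ.toℕ-↑ʳ (σ zero) r))
                    (trans (cong toℕ (sym (Finₚ.splitAt⁻¹-↑ʳ eq′))) (Finₚ.toℕ-↑ʳ (σ zero) r′)) q≤q′)))
... | inj₂ r | inj₁ r′ = contradiction q≤q′ (ℕₚ.<⇒≱ (begin-strict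
        toℕ q′                  ≡⟨ cong toℕ (Finₚ.splitAt⁻¹-↑ˡ eq′) ⟨
        toℕ (r′ ↑ˡ _)           ≡⟨ Finₚ.toℕ-↑ˡ r′ _ ⟩
        toℕ r′                  <⟨ Finₚ.toℕ<n r′ ⟩
        σ zero                  ≤⟨ m≤m+n _ _ ⟩
        σ zero + toℕ r          ≡⟨ Finₚ.toℕ-↑ʳ (σ zero) r ⟨
        toℕ (σ zero ↑ʳ r)       ≡⟨ cong toℕ (Finₚ.splitAt⁻¹-↑ʳ eq) ⟩
        toℕ q                   ∎))
  where open ℕₚ.≤-Reasoning

-- Hermite's identity; the floors are the part sizes of an equitable partition. Raising `n` by one
-- shifts the summands by one place: `n / t` leaves, and `(n + t) / t = n / t + 1` enters.
hermite : ∀ t .{{_ : NonZero t}} n → ∑[ i < t ] ((n + toℕ i) / t) ≡ n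
hermite t zero    = trans (sum-cong-≗ {t} (λ i → DivMod.m<n⇒m/n≡0 (Finₚ.toℕ<n i)))
                          (trans (sum-const t 0) (*-zeroʳ t))
hermite t (suc n) = ℕₚ.+-cancelʳ-≡ (n / t) _ _ (begin
  ∑[ i < t ] ((suc n + toℕ i) / t) + n / t
    ≡⟨ cong₂ _+_ (sum-cong-≗ {t} (λ i → cong (_/ t) (sym (ℕₚ.+-suc n (toℕ i)))))
                 (cong (_/ t) (sym (+-identityʳ n))) ⟩
  ∑[ i < t ] ((n + suc (toℕ i)) / t) + (n + 0) / t
    ≡⟨ sum-snoc t (λ i → (n + i) / t) ⟩
  ∑[ i < t ] ((n + toℕ i) / t) + (n + t) / t
    ≡⟨ cong₂ _+_ (hermite t n) n+t/t ⟩
  n + (n / t + 1)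
    ≡⟨ lem n (n / t) ⟩
  suc n + n / t ∎)
  where
  open ≡-Reasoning
  lem : ∀ a b → a + (b + 1) ≡ suc (a + b)
  lem = solve-∀
  n+t/t : (n + t) / t ≡ n / t + 1
  n+t/t = trans (DivMod.+-distrib-/-∣ʳ n ∣-refl) (cong (_+_ (n / t)) (DivMod.n/n≡1 t))

-- Sorting by class and cutting into equal parts

module Sorting {n K : ℕ} (κ : Fin n → Fin K) where

  _≺_ : Fin n → Fin n → Set
  x ≺ y = (κ x Fin.< κ y) ⊎ (κ x ≡ κ y × x Fin.< y)

  _≺?_ : ∀ x y → Dec (x ≺ y)
  x ≺? y = (κ x Finₚ.<? κ y) ⊎-dec ((κ x ≟ κ y) ×-dec (x Finₚ.<? y))

  ≺-irrefl : ∀ x → ¬ x ≺ x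
  ≺-irrefl x (inj₁ p)       = ℕₚ.<-irrefl refl p
  ≺-irrefl x (inj₂ (_ , p)) = ℕₚ.<-irrefl refl p

  ≺-trans : ∀ {x y z} → x ≺ y → y ≺ z → x ≺ z
  ≺-trans (inj₁ p) (inj₁ q) = inj₁ (ℕₚ.<-trans p q)
  ≺-trans {x} (inj₁ p) (inj₂ (e , _)) = inj₁ (subst (κ x Fin.<_) e p)
  ≺-trans {z = z} (inj₂ (e , _)) (inj₁ q) = inj₁ (subst (Fin._< κ z) (sym e) q)
  ≺-trans (inj₂ (e , p)) (inj₂ (e′ , q)) = inj₂ (trans e e′ , ℕₚ.<-trans p q)

  ≺-connex : ∀ {x y} → x ≢ y → x ≺ y ⊎ y ≺ x
  ≺-connex {x} {y} x≢y with Finₚ.<-cmp (κ x) (κ y) | Finₚ.<-cmp x y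
  ... | tri< p _ _ | _ = inj₁ (inj₁ p)
  ... | tri> _ _ p | _ = inj₂ (inj₁ p)
  ... | tri≈ _ e _ | tri< p _ _ = inj₁ (inj₂ (e , p))
  ... | tri≈ _ e _ | tri> _ _ p = inj₂ (inj₂ (sym e , p))
  ... | tri≈ _ _ _ | tri≈ _ e _ = contradiction e x≢y

  below : Fin n → Fin n → ℕ
  below x y = 𝟙 (does (y ≺? x))

  rankℕ : Fin n → ℕ
  rankℕ x = sum (below x)

  rankℕ-mono : ∀ {x y} → x ≺ y → rankℕ x < rankℕ y
  rankℕ-mono {x} {y} x≺y = sum-mono-< le x lt
    where
    le : ∀ z → below x z ≤ below y z
    le z = 𝟙-mono (z ≺? x) (z ≺? y) (λ z≺x → ≺-trans z≺x x≺y)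
    lt : below x x < below y x
    lt = subst₂ _<_ (sym (𝟙-no (x ≺? x) (≺-irrefl x))) (sym (𝟙-yes (x ≺? y) x≺y)) (s≤s z≤n)

  rankℕ<n : ∀ x → rankℕ x < n
  rankℕ<n x = subst (rankℕ x <_) (trans (sum-const n 1) (*-identityʳ n))
    (sum-mono-< (λ y → 𝟙≤1 (does (y ≺? x))) x lt)
    where
    lt : below x x < 1
    lt = subst (_< 1) (sym (𝟙-no (x ≺? x) (≺-irrefl x))) (s≤s z≤n)

  rank : Fin n → Fin n
  rank x = fromℕ< (rankℕ<n x)

  rank-mono : ∀ {x y} → x ≺ y → rank x Fin.< rank y
  rank-mono {x} {y} x≺y = subst₂ _<_ (sym (Finₚ.toℕ-fromℕ< (rankℕ<n x)))
    (sym (Finₚ.toℕ-fromℕ< (rankℕ<n y))) (rankℕ-mono x≺y)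

  rank-injective : ∀ {x y} → rank x ≡ rank y → x ≡ y
  rank-injective {x} {y} e with x ≟ y
  ... | yes x≡y = x≡y
  ... | no  x≢y with ≺-connex x≢y
  ...   | inj₁ p = contradiction (cong toℕ e) (ℕₚ.<⇒≢ (rank-mono p))
  ...   | inj₂ p = contradiction (cong toℕ (sym e)) (ℕₚ.<⇒≢ (rank-mono p))

injective-fibre≤1 : ∀ {m n} (f : Fin m → Fin n) → (∀ {x y} → f x ≡ f y → x ≡ y) →
                    ∀ i → ∑[ x < m ] 𝟙 (does (f x ≟ i)) ≤ 1
injective-fibre≤1 {zero}  f inj i = z≤n
injective-fibre≤1 {suc m} f inj i with f zero ≟ i
... | no  _ = injective-fibre≤1 (f ∘ suc) (Finₚ.suc-injective ∘ inj) i
... | yes e = s≤s (≤-reflexive (trans (sum-cong-≗ {m} miss)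
                (trans (sum-const m 0) (*-zeroʳ m))))
  where
  miss : ∀ x → 𝟙 (does (f (suc x) ≟ i)) ≡ 0
  miss x with f (suc x) ≟ i
  ... | no  _  = refl
  ... | yes e′ with () ← inj {zero} {suc x} (trans e (sym e′))

-- A self-injection of `Fin n` is onto by counting: its fibres have size at most one, and the sizes
-- sum to `n`.
injective-size : (f : Fin n → Fin n) → (∀ {x y} → f x ≡ f y → x ≡ y) →
                 (φ : Fin n → Fin t) → ∀ i → size (φ ∘ f) i ≡ size φ i
injective-size {n} f inj φ i = begin
  ∑[ x < n ] 𝟙 (does (φ (f x) ≟ i))
    ≡⟨ sum-fibre f (λ q _ → 𝟙 (does (φ q ≟ i))) ⟩
  ∑[ q < n ] ∑[ x < n ] (𝟙 (does (f x ≟ q)) * 𝟙 (does (φ q ≟ i)))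
    ≡⟨ sum-cong-≗ {n} (λ q → trans (sym (*-distribʳ-sum _ (λ x → 𝟙 (does (f x ≟ q)))))
         (cong (_* 𝟙 (does (φ q ≟ i))) (fibre≡1 q))) ⟩
  ∑[ q < n ] (1 * 𝟙 (does (φ q ≟ i)))
    ≡⟨ sum-cong-≗ {n} (λ q → *-identityˡ _) ⟩
  ∑[ q < n ] 𝟙 (does (φ q ≟ i)) ∎
  where
  open ≡-Reasoning
  fibre≡1 : ∀ q → size f q ≡ 1
  fibre≡1 = ∑≡n⇒all≡1 (size f) (injective-fibre≤1 f inj) (∑size≡n f)

-- Parts of nearly equal size cannot follow the classes of `κ` exactly. Those that do not are
-- counted instead; `K` of them are few when `t` is much larger than `K`.
record Refinement {n K : ℕ} (t : ℕ) (κ : Fin n → Fin K) : Set where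
  field
    part      : Fin n → Fin t
    equitable : Equitable part
    impure    : Fin t → Bool
    pure      : ∀ i → impure i ≡ false → ∀ x y → part x ≡ i → part y ≡ i → κ x ≡ κ y
    #impure   : ∑[ i < t ] 𝟙 (impure i) ≤ K

-- Sort the vertices by `κ` and cut the sorted list into consecutive blocks: a block is impure only
-- if it straddles a border between classes.
refine : ∀ {n K} t .{{_ : NonZero t}} (κ : Fin n → Fin K) → Refinement t κ
refine {n} {K} t κ = record
  { part = part ; equitable = equitable ; impure = impure ; pure = pure ; #impure = #impure }
  where
  open Sorting κ
  -- These sizes are nondecreasing in `i`, differ by at most one, and have sum `n` by `hermite`.
  σ : Fin t → ℕ
  σ i = (n + toℕ i) / t
  cast : Fin n → Fin (sum σ)
  cast = Fin.cast (sym (hermite t n))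
  part : Fin n → Fin t
  part x = block σ (cast (rank x))
  size≡σ : ∀ i → size part i ≡ σ i
  size≡σ i = trans (injective-size rank rank-injective (block σ ∘ cast) i)
    (trans (cast-size (hermite t n)) (block-size σ i))
    where
    cast-size : ∀ {N} (e : sum σ ≡ N) →
      ∑[ q < N ] 𝟙 (does (block σ (Fin.cast (sym e) q) ≟ i)) ≡ size (block σ) i
    cast-size refl = sum-cong-≗ {sum σ}
      (λ q → cong (λ r → 𝟙 (does (block σ r ≟ i))) (Finₚ.cast-is-id refl q))
  equitable : Equitable part
  equitable = record
    { sorted   = λ i j i≤j → subst₂ _≤_ (sym (size≡σ i)) (sym (size≡σ j))
                   (DivMod./-monoˡ-≤ t (+-monoʳ-≤ n i≤j))
    ; balanced = λ i j → subst₂ _≤_ (sym (size≡σ j)) (cong suc (sym (size≡σ i))) (bal i j)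
    }
    where
    bal : ∀ i j → σ j ≤ suc (σ i)
    bal i j = begin
      (n + toℕ j) / t         ≤⟨ DivMod./-monoˡ-≤ t (+-monoʳ-≤ n (ℕₚ.<⇒≤ (Finₚ.toℕ<n j))) ⟩
      (n + t) / t             ≤⟨ DivMod./-monoˡ-≤ t (+-monoˡ-≤ t (m≤m+n n (toℕ i))) ⟩
      (n + toℕ i + t) / t     ≡⟨ DivMod.+-distrib-/-∣ʳ (n + toℕ i) ∣-refl ⟩
      σ i + t / t             ≡⟨ cong (_+_ (σ i)) (DivMod.n/n≡1 t) ⟩
      σ i + 1                 ≡⟨ +-comm (σ i) 1 ⟩
      suc (σ i)               ∎
      where
      open ℕₚ.≤-Reasoning
  part-mono : ∀ {x y} → part x Fin.< part y → κ x Fin.≤ κ y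
  part-mono {x} {y} px<py with κ x Finₚ.≤? κ y
  ... | yes le = le
  ... | no  ¬le = contradiction
        (block-mono σ (cast (rank y)) (cast (rank x))
          (subst₂ _≤_ (sym (Finₚ.toℕ-cast _ (rank y))) (sym (Finₚ.toℕ-cast _ (rank x)))
            (ℕₚ.<⇒≤ (rank-mono (inj₁ (ℕₚ.≰⇒> ¬le))))))
        (ℕₚ.<⇒≱ px<py)
  -- An impure block is charged to a value `v` that it attains together with a smaller one. Were two
  -- blocks `i < j` charged to `v`, the later one would contain a value below `v` although `v`
  -- occurs in the earlier one. So every value is charged at most once.
  Cut : Fin t → Fin K → Set
  Cut i v = ∃[ x ] ∃[ y ] (part x ≡ i × part y ≡ i × κ x ≡ v × κ y Fin.< v)
  cut? : ∀ i v → Dec (Cut i v)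
  cut? i v = any? λ x → any? λ y →
    (part x ≟ i) ×-dec (part y ≟ i) ×-dec (κ x ≟ v) ×-dec (κ y Finₚ.<? v)
  cut-unique : ∀ {i j v} → Cut i v → Cut j v → ¬ (i Fin.< j)
  cut-unique (x , _ , px , _ , κx , _) (_ , y , _ , py , _ , κy<v) i<j =
    ℕₚ.<⇒≱ κy<v (subst (Fin._≤ κ y) κx (part-mono (subst₂ Fin._<_ (sym px) (sym py) i<j)))
  impure : Fin t → Bool
  impure i = does (any? (cut? i))
  pure : ∀ i → impure i ≡ false → ∀ x y → part x ≡ i → part y ≡ i → κ x ≡ κ y
  pure i eq x y px py with does⇒¬ (any? (cut? i)) eq | Finₚ.<-cmp (κ x) (κ y)
  ... | ¬cut | tri≈ _ e _ = e
  ... | ¬cut | tri< p _ _ = contradiction (κ y , y , x , py , px , refl , p) ¬cut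
  ... | ¬cut | tri> _ _ p = contradiction (κ x , x , y , px , py , refl , p) ¬cut
  #impure : ∑[ i < t ] 𝟙 (impure i) ≤ K
  #impure = begin
    ∑[ i < t ] 𝟙 (impure i)                         ≤⟨ sum-mono {t} witness ⟩
    ∑[ i < t ] ∑[ v < K ] 𝟙 (does (cut? i v))       ≡⟨ ∑-comm {t} {K} (λ i v → 𝟙 (does (cut? i v))) ⟩
    ∑[ v < K ] ∑[ i < t ] 𝟙 (does (cut? i v))       ≤⟨ sum-bound {K} (λ v → atMostOne (λ i → cut? i v) cut-unique) ⟩
    K * 1                                           ≡⟨ *-identityʳ K ⟩
    K                                               ∎
    where
    open ℕₚ.≤-Reasoning
    witness : ∀ i → 𝟙 (impure i) ≤ ∑[ v < K ] 𝟙 (does (cut? i v))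
    witness i = go (any? (cut? i))
      where
      go : (d : Dec (∃[ v ] Cut i v)) → 𝟙 (does d) ≤ ∑[ v < K ] 𝟙 (does (cut? i v))
      go (no _)        = z≤n
      go (yes (v , c)) = ≤-trans (≤-reflexive (sym (𝟙-yes (cut? i v) c)))
                                     (term≤sum (λ v → 𝟙 (does (cut? i v))) v)
    atMostOne : ∀ {m} {P : Fin m → Set} (P? : ∀ i → Dec (P i)) →
      (∀ {i j} → P i → P j → ¬ (i Fin.< j)) → ∑[ i < m ] 𝟙 (does (P? i)) ≤ 1
    atMostOne {zero}  P? u = z≤n
    atMostOne {suc m} P? u with P? zero
    ... | no  _ = atMostOne (λ i → P? (suc i)) (λ p q i<j → u p q (s≤s i<j))
    ... | yes p = s≤s (≤-reflexive (trans
            (sum-cong-≗ {m} (λ i → cong 𝟙 (dec-false (P? (suc i)) (λ q → u p q (s≤s z≤n)))))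
            (trans (sum-const m 0) (*-zeroʳ m))))

-- The energy increment

open import Algebra.Properties.Semiring.Sum ℤₚ.+-*-semiring using ()
  renaming (sum to sumᶻ; ∑-distrib-+ to ∑ᶻ-distrib-+; ∑-comm to ∑ᶻ-comm; sum-cong-≗ to sumᶻ-cong;
            *-distribˡ-sum to *-distribˡ-sumᶻ; *-distribʳ-sum to *-distribʳ-sumᶻ)
open FibreSum ℤₚ.+-*-semiring renaming (δ to ι; sum-fibre₂ to sumᶻ-fibre₂) using ()


sumᶻ-mono : {f g : Fin n → ℤ} → (∀ i → f i ≤ᶻ g i) → sumᶻ f ≤ᶻ sumᶻ g
sumᶻ-mono {zero}  f≤g = ℤₚ.≤-refl
sumᶻ-mono {suc n} f≤g = ℤₚ.+-mono-≤ (f≤g zero) (sumᶻ-mono (f≤g ∘ suc))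

sumᶻ-+ : (f : Fin n → ℕ) → sumᶻ (λ i → + f i) ≡ + sum f
sumᶻ-+ {zero}  f = refl
sumᶻ-+ {suc n} f = cong (+ f zero +ᶻ_) (sumᶻ-+ (f ∘ suc))

sumᶻ₂-+ : (f : Fin n → Fin t → ℕ) →
  sumᶻ (λ i → sumᶻ (λ j → + f i j)) ≡ + ∑[ i < n ] ∑[ j < t ] f i j
sumᶻ₂-+ {n} f = trans (sumᶻ-cong {n} (λ i → sumᶻ-+ (f i))) (sumᶻ-+ (λ i → sum (f i)))

ι≡𝟙 : ∀ b → ι b ≡ + 𝟙 b
ι≡𝟙 true  = refl
ι≡𝟙 false = refl

sq≥0 : ∀ i → 0ℤ ≤ᶻ i *ᶻ i
sq≥0 (+ n)    = subst (0ℤ ≤ᶻ_) (ℤₚ.pos-* n n) (ℤ.+≤+ z≤n)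
sq≥0 -[1+ n ] = ℤ.+≤+ z≤n

sumᶻ₂-mono : {f g : Fin n → Fin t → ℤ} → (∀ i j → f i j ≤ᶻ g i j) →
  sumᶻ (λ i → sumᶻ (f i)) ≤ᶻ sumᶻ (λ i → sumᶻ (g i))
sumᶻ₂-mono f≤g = sumᶻ-mono (λ i → sumᶻ-mono (f≤g i))

sumᶻ₂-cong : {f g : Fin n → Fin t → ℤ} → (∀ i j → f i j ≡ g i j) →
  sumᶻ (λ i → sumᶻ (f i)) ≡ sumᶻ (λ i → sumᶻ (g i))
sumᶻ₂-cong {n} {t} f≡g = sumᶻ-cong {n} (λ i → sumᶻ-cong {t} (f≡g i))

sumᶻ₂-distrib-+ : (f g : Fin n → Fin t → ℤ) →
  sumᶻ (λ i → sumᶻ (λ j → f i j +ᶻ g i j)) ≡ sumᶻ (λ i → sumᶻ (f i)) +ᶻ sumᶻ (λ i → sumᶻ (g i))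
sumᶻ₂-distrib-+ {n} {t} f g =
  trans (sumᶻ-cong {n} (λ i → ∑ᶻ-distrib-+ {t} (f i) (g i))) (∑ᶻ-distrib-+ {n} _ _)

energy : (F G : Fin n → Fin n → ℤ) → ℤ
energy F G = sumᶻ λ x → sumᶻ λ y → (F x y -ᶻ G x y) *ᶻ (F x y -ᶻ G x y)

energy≥0 : (F G : Fin n → Fin n → ℤ) → 0ℤ ≤ᶻ energy F G
energy≥0 {n} F G = subst (_≤ᶻ energy F G) zero-sum (sumᶻ₂-mono (λ x y → sq≥0 (F x y -ᶻ G x y)))
  where
  zero-sum : sumᶻ {n} (λ _ → sumᶻ {n} (λ _ → 0ℤ)) ≡ 0ℤ
  zero-sum = trans (sumᶻ₂-+ {n} {n} (λ _ _ → 0)) (cong +_ (trans (sum-const n _)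
    (trans (cong (n *_) (trans (sum-const n 0) (*-zeroʳ n))) (*-zeroʳ n))))

-- The energy released by moving the constant c by θ on the rectangle U × W.
release : (c θ : ℤ) (F : Fin n → Fin n → ℤ) (U W : Fin n → Bool) → Fin n → Fin n → ℤ
release c θ F U W x y = ι (U x ∧ W y) *ᶻ (+ 2 *ᶻ θ *ᶻ (F x y -ᶻ c) -ᶻ θ *ᶻ θ)

private
  complete-square : ∀ b f c θ →
    (f -ᶻ (c +ᶻ θ *ᶻ ι b)) *ᶻ (f -ᶻ (c +ᶻ θ *ᶻ ι b)) +ᶻ ι b *ᶻ (+ 2 *ᶻ θ *ᶻ (f -ᶻ c) -ᶻ θ *ᶻ θ)
    ≡ (f -ᶻ c) *ᶻ (f -ᶻ c)
  complete-square true  = ring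
    where
    ring : ∀ f c θ → (f -ᶻ (c +ᶻ θ *ᶻ + 1)) *ᶻ (f -ᶻ (c +ᶻ θ *ᶻ + 1)) +ᶻ + 1 *ᶻ (+ 2 *ᶻ θ *ᶻ (f -ᶻ c) -ᶻ θ *ᶻ θ)
      ≡ (f -ᶻ c) *ᶻ (f -ᶻ c)
    ring = solveᶻ-∀
  complete-square false = ring
    where
    ring : ∀ f c θ → (f -ᶻ (c +ᶻ θ *ᶻ + 0)) *ᶻ (f -ᶻ (c +ᶻ θ *ᶻ + 0)) +ᶻ + 0 *ᶻ (+ 2 *ᶻ θ *ᶻ (f -ᶻ c) -ᶻ θ *ᶻ θ)
      ≡ (f -ᶻ c) *ᶻ (f -ᶻ c)
    ring = solveᶻ-∀

-- The two indicators cut `U × W` down to the cell `(i , j)`, so `U` and `W` may be arbitrary vertex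
-- sets and can be sought among all subsets.
gain : (p : Fin n → Fin t) (F : Fin n → Fin n → ℤ) (i j : Fin t) (c θ : ℤ) (U W : Fin n → Bool) → ℤ
gain p F i j c θ U W = sumᶻ λ x → sumᶻ λ y →
  ι (does (p x ≟ i)) *ᶻ (ι (does (p y ≟ j)) *ᶻ release c θ F U W x y)

module _ (p : Fin n → Fin t) (F : Fin n → Fin n → ℤ)
         (g θ : Fin t → Fin t → ℤ) (U W : Fin t → Fin t → Fin n → Bool) where

  adjust : Fin n → Fin n → ℤ
  adjust x y = g (p x) (p y) +ᶻ θ (p x) (p y) *ᶻ ι (U (p x) (p y) x ∧ W (p x) (p y) y)

  -- An exact identity, by completing the square at each pair of vertices: all cells may be moved at
  -- once, each along its own rectangle, and their gains add up.
  energy-adjust : energy F adjust +ᶻ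
      sumᶻ (λ i → sumᶻ λ j → gain p F i j (g i j) (θ i j) (U i j) (W i j))
    ≡ energy F (λ x y → g (p x) (p y))
  energy-adjust =
    trans (cong (energy F adjust +ᶻ_) (sym (sumᶻ-fibre₂ p p
            (λ i j → release (g i j) (θ i j) F (U i j) (W i j)))))
    (trans (sym (sumᶻ₂-distrib-+ (λ x y → (F x y -ᶻ adjust x y) *ᶻ (F x y -ᶻ adjust x y)) _))
      (sumᶻ₂-cong (λ x y → complete-square (U (p x) (p y) x ∧ W (p x) (p y) y)
         (F x y) (g (p x) (p y)) (θ (p x) (p y)))))

gain-zero : (p : Fin n → Fin t) (F : Fin n → Fin n → ℤ) (i j : Fin t) (c : ℤ) (U W : Fin n → Bool) →
  gain p F i j c 0ℤ U W ≡ 0ℤ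
gain-zero {n} p F i j c U W = trans
  (sumᶻ₂-cong {n} {n} (λ x y → ring (ι (does (p x ≟ i))) (ι (does (p y ≟ j))) (ι (U x ∧ W y)) (F x y -ᶻ c)))
  (trans (sumᶻ₂-+ {n} {n} (λ _ _ → 0)) (cong +_ (trans (sum-const n _)
    (trans (cong (n *_) (trans (sum-const n 0) (*-zeroʳ n))) (*-zeroʳ n)))))
  where
  ring : ∀ a b c d → a *ᶻ (b *ᶻ (c *ᶻ (+ 2 *ᶻ + 0 *ᶻ d -ᶻ + 0 *ᶻ + 0))) ≡ + 0
  ring = solveᶻ-∀

-- The price of a partition that is not quite a refinement. Where an impure vertex is involved the
-- weight is reset to 0, so that the energy there is `F² ≤ Q`; at most `2 n I` ordered pairs are
-- concerned, with `I` impure vertices.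
energy-almost : (F G G′ : Fin n → Fin n → ℤ) (Q : ℕ) (imp : Fin n → Bool) →
  (∀ x y → F x y *ᶻ F x y ≤ᶻ + Q) →
  (∀ x y → imp x ∨ imp y ≡ true → G′ x y ≡ 0ℤ) →
  (∀ x y → imp x ∨ imp y ≡ false → G′ x y ≡ G x y) →
  energy F G′ ≤ᶻ energy F G +ᶻ + (Q * (2 * (n * ∑[ x < n ] 𝟙 (imp x))))
energy-almost {n} F G G′ Q imp F²≤Q vanish agree = ℤₚ.≤-trans (sumᶻ₂-mono pointwise)
  (ℤₚ.≤-reflexive (trans (sumᶻ₂-distrib-+ (λ x y → (F x y -ᶻ G x y) *ᶻ (F x y -ᶻ G x y)) _)
    (cong (energy F G +ᶻ_) (trans (sumᶻ₂-+ (λ x y → Q * (𝟙 (imp x) + 𝟙 (imp y)))) (cong +_ total)))))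
  where
  I = ∑[ x < n ] 𝟙 (imp x)
  pointwise : ∀ x y → (F x y -ᶻ G′ x y) *ᶻ (F x y -ᶻ G′ x y) ≤ᶻ
    (F x y -ᶻ G x y) *ᶻ (F x y -ᶻ G x y) +ᶻ + (Q * (𝟙 (imp x) + 𝟙 (imp y)))
  pointwise x y with imp x ∨ imp y in eq
  ... | false rewrite agree x y eq = ℤₚ.i≤i+j _ _
  ... | true  rewrite vanish x y eq | ℤₚ.+-identityʳ (F x y) = ℤₚ.≤-trans (F²≤Q x y)
          (ℤₚ.≤-trans (ℤ.+≤+ (≤-trans (≤-reflexive (sym (*-identityʳ Q)))
              (*-monoʳ-≤ Q (≤-trans (≤-reflexive (cong 𝟙 (sym eq))) (𝟙-∨ (imp x) (imp y))))))
            (ℤₚ.≤-trans (ℤₚ.≤-reflexive (sym (ℤₚ.+-identityˡ _)))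
              (ℤₚ.+-monoˡ-≤ _ (sq≥0 (F x y -ᶻ G x y)))))
  total : ∑[ x < n ] ∑[ y < n ] (Q * (𝟙 (imp x) + 𝟙 (imp y))) ≡ Q * (2 * (n * I))
  total = begin
    ∑[ x < n ] ∑[ y < n ] (Q * (𝟙 (imp x) + 𝟙 (imp y)))
      ≡⟨ sum-cong-≗ {n} (λ x → trans (sym (*-distribˡ-sum Q (λ y → 𝟙 (imp x) + 𝟙 (imp y))))
           (cong (Q *_) (trans (∑-distrib-+ {n} (λ _ → 𝟙 (imp x)) (𝟙 ∘ imp))
             (cong (_+ I) (sum-const n (𝟙 (imp x))))))) ⟩
    ∑[ x < n ] (Q * (n * 𝟙 (imp x) + I))
      ≡⟨ sym (*-distribˡ-sum Q (λ x → n * 𝟙 (imp x) + I)) ⟩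
    Q * (∑[ x < n ] (n * 𝟙 (imp x) + I))
      ≡⟨ cong (Q *_) (∑-distrib-+ {n} (λ x → n * 𝟙 (imp x)) (λ _ → I)) ⟩
    Q * (∑[ x < n ] (n * 𝟙 (imp x)) + ∑[ x < n ] I)
      ≡⟨ cong (Q *_) (cong₂ _+_ (sym (*-distribˡ-sum n (𝟙 ∘ imp))) (sum-const n I)) ⟩
    Q * (n * I + n * I)
      ≡⟨ cong (Q *_) (cong (λ k → n * I + k) (sym (+-identityʳ (n * I)))) ⟩
    Q * (2 * (n * I)) ∎
    where open ≡-Reasoning

-- The regularity lemma

size-lower₂ : {p : Fin n → Fin t} → Equitable p → 2 * t ≤ n → ∀ i → n ≤ 2 * (t * size p i)
size-lower₂ {n} {t} {p} eq 2t≤n i = ℕₚ.+-cancelʳ-≤ (2 * t) n _ (begin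
  n + 2 * t                          ≤⟨ +-monoʳ-≤ n 2t≤n ⟩
  n + n                              ≤⟨ +-mono-≤ (size-lower eq i) (size-lower eq i) ⟩
  t * suc (size p i) + t * suc (size p i) ≡⟨ lem t (size p i) ⟩
  2 * (t * size p i) + 2 * t         ∎)
  where
  open ℕₚ.≤-Reasoning
  lem : ∀ t s → t * suc s + t * suc s ≡ 2 * (t * s) + 2 * t
  lem = solve-∀

size>0⇒inhabited : (p : Fin n → Fin t) (i : Fin t) → 1 ≤ size p i → ∃[ x ] p x ≡ i
size>0⇒inhabited {n} p i pos with any? (λ x → p x ≟ i)
... | yes w = w
... | no ¬w = contradiction pos (ℕₚ.<⇒≱ (s≤s (≤-reflexive
      (trans (sum-cong-≗ {n} (λ x → 𝟙-no (p x ≟ i) (λ e → ¬w (x , e))))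
             (trans (sum-const n 0) (*-zeroʳ n))))))

module _ (p : Fin n → Fin t) (F : Fin n → Fin n → ℤ) (c : ℤ) (i j : Fin t) where

  -- Irregularity is defined through the gain itself, which makes the energy increment immediate;
  -- `deviation≤` shows that without a gainful rectangle the pair is regular in the usual sense. An
  -- exhaustive search over subsets decides it.
  Gainful : ℤ → Set
  Gainful θ = ∃[ U ] ∃[ W ] + (size p i * size p j) ≤ᶻ gain p F i j c θ (lookup U) (lookup W)

  Irregular : Set
  Irregular = Gainful 1ℤ ⊎ Gainful -1ℤ

  gainful? : ∀ θ → Dec (Gainful θ)
  gainful? θ = anySubset? λ U → anySubset? λ W → _ ℤₚ.≤? _

  irregular? : Dec Irregular
  irregular? = gainful? 1ℤ ⊎-dec gainful? -1ℤ

  record Adjustment : Set where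
    field
      θ   : ℤ
      U W : Fin n → Bool
      gain≥ : + (𝟙 (does irregular?) * (size p i * size p j)) ≤ᶻ gain p F i j c θ U W

  adjustment : Adjustment
  adjustment = go irregular?
    where
    Adj : Dec Irregular → Set
    Adj d = Σ[ θ ∈ ℤ ] Σ[ U ∈ (Fin n → Bool) ] Σ[ W ∈ (Fin n → Bool) ]
      + (𝟙 (does d) * (size p i * size p j)) ≤ᶻ gain p F i j c θ U W
    weigh : ∀ θ U W → + (size p i * size p j) ≤ᶻ gain p F i j c θ U W →
            + (1 * (size p i * size p j)) ≤ᶻ gain p F i j c θ U W
    weigh θ U W = subst (λ m → + m ≤ᶻ gain p F i j c θ U W) (sym (*-identityˡ _))
    find : ∀ d → Adj d
    -- A regular cell stays as it is: with `θ = 0` every rectangle has gain 0.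
    find (no _)                    = 0ℤ , (λ _ → false) , (λ _ → false) ,
      ℤₚ.≤-reflexive (sym (gain-zero p F i j c (λ _ → false) (λ _ → false)))
    find (yes (inj₁ (U , W , le))) = 1ℤ , lookup U , lookup W , weigh 1ℤ (lookup U) (lookup W) le
    find (yes (inj₂ (U , W , le))) = -1ℤ , lookup U , lookup W , weigh -1ℤ (lookup U) (lookup W) le
    go : ∀ d → Adjustment
    go _ = let θ , U , W , le = find irregular? in record { θ = θ ; U = U ; W = W ; gain≥ = le }

bits : ∀ {m} → (Fin m → Bool) → Fin (2 ^ m)
bits b = funToFin (Inverse.from 2↔Bool ∘ b)

bits-injective : ∀ {m} {b b′ : Fin m → Bool} → bits b ≡ bits b′ → ∀ i → b i ≡ b′ i
bits-injective {m} {b} {b′} e i = begin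
  b i                                        ≡⟨ Inverse.strictlyInverseˡ 2↔Bool (b i) ⟨
  to (from (b i))                            ≡⟨ cong to (Finₚ.finToFun-funToFin (from ∘ b) i) ⟨
  to (finToFun (bits b) i)                   ≡⟨ cong (λ s → to (finToFun s i)) e ⟩
  to (finToFun (bits b′) i)                  ≡⟨ cong to (Finₚ.finToFun-funToFin (from ∘ b′) i) ⟩
  to (from (b′ i))                           ≡⟨ Inverse.strictlyInverseˡ 2↔Bool (b′ i) ⟩
  b′ i                                       ∎
  where
  open ≡-Reasoning
  open Inverse 2↔Bool using (to; from)

module Regularity (R Q h : ℕ) .{{h≢0 : NonZero h}} where

  -- A single partition serves all `R` functions, since it is the sum of their energies that is
  -- driven down; only the weights `g` depend on the function.
  record State {n} (F : Fin R → Fin n → Fin n → ℤ) (A : Fin n → Bool) (t : ℕ) : Set where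
    field
      part      : Fin n → Fin t
      equitable : Equitable part
      impure    : Fin t → Bool
      pure      : ∀ i → impure i ≡ false → ∀ x y → part x ≡ i → part y ≡ i → A x ≡ A y
      #impure   : h * ∑[ i < t ] 𝟙 (impure i) ≤ t
      g         : Fin R → Fin t → Fin t → ℤ

    Bad : Fin t → Fin t → Set
    Bad i j = ∃[ r ] Irregular part (F r) (g r i j) i j

    bad? : ∀ i j → Dec (Bad i j)
    bad? i j = any? λ r → irregular? part (F r) (g r i j) i j

    #bad : ℕ
    #bad = ∑[ i < t ] ∑[ j < t ] 𝟙 (does (bad? i j))

    total : ℤ
    total = sumᶻ λ r → energy (F r) (λ x y → g r (part x) (part y))

  open State

  -- A class of the new atoms is given by the value of `A`, the old part, and `R * t` bits each for
  -- membership in the sets `U` and `W` chosen for that part. The further factor in `next` makes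
  -- impure parts so rare that they undo at most half of what an irregular state releases, see
  -- `loss≤` and `step`.
  atoms next : ℕ → ℕ
  atoms t = 2 * (t * (2 ^ (R * t) * 2 ^ (R * t)))
  next t = atoms t * (32 * h * suc (R * Q))

  module _ {n} (F : Fin R → Fin n → Fin n → ℤ) (A : Fin n → Bool)
           (F²≤Q : ∀ r x y → F r x y *ᶻ F r x y ≤ᶻ + Q) where

    -- Replaces the atoms of `κ` by an equitable partition. As `G` depends on atoms only, it is
    -- constant on pairs of pure parts and survives there as a weight.
    refresh : ∀ {t K} (κ : Fin n → Fin K) → (∀ x y → κ x ≡ κ y → A x ≡ A y) →
      h * K ≤ t → 2 * t ≤ n → 1 ≤ t →
      (G : Fin R → Fin n → Fin n → ℤ) →
      (∀ r x x′ y y′ → κ x ≡ κ x′ → κ y ≡ κ y′ → G r x y ≡ G r x′ y′) →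
      Σ[ S ∈ State F A t ] Σ[ I ∈ ℕ ] (t * I ≤ K * (n + t)) ×
        total S ≤ᶻ (sumᶻ λ r → energy (F r) (G r)) +ᶻ + (R * (Q * (2 * (n * I))))
    refresh {t} {K} κ κ⇒A hK≤t 2t≤n 1≤t G G-κ = S , I , tI , bound
      where
      module ρ = Refinement (refine t {{>-nonZero 1≤t}} κ)
      inhabited : ∀ i → ∃[ x ] ρ.part x ≡ i
      inhabited i = size>0⇒inhabited ρ.part i
        (ℕₚ.≤-pred (*-cancelˡ-≤ t {{>-nonZero 1≤t}} (≤-trans (≤-reflexive (*-comm t 2))
          (≤-trans 2t≤n (size-lower ρ.equitable i)))))
      rep : Fin t → Fin n
      rep = proj₁ ∘ inhabited
      -- On pure parts any representative gives the right value; next to an impure part the weight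
      -- is 0, which keeps the energy below `Q` per pair of vertices.
      g′ : Fin R → Fin t → Fin t → ℤ
      g′ r i j = if ρ.impure i ∨ ρ.impure j then 0ℤ else G r (rep i) (rep j)
      imp : Fin n → Bool
      imp = ρ.impure ∘ ρ.part
      I = ∑[ x < n ] 𝟙 (imp x)
      S : State F A t
      S = record
        { part = ρ.part ; equitable = ρ.equitable ; impure = ρ.impure
        ; pure = λ i e x y px py → κ⇒A x y (ρ.pure i e x y px py)
        ; #impure = ≤-trans (*-monoʳ-≤ h ρ.#impure) hK≤t
        ; g = g′ }
      tI : t * I ≤ K * (n + t)
      tI = begin
        t * I
          ≡⟨ cong (t *_) (sum-fibre ρ.part (λ i _ → 𝟙 (ρ.impure i))) ⟩
        t * ∑[ i < t ] ∑[ x < n ] (𝟙 (does (ρ.part x ≟ i)) * 𝟙 (ρ.impure i))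
          ≡⟨ cong (t *_) (sum-cong-≗ {t} (λ i → sym (*-distribʳ-sum (𝟙 (ρ.impure i)) (λ x → 𝟙 (does (ρ.part x ≟ i)))))) ⟩
        t * ∑[ i < t ] (size ρ.part i * 𝟙 (ρ.impure i))
          ≡⟨ *-distribˡ-sum t (λ i → size ρ.part i * 𝟙 (ρ.impure i)) ⟩
        ∑[ i < t ] (t * (size ρ.part i * 𝟙 (ρ.impure i)))
          ≤⟨ sum-mono {t} (λ i → ≤-trans (≤-reflexive (sym (*-assoc t _ _)))
               (*-monoˡ-≤ (𝟙 (ρ.impure i)) (size-upper ρ.equitable i))) ⟩
        ∑[ i < t ] ((n + t) * 𝟙 (ρ.impure i))
          ≡⟨ *-distribˡ-sum (n + t) (𝟙 ∘ ρ.impure) ⟨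
        (n + t) * ∑[ i < t ] 𝟙 (ρ.impure i)
          ≤⟨ *-monoʳ-≤ (n + t) ρ.#impure ⟩
        (n + t) * K
          ≡⟨ *-comm (n + t) K ⟩
        K * (n + t) ∎
        where open ℕₚ.≤-Reasoning
      agree : ∀ r x y → imp x ∨ imp y ≡ false → g′ r (ρ.part x) (ρ.part y) ≡ G r x y
      agree r x y e = trans (cong (λ b → if b then 0ℤ else G r (rep (ρ.part x)) (rep (ρ.part y))) e)
        (G-κ r _ _ _ _
          (ρ.pure _ (𝔹ₚ.∨-conicalˡ (imp x) (imp y) e) _ _ (proj₂ (inhabited (ρ.part x))) refl)
          (ρ.pure _ (𝔹ₚ.∨-conicalʳ (imp x) (imp y) e) _ _ (proj₂ (inhabited (ρ.part y))) refl))
      bound : total S ≤ᶻ (sumᶻ λ r → energy (F r) (G r)) +ᶻ + (R * (Q * (2 * (n * I))))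
      bound = ℤₚ.≤-trans
        (sumᶻ-mono {R} (λ r → energy-almost (F r) (G r) (λ x y → g′ r (ρ.part x) (ρ.part y)) Q imp (F²≤Q r)
          (λ x y e → cong (λ b → if b then 0ℤ else G r (rep (ρ.part x)) (rep (ρ.part y))) e)
          (agree r)))
        (ℤₚ.≤-reflexive (trans (∑ᶻ-distrib-+ {R} (λ r → energy (F r) (G r)) _)
          (cong ((sumᶻ λ r → energy (F r) (G r)) +ᶻ_)
            (trans (sumᶻ-+ {R} (λ _ → Q * (2 * (n * I)))) (cong +_ (sum-const R _))))))

    module Increment {t} (S : State F A t) where
      private
        module S = State S
        choice : ∀ r i j → Adjustment S.part (F r) (S.g r i j) i j
        choice r i j = adjustment S.part (F r) (S.g r i j) i j
        θ : Fin R → Fin t → Fin t → ℤ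
        θ r i j = Adjustment.θ (choice r i j)
        U W : Fin R → Fin t → Fin t → Fin n → Bool
        U r i j = Adjustment.U (choice r i j)
        W r i j = Adjustment.W (choice r i j)

      G : Fin R → Fin n → Fin n → ℤ
      G r = adjust S.part (F r) (S.g r) (θ r) (U r) (W r)

      -- The common refinement of `A`, the old parts and all the chosen rectangles. For a vertex
      -- only the rectangles having its own part as a side matter, so `R * t` bits suffice for
      -- either side.
      κ : Fin n → Fin (atoms t)
      κ x = combine (Inverse.from 2↔Bool (A x)) (combine (S.part x)
        (combine (bits {R * t} (λ e → let r , j = remQuot t e in U r (S.part x) j x))
                 (bits {R * t} (λ e → let r , i = remQuot t e in W r i (S.part x) x))))

      κ-split : ∀ x x′ → κ x ≡ κ x′ → A x ≡ A x′ × S.part x ≡ S.part x′ ×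
        (∀ r j → U r (S.part x) j x ≡ U r (S.part x′) j x′) ×
        (∀ r i → W r i (S.part x) x ≡ W r i (S.part x′) x′)
      κ-split x x′ e =
        let eA , e₁ = Finₚ.combine-injective _ _ _ _ e
            ep , e₂ = Finₚ.combine-injective _ _ _ _ e₁
            eU , eW = Finₚ.combine-injective _ _ _ _ e₂
        in trans (sym (Inverse.strictlyInverseˡ 2↔Bool (A x)))
             (trans (cong (Inverse.to 2↔Bool) eA) (Inverse.strictlyInverseˡ 2↔Bool (A x′)))
         , ep
         , (λ r j → subst (λ rj → U (proj₁ rj) (S.part x) (proj₂ rj) x ≡ U (proj₁ rj) (S.part x′) (proj₂ rj) x′)
              (Finₚ.remQuot-combine r j) (bits-injective eU (combine r j)))
         , (λ r i → subst (λ ri → W (proj₁ ri) (proj₂ ri) (S.part x) x ≡ W (proj₁ ri) (proj₂ ri) (S.part x′) x′)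
              (Finₚ.remQuot-combine r i) (bits-injective eW (combine r i)))

      κ⇒A : ∀ x y → κ x ≡ κ y → A x ≡ A y
      κ⇒A x y e = proj₁ (κ-split x y e)

      G-κ : ∀ r x x′ y y′ → κ x ≡ κ x′ → κ y ≡ κ y′ → G r x y ≡ G r x′ y′
      G-κ r x x′ y y′ ex ey =
        let _ , px , ux , _ = κ-split x x′ ex
            _ , py , _ , wy = κ-split y y′ ey
        in cong₂ _+ᶻ_ (cong₂ (S.g r) px py)
          (cong₂ _*ᶻ_ (cong₂ (θ r) px py)
            (cong ι (cong₂ _∧_
              (trans (ux r (S.part y)) (cong (λ j → U r (S.part x′) j x′) py))
              (trans (wy r (S.part x)) (cong (λ i → W r i (S.part y′) y′) px)))))

      gainℕ : ℕ
      gainℕ = ∑[ i < t ] ∑[ j < t ] (𝟙 (does (S.bad? i j)) * (size S.part i * size S.part j))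

      -- A pair of parts that is bad for several functions counts once in `gainℕ`, hence the
      -- inequality `bad≤`; a function regular on the pair has gain at least 0 there.
      energy-drop : (sumᶻ λ r → energy (F r) (G r)) +ᶻ + gainℕ ≤ᶻ S.total
      energy-drop = begin
        (sumᶻ λ r → energy (F r) (G r)) +ᶻ + gainℕ
          ≤⟨ ℤₚ.+-monoʳ-≤ (sumᶻ λ r → energy (F r) (G r)) gain≤ ⟩
        (sumᶻ λ r → energy (F r) (G r)) +ᶻ (sumᶻ λ r → gains r)
          ≡⟨ sym (∑ᶻ-distrib-+ {R} (λ r → energy (F r) (G r)) gains) ⟩
        (sumᶻ λ r → energy (F r) (G r) +ᶻ gains r)
          ≡⟨ sumᶻ-cong {R} (λ r → energy-adjust S.part (F r) (S.g r) (θ r) (U r) (W r)) ⟩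
        S.total ∎
        where
        open ℤₚ.≤-Reasoning
        m : Fin t → Fin t → ℕ
        m i j = size S.part i * size S.part j
        irr : Fin R → Fin t → Fin t → ℕ
        irr r i j = 𝟙 (does (irregular? S.part (F r) (S.g r i j) i j))
        gains : Fin R → ℤ
        gains r = sumᶻ λ i → sumᶻ λ j → gain S.part (F r) i j (S.g r i j) (θ r i j) (U r i j) (W r i j)
        bad≤ : ∀ i j → 𝟙 (does (S.bad? i j)) ≤ ∑[ r < R ] irr r i j
        bad≤ i j = go (S.bad? i j)
          where
          go : (d : Dec (S.Bad i j)) → 𝟙 (does d) ≤ ∑[ r < R ] irr r i j
          go (no _)        = z≤n
          go (yes (r , b)) = ≤-trans
            (≤-reflexive (sym (𝟙-yes (irregular? S.part (F r) (S.g r i j) i j) b)))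
            (term≤sum (λ r → irr r i j) r)
        gain≤ : + gainℕ ≤ᶻ sumᶻ gains
        gain≤ = begin
          + gainℕ
            ≤⟨ ℤ.+≤+ (sum-mono {t} (λ i → sum-mono {t} (λ j → *-monoˡ-≤ (m i j) (bad≤ i j)))) ⟩
          + ∑[ i < t ] ∑[ j < t ] (∑[ r < R ] irr r i j * m i j)
            ≡⟨ cong +_ (trans (sum-cong-≗ {t} (λ i → trans (sum-cong-≗ {t} (λ j → *-distribʳ-sum (m i j) (λ r → irr r i j)))
                 (∑-comm {t} {R} (λ j r → irr r i j * m i j))))
                 (∑-comm {t} {R} (λ i r → ∑[ j < t ] (irr r i j * m i j)))) ⟩
          + ∑[ r < R ] ∑[ i < t ] ∑[ j < t ] (irr r i j * m i j)
            ≡⟨ sym (sumᶻ-+ (λ r → ∑[ i < t ] ∑[ j < t ] (irr r i j * m i j))) ⟩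
          sumᶻ (λ r → + ∑[ i < t ] ∑[ j < t ] (irr r i j * m i j))
            ≤⟨ sumᶻ-mono {R} (λ r → ℤₚ.≤-trans (ℤₚ.≤-reflexive (sym (sumᶻ₂-+ (λ i j → irr r i j * m i j))))
                 (sumᶻ₂-mono (λ i j → Adjustment.gain≥ (choice r i j)))) ⟩
          sumᶻ gains ∎

+ᶻ-cancelʳ-≤ : ∀ {i j} k → i +ᶻ k ≤ᶻ j +ᶻ k → i ≤ᶻ j
+ᶻ-cancelʳ-≤ {i} {j} k le = subst₂ _≤ᶻ_ (ring i k) (ring j k) (ℤₚ.+-monoˡ-≤ (- k) le)
  where
  ring : ∀ i k → i +ᶻ k +ᶻ - k ≡ i
  ring = solveᶻ-∀

-- Iterating the energy increment

module RegularityLemma (R Q h : ℕ) .{{h≢0 : NonZero h}} where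
  open Regularity R Q h

  2t≤atoms : ∀ t → 2 * t ≤ atoms t
  2t≤atoms t = *-monoʳ-≤ 2 (≤-trans (≤-reflexive (sym (*-identityʳ t)))
    (*-monoʳ-≤ t (*-mono-≤ (ℕₚ.m^n>0 2 (R * t)) (ℕₚ.m^n>0 2 (R * t)))))

  module _ (t : ℕ) where
    private K = atoms t

    h*atoms≤next : h * K ≤ next t
    h*atoms≤next = begin
      h * K                           ≡⟨ *-comm h K ⟩
      K * h                           ≤⟨ *-monoʳ-≤ K (m≤n*m h 32) ⟩
      K * (32 * h)                    ≤⟨ *-monoʳ-≤ K (ℕₚ.m≤m*n (32 * h) (suc (R * Q))) ⟩
      K * (32 * h * suc (R * Q))      ∎
      where open ℕₚ.≤-Reasoning

    atoms≤next : K ≤ next t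
    atoms≤next = ≤-trans (m≤n*m K h) h*atoms≤next

    2t≤next : 2 * t ≤ next t
    2t≤next = ≤-trans (2t≤atoms t) atoms≤next

    t≤next : t ≤ next t
    t≤next = ≤-trans (m≤n*m t 2) 2t≤next

  -- The impure parts hold at most a share `2 * atoms t / next t` of the vertices; the factor
  -- `32 * h * suc (R * Q)` of `next` is made for this estimate.
  loss≤ : ∀ {n t I} → 1 ≤ t → next t ≤ n → next t * I ≤ atoms t * (n + next t) →
    8 * h * (R * (Q * (2 * (n * I)))) ≤ n * n
  loss≤ {n} {t} {I} 1≤t t′≤n t′I = *-cancelˡ-≤ (next t) {{>-nonZero (≤-trans 1≤t (t≤next t))}} (begin
    next t * (8 * h * (R * (Q * (2 * (n * I)))))
      ≡⟨ ring₁ (next t) h R Q n I ⟩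
    16 * h * (R * Q) * n * (next t * I)
      ≤⟨ *-monoʳ-≤ (16 * h * (R * Q) * n) (≤-trans t′I
           (*-monoʳ-≤ (atoms t) (+-monoʳ-≤ n t′≤n))) ⟩
    16 * h * (R * Q) * n * (atoms t * (n + n))
      ≡⟨ ring₂ h (R * Q) n (atoms t) ⟩
    atoms t * (32 * h * (R * Q)) * (n * n)
      ≤⟨ *-monoˡ-≤ (n * n) (*-monoʳ-≤ (atoms t) (*-monoʳ-≤ (32 * h) (ℕₚ.n≤1+n (R * Q)))) ⟩
    next t * (n * n) ∎)
    where
    open ℕₚ.≤-Reasoning
    ring₁ : ∀ t h R Q n I → t * (8 * h * (R * (Q * (2 * (n * I))))) ≡ 16 * h * (R * Q) * n * (t * I)
    ring₁ = solve-∀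
    ring₂ : ∀ h q n K → 16 * h * q * n * (K * (n + n)) ≡ K * (32 * h * q) * (n * n)
    ring₂ = solve-∀

  threshold bound : ℕ → ℕ → ℕ
  -- Even without fuel an irregular state takes one more step, namely to a contradiction, so
  -- `next t` still has to fit; the `suc` makes `n` positive.
  threshold zero    t = suc (2 * next t)
  threshold (suc k) t = suc (2 * next t) ⊔ threshold k (next t)
  bound zero    t = t
  bound (suc k) t = t ⊔ bound k (next t)

  module _ {n} (F : Fin R → Fin n → Fin n → ℤ) (A : Fin n → Bool)
           (F²≤Q : ∀ r x y → F r x y *ᶻ F r x y ≤ᶻ + Q) where

    Regular : ∀ {t} → State F A t → Set
    Regular {t} S = h * State.#bad S ≤ t * t

    module _ {t} (S : State F A t) (1≤t : 1 ≤ t) (2t≤n : 2 * t ≤ n) where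
      open Increment F A F²≤Q S
      open State S

      -- There are more than `t²/h` bad pairs, and each releases `|Vᵢ||Vⱼ| ≥ (n/2t)²`.
      gain≥ : ¬ Regular S → n * n ≤ 4 * h * gainℕ
      gain≥ ¬reg = *-cancelˡ-≤ (t * t) {{>-nonZero (*-mono-≤ 1≤t 1≤t)}} (begin
        t * t * (n * n)
          ≤⟨ *-monoˡ-≤ (n * n) (ℕₚ.<⇒≤ (ℕₚ.≰⇒> ¬reg)) ⟩
        h * #bad * (n * n)
          ≡⟨ trans (*-assoc h #bad (n * n)) (cong (h *_) pull) ⟩
        h * ∑[ i < t ] ∑[ j < t ] (β i j * (n * n))
          ≤⟨ *-monoʳ-≤ h (sum-mono {t} (λ i → sum-mono {t} (λ j →
               ≤-trans (*-monoʳ-≤ (β i j) (cell i j))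
                 (≤-reflexive (ring₁ (β i j) (t * t) (m i j)))))) ⟩
        h * ∑[ i < t ] ∑[ j < t ] (4 * (t * t) * (β i j * m i j))
          ≡⟨ cong (h *_) (trans (sum-cong-≗ {t} (λ i → sym (*-distribˡ-sum (4 * (t * t)) (λ j → β i j * m i j))))
               (sym (*-distribˡ-sum (4 * (t * t)) (λ i → ∑[ j < t ] (β i j * m i j))))) ⟩
        h * (4 * (t * t) * gainℕ)
          ≡⟨ ring₂ h (t * t) gainℕ ⟩
        t * t * (4 * h * gainℕ) ∎)
        where
        open ℕₚ.≤-Reasoning
        β m : Fin t → Fin t → ℕ
        β i j = 𝟙 (does (bad? i j))
        m i j = size part i * size part j
        ring₁ : ∀ b t m → b * (4 * (t * m)) ≡ 4 * t * (b * m)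
        ring₁ = solve-∀
        ring₂ : ∀ h t g → h * (4 * t * g) ≡ t * (4 * h * g)
        ring₂ = solve-∀
        ring₃ : ∀ t a b → 2 * (t * a) * (2 * (t * b)) ≡ 4 * (t * t * (a * b))
        ring₃ = solve-∀
        cell : ∀ i j → n * n ≤ 4 * (t * t * m i j)
        cell i j = ≤-trans (*-mono-≤ (size-lower₂ equitable 2t≤n i) (size-lower₂ equitable 2t≤n j))
          (≤-reflexive (ring₃ t (size part i) (size part j)))
        pull : #bad * (n * n) ≡ ∑[ i < t ] ∑[ j < t ] (β i j * (n * n))
        pull = trans (*-distribʳ-sum (n * n) (λ i → ∑[ j < t ] β i j))
          (sum-cong-≗ {t} (λ i → *-distribʳ-sum (n * n) (β i)))

    -- In units of `1/(8h)`, the bad pairs release at least `2 n²` and the impure parts cost at most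
    -- `n²`.
    step : ∀ {t} (S : State F A t) → 1 ≤ t → 2 * next t ≤ n → ¬ Regular S →
      Σ[ S′ ∈ State F A (next t) ]
        + (8 * h) *ᶻ State.total S′ +ᶻ + (n * n) ≤ᶻ + (8 * h) *ᶻ State.total S
    step {t} S 1≤t 2t′≤n ¬reg = let S′ , I , t′I , le = refreshed in S′ , conclude S′ I t′I le
      where
      open Increment F A F²≤Q S
      t′≤n = ≤-trans (m≤n*m (next t) 2) 2t′≤n
      refreshed = refresh F A F²≤Q κ κ⇒A (h*atoms≤next t) 2t′≤n (≤-trans 1≤t (t≤next t)) G G-κ
      mid = sumᶻ λ r → energy (F r) (G r)
      conclude : ∀ S′ I → next t * I ≤ atoms t * (n + next t) →
        State.total S′ ≤ᶻ mid +ᶻ + (R * (Q * (2 * (n * I)))) →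
        + (8 * h) *ᶻ State.total S′ +ᶻ + (n * n) ≤ᶻ + (8 * h) *ᶻ State.total S
      conclude S′ I t′I le = begin
        + (8 * h) *ᶻ State.total S′ +ᶻ + (n * n)
          ≤⟨ ℤₚ.+-monoˡ-≤ (+ (n * n)) (ℤₚ.*-monoˡ-≤-nonNeg (+ (8 * h)) le) ⟩
        + (8 * h) *ᶻ (mid +ᶻ + L) +ᶻ + (n * n)
          ≡⟨ cong (_+ᶻ + (n * n)) (trans (ℤₚ.*-distribˡ-+ (+ (8 * h)) mid (+ L))
               (cong (+ (8 * h) *ᶻ mid +ᶻ_) (sym (ℤₚ.pos-* (8 * h) L)))) ⟩
        + (8 * h) *ᶻ mid +ᶻ + (8 * h * L) +ᶻ + (n * n)
          ≡⟨ ℤₚ.+-assoc (+ (8 * h) *ᶻ mid) _ _ ⟩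
        + (8 * h) *ᶻ mid +ᶻ + (8 * h * L + n * n)
          ≤⟨ ℤₚ.+-monoʳ-≤ (+ (8 * h) *ᶻ mid) (ℤ.+≤+ budget) ⟩
        + (8 * h) *ᶻ mid +ᶻ + (8 * h * gainℕ)
          ≡⟨ trans (cong (+ (8 * h) *ᶻ mid +ᶻ_) (ℤₚ.pos-* (8 * h) gainℕ))
               (sym (ℤₚ.*-distribˡ-+ (+ (8 * h)) mid (+ gainℕ))) ⟩
        + (8 * h) *ᶻ (mid +ᶻ + gainℕ)
          ≤⟨ ℤₚ.*-monoˡ-≤-nonNeg (+ (8 * h)) energy-drop ⟩
        + (8 * h) *ᶻ State.total S ∎
        where
        open ℤₚ.≤-Reasoning
        L = R * (Q * (2 * (n * I)))
        2t≤n : 2 * t ≤ n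
        2t≤n = ≤-trans (2t≤next t) t′≤n
        ring : ∀ h g → 4 * h * g + 4 * h * g ≡ 8 * h * g
        ring = solve-∀
        budget : 8 * h * L + n * n ≤ 8 * h * gainℕ
        budget = ≤-trans (+-mono-≤
            (≤-trans (loss≤ 1≤t t′≤n t′I) (gain≥ S 1≤t 2t≤n ¬reg)) (gain≥ S 1≤t 2t≤n ¬reg))
          (≤-reflexive (ring h gainℕ))

    Result : ℕ → ℕ → Set
    Result lo hi = ∃[ t ] (lo ≤ t × t ≤ hi) × Σ[ S ∈ State F A t ] Regular S

    -- The fuel `k` bounds the energy in units of `n²/(8h)`, and every step uses up at least one
    -- unit.
    iterate : ∀ k {t} → 1 ≤ t → threshold k t ≤ n → (S : State F A t) →
      + (8 * h) *ᶻ State.total S ≤ᶻ + (k * (n * n)) → Result t (bound k t)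
    iterate zero {t} 1≤t N≤n S le with h * State.#bad S ≤? t * t
    ... | yes reg = t , (ℕₚ.≤-refl , ℕₚ.≤-refl) , S , reg
    -- The drop would force `8h` times a nonnegative energy, plus `n²`, to be at most 0.
    ... | no ¬reg = let S′ , drop = step S 1≤t (≤-trans (ℕₚ.n≤1+n _) N≤n) ¬reg in
          contradiction (ℤₚ.≤-trans (ℤₚ.+-monoˡ-≤ (+ (n * n)) (nonneg S′)) (ℤₚ.≤-trans drop le))
            λ { (ℤ.+≤+ n²≤0) → ℕₚ.<⇒≱ (*-mono-≤ 1≤n 1≤n) n²≤0 }
      where
      1≤n : 1 ≤ n
      1≤n = ≤-trans (s≤s z≤n) N≤n
      nonneg : (S′ : State F A (next t)) → 0ℤ ≤ᶻ + (8 * h) *ᶻ State.total S′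
      nonneg S′ = ℤₚ.≤-trans (ℤₚ.≤-reflexive (sym (ℤₚ.*-zeroʳ (+ (8 * h)))))
        (ℤₚ.*-monoˡ-≤-nonNeg (+ (8 * h)) (ℤₚ.≤-trans
          (ℤₚ.≤-reflexive (sym (trans (sumᶻ-+ {R} (λ _ → 0)) (cong +_ (trans (sum-const R 0) (*-zeroʳ R))))))
          (sumᶻ-mono {R} (λ r → energy≥0 (F r) _))))
    iterate (suc k) {t} 1≤t N≤n S le with h * State.#bad S ≤? t * t
    ... | yes reg = t , (ℕₚ.≤-refl , m≤m⊔n _ _) , S , reg
    ... | no ¬reg =
          let S′ , drop = step S 1≤t (≤-trans (ℕₚ.n≤1+n _) (≤-trans (m≤m⊔n (suc (2 * next t)) (threshold k (next t))) N≤n)) ¬reg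
              t′ , (lo , hi) , S″ , reg = iterate k (≤-trans 1≤t (t≤next t))
                (≤-trans (m≤n⊔m (suc (2 * next t)) _) N≤n) S′ (cancel drop)
          in t′ , (≤-trans (t≤next t) lo , ≤-trans hi (m≤n⊔m t _)) , S″ , reg
      where
      cancel : ∀ {E} → E +ᶻ + (n * n) ≤ᶻ + (8 * h) *ᶻ State.total S → E ≤ᶻ + (k * (n * n))
      cancel drop = +ᶻ-cancelʳ-≤ (+ (n * n)) (ℤₚ.≤-trans drop (ℤₚ.≤-trans le
        (ℤₚ.≤-reflexive (cong +_ (+-comm (n * n) (k * (n * n)))))))

  module _ (t₀ : ℕ) where
    -- In `t₁`, the summand `2 * h` keeps impure parts few when only `A` is separated (two atoms),
    -- and 4 yields `I ≤ n`. With all weights 0 the initial energy is at most `R Q n²`, and the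
    -- impure parts add at most `2 R Q n²`; three times `8 * h` gives the 24.
    t₁ fuel : ℕ
    t₁ = 4 + (t₀ + 2 * h)
    fuel = 24 * h * (R * Q)

    regularity : ∀ {n} (F : Fin R → Fin n → Fin n → ℤ) (A : Fin n → Bool)
      (F²≤Q : ∀ r x y → F r x y *ᶻ F r x y ≤ᶻ + Q) → 2 * t₁ ⊔ threshold fuel t₁ ≤ n →
      Result F A F²≤Q t₀ (bound fuel t₁)
    regularity {n} F A F²≤Q N≤n =
      let S , I , tI , le = refresh F A F²≤Q κ κ⇒A (≤-trans (≤-reflexive (*-comm h 2))
                              (≤-trans (m≤n+m (2 * h) t₀) (m≤n+m _ 4)))
                              2t₁≤n (s≤s z≤n) (λ _ _ _ → 0ℤ) (λ _ _ _ _ _ _ _ → refl)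
          t , (lo , hi) , S′ , reg = iterate F A F²≤Q fuel (s≤s z≤n) (≤-trans (m≤n⊔m (2 * t₁) _) N≤n) S
                                       (start S I tI le)
      in t , (≤-trans (≤-trans (m≤m+n t₀ (2 * h)) (m≤n+m _ 4)) lo , hi) , S′ , reg
      where
      κ : Fin n → Fin 2
      κ x = Inverse.from 2↔Bool (A x)
      κ⇒A : ∀ x y → κ x ≡ κ y → A x ≡ A y
      κ⇒A x y e = trans (sym (Inverse.strictlyInverseˡ 2↔Bool (A x)))
             (trans (cong (Inverse.to 2↔Bool) e) (Inverse.strictlyInverseˡ 2↔Bool (A y)))
      2t₁≤n = ≤-trans (m≤m⊔n (2 * t₁) (threshold fuel t₁)) N≤n
      I≤n : ∀ I → t₁ * I ≤ 2 * (n + t₁) → I ≤ n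
      I≤n I tI = *-cancelˡ-≤ 4 (begin
        4 * I          ≤⟨ *-monoˡ-≤ I (m≤m+n 4 (t₀ + 2 * h)) ⟩
        t₁ * I         ≤⟨ tI ⟩
        2 * (n + t₁)   ≤⟨ *-monoʳ-≤ 2 (+-monoʳ-≤ n (≤-trans (m≤n*m t₁ 2) 2t₁≤n)) ⟩
        2 * (n + n)    ≡⟨ ring n ⟩
        4 * n          ∎)
        where
        open ℕₚ.≤-Reasoning
        ring : ∀ n → 2 * (n + n) ≡ 4 * n
        ring = solve-∀
      flat : ∀ r → energy (F r) (λ _ _ → 0ℤ) ≤ᶻ + (n * (n * Q))
      flat r = ℤₚ.≤-trans (sumᶻ₂-mono (λ x y →
          subst (λ a → a *ᶻ a ≤ᶻ + Q) (sym (ℤₚ.+-identityʳ (F r x y))) (F²≤Q r x y)))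
        (ℤₚ.≤-reflexive (trans (sumᶻ₂-+ {n} {n} (λ _ _ → Q))
          (cong +_ (trans (sum-const n _) (cong (n *_) (sum-const n Q))))))
      start : ∀ (S : State F A t₁) I → t₁ * I ≤ 2 * (n + t₁) →
        State.total S ≤ᶻ (sumᶻ λ r → energy (F r) (λ _ _ → 0ℤ)) +ᶻ + (R * (Q * (2 * (n * I)))) →
        + (8 * h) *ᶻ State.total S ≤ᶻ + (fuel * (n * n))
      start S I tI le = begin
        + (8 * h) *ᶻ State.total S
          ≤⟨ ℤₚ.*-monoˡ-≤-nonNeg (+ (8 * h)) (ℤₚ.≤-trans le (ℤₚ.+-mono-≤
               (ℤₚ.≤-trans (sumᶻ-mono {R} flat) (ℤₚ.≤-reflexive (trans (sumᶻ-+ {R} (λ _ → n * (n * Q))) (cong +_ (sum-const R _)))))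
               (ℤ.+≤+ (*-monoʳ-≤ R (*-monoʳ-≤ Q (*-monoʳ-≤ 2 (*-monoʳ-≤ n (I≤n I tI)))))))) ⟩
        + (8 * h) *ᶻ + (R * (n * (n * Q)) + R * (Q * (2 * (n * n))))
          ≡⟨ sym (ℤₚ.pos-* (8 * h) _) ⟩
        + (8 * h * (R * (n * (n * Q)) + R * (Q * (2 * (n * n)))))
          ≡⟨ cong +_ (ring h R Q n) ⟩
        + (24 * h * (R * Q) * (n * n)) ∎
        where
        open ℤₚ.≤-Reasoning
        ring : ∀ h R Q n → 8 * h * (R * (n * (n * Q)) + R * (Q * (2 * (n * n)))) ≡ 24 * h * (R * Q) * (n * n)
        ring = solve-∀

-- Hues of low density on rectangles

sumᶻ-↑ : ∀ a {b} (φ : Fin (a + b) → ℤ) →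
  sumᶻ φ ≡ sumᶻ (λ i → φ (i ↑ˡ b)) +ᶻ sumᶻ (λ j → φ (a ↑ʳ j))
sumᶻ-↑ zero    φ = sym (ℤₚ.+-identityˡ _)
sumᶻ-↑ (suc a) φ = trans (cong (φ zero +ᶻ_) (sumᶻ-↑ a (φ ∘ suc))) (sym (ℤₚ.+-assoc (φ zero) _ _))

sumᶻ-combine : ∀ m {n} (φ : Fin (m * n) → ℤ) →
  sumᶻ φ ≡ sumᶻ (λ i → sumᶻ (λ j → φ (combine {m} {n} i j)))
sumᶻ-combine zero        φ = refl
sumᶻ-combine (suc m) {n} φ = trans (sumᶻ-↑ n φ)
  (cong (sumᶻ (λ j → φ (j ↑ˡ (m * n))) +ᶻ_) (sumᶻ-combine m (λ q → φ (n ↑ʳ q))))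

sumᶻ-const : ∀ n (c : ℤ) → sumᶻ {n} (λ _ → c) ≡ + n *ᶻ c
sumᶻ-const zero    c = sym (ℤₚ.*-zeroˡ c)
sumᶻ-const (suc n) c = trans (cong (c +ᶻ_) (sumᶻ-const n c)) (sym (ℤₚ.suc-* (+ n) c))

-- The second moment of z + Σⱼ wⱼ v(φⱼ) over all functions φ : Fin M → Fin lam,
-- where v has mean zero: distinct coordinates of φ are uncorrelated.
module _ {lam : ℕ} (v : Fin lam → ℤ) (B : ℕ) (∑v≡0 : sumᶻ v ≡ 0ℤ)
         (∑v²≤B : sumᶻ (λ β → v β *ᶻ v β) ≤ᶻ + B) where

  form : ∀ {M} → ℤ → (Fin M → ℤ) → Fin (lam ^ M) → ℤ
  form z w φ = z +ᶻ sumᶻ (λ j → w j *ᶻ v (finToFun φ j))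

  form² : ∀ {M} → ℤ → (Fin M → ℤ) → Fin (lam ^ M) → ℤ
  form² z w φ = form z w φ *ᶻ form z w φ

  form-combine : ∀ {M} z (w : Fin (suc M) → ℤ) β φ →
    form z w (combine β φ) ≡ form (z +ᶻ w zero *ᶻ v β) (w ∘ suc) φ
  form-combine {M} z w β φ = trans
    (cong (λ qr → z +ᶻ (w zero *ᶻ v (proj₁ qr) +ᶻ sumᶻ (λ j → w (suc j) *ᶻ v (finToFun (proj₂ qr) j))))
      (Finₚ.remQuot-combine β φ))
    (sym (ℤₚ.+-assoc z _ _))

  -- Induction on the coordinates: fixing the first one at `β` merely adds `w zero * v β` to the
  -- constant, which is why `z` is arbitrary. After summation over `β` the cross term vanishes by
  -- `∑v≡0`. The factor `lam` on both sides avoids the division of `B` by `lam`.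
  second-moment : ∀ {M} z (w : Fin M → ℤ) →
    + lam *ᶻ sumᶻ (form² z w) ≤ᶻ
    + (lam ^ M) *ᶻ (+ lam *ᶻ (z *ᶻ z) +ᶻ + B *ᶻ sumᶻ (λ j → w j *ᶻ w j))
  second-moment {zero}  z w = ℤₚ.≤-reflexive (ring (+ lam) z (+ B))
    where
    ring : ∀ l z b → l *ᶻ ((z +ᶻ + 0) *ᶻ (z +ᶻ + 0) +ᶻ + 0) ≡ + 1 *ᶻ (l *ᶻ (z *ᶻ z) +ᶻ b *ᶻ + 0)
    ring = solveᶻ-∀
  second-moment {suc M} z w = begin
    + lam *ᶻ sumᶻ (form² z w)
      ≡⟨ cong (+ lam *ᶻ_) (trans (sumᶻ-combine lam (form² z w))
           (sumᶻ₂-cong (λ β φ → cong (λ s → s *ᶻ s) (form-combine z w β φ)))) ⟩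
    + lam *ᶻ sumᶻ (λ β → sumᶻ (form² (ζ β) w′))
      ≡⟨ *-distribˡ-sumᶻ (+ lam) (λ β → sumᶻ (form² (ζ β) w′)) ⟩
    sumᶻ (λ β → + lam *ᶻ sumᶻ (form² (ζ β) w′))
      ≤⟨ sumᶻ-mono {lam} (λ β → second-moment (ζ β) w′) ⟩
    sumᶻ (λ β → L *ᶻ (+ lam *ᶻ (ζ β *ᶻ ζ β) +ᶻ + B *ᶻ Σ′))
      ≡⟨ sym (*-distribˡ-sumᶻ L (λ β → + lam *ᶻ (ζ β *ᶻ ζ β) +ᶻ + B *ᶻ Σ′)) ⟩
    L *ᶻ sumᶻ (λ β → + lam *ᶻ (ζ β *ᶻ ζ β) +ᶻ + B *ᶻ Σ′)
      ≡⟨ cong (L *ᶻ_) (trans (∑ᶻ-distrib-+ {lam} (λ β → + lam *ᶻ (ζ β *ᶻ ζ β)) _)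
           (cong₂ _+ᶻ_ (sym (*-distribˡ-sumᶻ (+ lam) (λ β → ζ β *ᶻ ζ β))) (sumᶻ-const lam _))) ⟩
    L *ᶻ (+ lam *ᶻ sumᶻ (λ β → ζ β *ᶻ ζ β) +ᶻ + lam *ᶻ (+ B *ᶻ Σ′))
      ≤⟨ ℤₚ.*-monoˡ-≤-nonNeg L (ℤₚ.+-monoˡ-≤ (+ lam *ᶻ (+ B *ᶻ Σ′)) (ℤₚ.*-monoˡ-≤-nonNeg (+ lam) ∑ζ²)) ⟩
    L *ᶻ (+ lam *ᶻ (+ lam *ᶻ (z *ᶻ z) +ᶻ w zero *ᶻ w zero *ᶻ + B) +ᶻ + lam *ᶻ (+ B *ᶻ Σ′))
      ≡⟨ ring L (+ lam) z (w zero) (+ B) Σ′ ⟩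
    + lam *ᶻ L *ᶻ (+ lam *ᶻ (z *ᶻ z) +ᶻ + B *ᶻ (w zero *ᶻ w zero +ᶻ Σ′))
      ≡⟨ cong (_*ᶻ (+ lam *ᶻ (z *ᶻ z) +ᶻ + B *ᶻ (w zero *ᶻ w zero +ᶻ Σ′))) (sym (ℤₚ.pos-* lam (lam ^ M))) ⟩
    + (lam * lam ^ M) *ᶻ (+ lam *ᶻ (z *ᶻ z) +ᶻ + B *ᶻ (w zero *ᶻ w zero +ᶻ Σ′)) ∎
    where
    open ℤₚ.≤-Reasoning
    L = + (lam ^ M)
    w′ = w ∘ suc
    Σ′ = sumᶻ (λ j → w′ j *ᶻ w′ j)
    ζ : Fin lam → ℤ
    ζ β = z +ᶻ w zero *ᶻ v β
    ring : ∀ L l z w b s → L *ᶻ (l *ᶻ (l *ᶻ (z *ᶻ z) +ᶻ w *ᶻ w *ᶻ b) +ᶻ l *ᶻ (b *ᶻ s))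
      ≡ l *ᶻ L *ᶻ (l *ᶻ (z *ᶻ z) +ᶻ b *ᶻ (w *ᶻ w +ᶻ s))
    ring = solveᶻ-∀
    expand : ∀ z w v → (z +ᶻ w *ᶻ v) *ᶻ (z +ᶻ w *ᶻ v) ≡ z *ᶻ z +ᶻ (+ 2 *ᶻ z *ᶻ w *ᶻ v +ᶻ w *ᶻ w *ᶻ (v *ᶻ v))
    expand = solveᶻ-∀
    ∑ζ² : sumᶻ (λ β → ζ β *ᶻ ζ β) ≤ᶻ + lam *ᶻ (z *ᶻ z) +ᶻ w zero *ᶻ w zero *ᶻ + B
    ∑ζ² = begin
      sumᶻ (λ β → ζ β *ᶻ ζ β)
        ≡⟨ sumᶻ-cong {lam} (λ β → expand z (w zero) (v β)) ⟩
      sumᶻ (λ β → z *ᶻ z +ᶻ (+ 2 *ᶻ z *ᶻ w zero *ᶻ v β +ᶻ w zero *ᶻ w zero *ᶻ (v β *ᶻ v β)))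
        ≡⟨ trans (∑ᶻ-distrib-+ {lam} (λ _ → z *ᶻ z) _)
             (cong₂ _+ᶻ_ (sumᶻ-const lam _) (∑ᶻ-distrib-+ {lam} (λ β → + 2 *ᶻ z *ᶻ w zero *ᶻ v β) _)) ⟩
      + lam *ᶻ (z *ᶻ z) +ᶻ (sumᶻ (λ β → + 2 *ᶻ z *ᶻ w zero *ᶻ v β) +ᶻ sumᶻ (λ β → w zero *ᶻ w zero *ᶻ (v β *ᶻ v β)))
        ≡⟨ cong (+ lam *ᶻ (z *ᶻ z) +ᶻ_) (cong₂ _+ᶻ_
             (trans (sym (*-distribˡ-sumᶻ (+ 2 *ᶻ z *ᶻ w zero) v))
               (trans (cong (+ 2 *ᶻ z *ᶻ w zero *ᶻ_) ∑v≡0) (ℤₚ.*-zeroʳ (+ 2 *ᶻ z *ᶻ w zero))))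
             (sym (*-distribˡ-sumᶻ (w zero *ᶻ w zero) (λ β → v β *ᶻ v β)))) ⟩
      + lam *ᶻ (z *ᶻ z) +ᶻ (0ℤ +ᶻ w zero *ᶻ w zero *ᶻ sumᶻ (λ β → v β *ᶻ v β))
        ≡⟨ cong (+ lam *ᶻ (z *ᶻ z) +ᶻ_) (ℤₚ.+-identityˡ _) ⟩
      + lam *ᶻ (z *ᶻ z) +ᶻ w zero *ᶻ w zero *ᶻ sumᶻ (λ β → v β *ᶻ v β)
        ≤⟨ ℤₚ.+-monoʳ-≤ (+ lam *ᶻ (z *ᶻ z)) (ℤₚ.*-monoˡ-≤-nonNeg (w zero *ᶻ w zero) {{ℤ.nonNegative (sq≥0 (w zero))}} ∑v²≤B) ⟩
      + lam *ᶻ (z *ᶻ z) +ᶻ w zero *ᶻ w zero *ᶻ + B ∎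

-- `lam` times the indicator minus its mean, which is integral and has sum 0. Summed over a
-- rectangle it is `lam` times the number of hits minus the area.
centred : ∀ {lam} → Fin lam → Fin lam → ℤ
centred {lam} α β = + lam *ᶻ ι (does (α ≟ β)) -ᶻ 1ℤ

sumᶻ-ι : ∀ {lam} (α : Fin lam) → sumᶻ (λ β → ι (does (α ≟ β))) ≡ 1ℤ
sumᶻ-ι {lam} α = trans (sumᶻ-cong {lam} (λ β → ι≡𝟙 (does (α ≟ β))))
  (trans (sumᶻ-+ (λ β → 𝟙 (does (α ≟ β)))) (cong +_ (sum-≡𝟙 α)))

∑centred≡0 : ∀ {lam} (α : Fin lam) → sumᶻ (centred α) ≡ 0ℤ
∑centred≡0 {lam} α = begin
  sumᶻ (λ β → + lam *ᶻ ι (does (α ≟ β)) -ᶻ 1ℤ)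
    ≡⟨ ∑ᶻ-distrib-+ {lam} (λ β → + lam *ᶻ ι (does (α ≟ β))) (λ _ → -1ℤ) ⟩
  sumᶻ (λ β → + lam *ᶻ ι (does (α ≟ β))) +ᶻ sumᶻ {lam} (λ _ → -1ℤ)
    ≡⟨ cong₂ _+ᶻ_ (trans (sym (*-distribˡ-sumᶻ (+ lam) (λ β → ι (does (α ≟ β))))) (cong (+ lam *ᶻ_) (sumᶻ-ι α)))
         (sumᶻ-const lam -1ℤ) ⟩
  + lam *ᶻ 1ℤ +ᶻ + lam *ᶻ -1ℤ
    ≡⟨ ring (+ lam) ⟩
  0ℤ ∎
  where
  open ≡-Reasoning
  ring : ∀ l → l *ᶻ + 1 +ᶻ l *ᶻ -[1+ 0 ] ≡ + 0
  ring = solveᶻ-∀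

-- The exact value is `lam² - lam`.
∑centred²≤ : ∀ {lam} (α : Fin lam) → sumᶻ (λ β → centred α β *ᶻ centred α β) ≤ᶻ + (lam * lam)
∑centred²≤ {lam} α = begin
  sumᶻ (λ β → centred α β *ᶻ centred α β)
    ≤⟨ sumᶻ-mono {lam} (λ β → pointwise (does (α ≟ β))) ⟩
  sumᶻ (λ β → + (lam * lam) *ᶻ ι (does (α ≟ β)) +ᶻ (1ℤ -ᶻ (+ 2 *ᶻ + lam) *ᶻ ι (does (α ≟ β))))
    ≡⟨ trans (∑ᶻ-distrib-+ {lam} (λ β → + (lam * lam) *ᶻ ι (does (α ≟ β))) _) (cong₂ _+ᶻ_
         (pull (+ (lam * lam)))
         (trans (∑ᶻ-distrib-+ {lam} (λ _ → 1ℤ) _) (cong₂ _+ᶻ_ (sumᶻ-const lam 1ℤ)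
           (trans (sumᶻ-cong {lam} (λ β → ℤₚ.neg-distribˡ-* (+ 2 *ᶻ + lam) (ι (does (α ≟ β))))) (pull (- (+ 2 *ᶻ + lam))))))) ⟩
  + (lam * lam) *ᶻ 1ℤ +ᶻ (+ lam *ᶻ 1ℤ +ᶻ - (+ 2 *ᶻ + lam) *ᶻ 1ℤ)
    ≡⟨ ring (+ (lam * lam)) (+ lam) ⟩
  + (lam * lam) -ᶻ + lam
    ≤⟨ ℤₚ.i≤j⇒i-k≤j (+ lam) ℤₚ.≤-refl ⟩
  + (lam * lam) ∎
  where
  open ℤₚ.≤-Reasoning
  pull : ∀ c → sumᶻ (λ β → c *ᶻ ι (does (α ≟ β))) ≡ c *ᶻ 1ℤ
  pull c = trans (sym (*-distribˡ-sumᶻ c (λ β → ι (does (α ≟ β))))) (cong (c *ᶻ_) (sumᶻ-ι α))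
  ring : ∀ s l → s *ᶻ + 1 +ᶻ (l *ᶻ + 1 +ᶻ - (+ 2 *ᶻ l) *ᶻ + 1) ≡ s -ᶻ l
  ring = solveᶻ-∀
  ring₁ : ∀ l → (l *ᶻ + 1 -ᶻ + 1) *ᶻ (l *ᶻ + 1 -ᶻ + 1) ≡ l *ᶻ l *ᶻ + 1 +ᶻ (+ 1 -ᶻ (+ 2 *ᶻ l) *ᶻ + 1)
  ring₁ = solveᶻ-∀
  ring₀ : ∀ l → (l *ᶻ + 0 -ᶻ + 1) *ᶻ (l *ᶻ + 0 -ᶻ + 1) ≡ l *ᶻ l *ᶻ + 0 +ᶻ (+ 1 -ᶻ (+ 2 *ᶻ l) *ᶻ + 0)
  ring₀ = solveᶻ-∀
  square : ∀ {s} → s ≡ + lam *ᶻ + lam → ∀ b → (+ lam *ᶻ ι b -ᶻ 1ℤ) *ᶻ (+ lam *ᶻ ι b -ᶻ 1ℤ) ≤ᶻ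
    s *ᶻ ι b +ᶻ (1ℤ -ᶻ (+ 2 *ᶻ + lam) *ᶻ ι b)
  square refl true  = ℤₚ.≤-reflexive (ring₁ (+ lam))
  square refl false = ℤₚ.≤-reflexive (ring₀ (+ lam))
  pointwise : ∀ b → (+ lam *ᶻ ι b -ᶻ 1ℤ) *ᶻ (+ lam *ᶻ ι b -ᶻ 1ℤ) ≤ᶻ
    + (lam * lam) *ᶻ ι b +ᶻ (1ℤ -ᶻ (+ 2 *ᶻ + lam) *ᶻ ι b)
  pointwise = square (ℤₚ.pos-* lam lam)

trivialPartition : ∀ t .{{_ : NonZero t}} n → Σ[ p ∈ (Fin n → Fin t) ] Equitable p
trivialPartition t n = part , equitable
  where open Refinement (refine {n} {1} t (λ _ → zero))

-- Colour (x , y) by the value at the label of y of the function labelling x.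
module Colouring (lam η : ℕ) .{{lam≢0 : NonZero lam}} .{{η≢0 : NonZero η}} where

  -- `L` counts the functions from `M` labels to hues. The size of `M` makes the mean square of the
  -- row excess `T` at most `(n/η)²`, see `η²∑T²≤`.
  M L : ℕ
  M = 4 * lam * (η * η)
  L = lam ^ M

  instance
    M≢0 : NonZero M
    M≢0 = m*n≢0 (4 * lam) (η * η) {{m*n≢0 4 lam}} {{m*n≢0 η η}}
    L≢0 : NonZero L
    L≢0 = ℕₚ.m^n≢0 lam M

  hueThreshold : ℕ
  hueThreshold = L ⊔ M

  module _ (n : ℕ) (N≤n : hueThreshold ≤ n) where
    private
      L≤n = ≤-trans (m≤m⊔n L M) N≤n
      M≤n = ≤-trans (m≤n⊔m L M) N≤n
      X : Fin n → Fin L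
      X = proj₁ (trivialPartition L n)
      Y : Fin n → Fin M
      Y = proj₁ (trivialPartition M n)

    -- The two arguments play different roles, so a hue is not symmetric; `colourOf` therefore
    -- always feeds it the vertex of the smaller part first.
    hue : Fin n → Fin n → Fin lam
    hue x y = finToFun (X x) (Y y)

    module _ (α : Fin lam) (U W : Fin n → Bool) where
      private
        v = centred α

        w : Fin M → ℕ
        w j = ∑[ y < n ] (𝟙 (does (Y y ≟ j)) * 𝟙 (W y))

        S : Fin L → ℤ
        S φ = sumᶻ (λ j → + w j *ᶻ v (finToFun φ j))

        -- The excess of hue `α` in row `x`: `lam` times its number of hits in `W`, minus the size
        -- of `W`.
        T : Fin n → ℤ
        T x = sumᶻ (λ y → ι (W y) *ᶻ v (hue x y))

        T≡S : ∀ x → T x ≡ S (X x)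
        T≡S x = trans (FibreSum.sum-fibre ℤₚ.+-*-semiring Y (λ j y → ι (W y) *ᶻ v (finToFun (X x) j)))
          (sumᶻ-cong {M} (λ j → trans
            (sumᶻ-cong {n} (λ y → trans (sym (ℤₚ.*-assoc (ι (does (Y y ≟ j))) (ι (W y)) _))
              (cong (_*ᶻ v (finToFun (X x) j)) (cast (does (Y y ≟ j)) (W y)))))
            (trans (sym (*-distribʳ-sumᶻ (v (finToFun (X x) j)) (λ y → + (𝟙 (does (Y y ≟ j)) * 𝟙 (W y)))))
              (cong (_*ᶻ v (finToFun (X x) j)) (sumᶻ-+ (λ y → 𝟙 (does (Y y ≟ j)) * 𝟙 (W y)))))))
          where
          cast : ∀ a b → ι a *ᶻ ι b ≡ + (𝟙 a * 𝟙 b)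
          cast a b = trans (cong₂ _*ᶻ_ (ι≡𝟙 a) (ι≡𝟙 b)) (sym (ℤₚ.pos-* (𝟙 a) (𝟙 b)))

        ∑w² : ℕ
        ∑w² = ∑[ j < M ] (w j * w j)

        M∑w²≤ : M * ∑w² ≤ 2 * (n * n)
        M∑w²≤ = begin
          M * ∑w²
            ≡⟨ *-distribˡ-sum M (λ j → w j * w j) ⟩
          ∑[ j < M ] (M * (w j * w j))
            ≤⟨ sum-mono {M} (λ j → ≤-trans (≤-reflexive (ring₁ M (w j)))
                 (*-monoˡ-≤ (w j) (≤-trans (*-monoʳ-≤ M (w≤size j))
                   (≤-trans (size-upper (proj₂ (trivialPartition M n)) j) (+-monoʳ-≤ n M≤n))))) ⟩
          ∑[ j < M ] ((n + n) * w j)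
            ≡⟨ *-distribˡ-sum (n + n) w ⟨
          (n + n) * sum w
            ≡⟨ cong ((n + n) *_) (sym (sum-fibre Y (λ _ y → 𝟙 (W y)))) ⟩
          (n + n) * ∑[ y < n ] 𝟙 (W y)
            ≤⟨ *-monoʳ-≤ (n + n) (∑𝟙≤n W) ⟩
          (n + n) * n
            ≡⟨ ring₂ n ⟩
          2 * (n * n) ∎
          where
          open ℕₚ.≤-Reasoning
          ring₁ : ∀ M w → M * (w * w) ≡ M * w * w
          ring₁ = solve-∀
          ring₂ : ∀ n → (n + n) * n ≡ 2 * (n * n)
          ring₂ = solve-∀
          w≤size : ∀ j → w j ≤ size Y j
          w≤size j = sum-mono {n} (λ y → ≤-trans (*-monoʳ-≤ (𝟙 (does (Y y ≟ j))) (𝟙≤1 (W y)))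
            (≤-reflexive (*-identityʳ _)))

        ∑T² : ℤ
        ∑T² = sumᶻ (λ x → T x *ᶻ T x)

        ∑S²≤ : sumᶻ (λ φ → S φ *ᶻ S φ) ≤ᶻ + L *ᶻ (+ lam *ᶻ + ∑w²)
        ∑S²≤ = ℤₚ.*-cancelˡ-≤-pos _ _ (+ lam) {{ℤ.positive (ℤ.+<+ (n≢0⇒n>0 (ℕ.≢-nonZero⁻¹ lam)))}} (begin
          + lam *ᶻ sumᶻ (λ φ → S φ *ᶻ S φ)
            ≡⟨ cong (+ lam *ᶻ_) (sumᶻ-cong {L} (λ φ → cong₂ _*ᶻ_ (sym (ℤₚ.+-identityˡ (S φ))) (sym (ℤₚ.+-identityˡ (S φ))))) ⟩
          + lam *ᶻ sumᶻ (form² v (lam * lam) (∑centred≡0 α) (∑centred²≤ α) 0ℤ (+_ ∘ w))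
            ≤⟨ second-moment v (lam * lam) (∑centred≡0 α) (∑centred²≤ α) 0ℤ (+_ ∘ w) ⟩
          + L *ᶻ (+ lam *ᶻ 0ℤ +ᶻ + (lam * lam) *ᶻ sumᶻ (λ j → + w j *ᶻ + w j))
            ≡⟨ cong (λ s → + L *ᶻ (+ lam *ᶻ 0ℤ +ᶻ s)) (cong₂ _*ᶻ_ (ℤₚ.pos-* lam lam)
                 (trans (sumᶻ-cong {M} (λ j → sym (ℤₚ.pos-* (w j) (w j)))) (sumᶻ-+ (λ j → w j * w j)))) ⟩
          + L *ᶻ (+ lam *ᶻ 0ℤ +ᶻ + lam *ᶻ + lam *ᶻ + ∑w²)
            ≡⟨ ringᶻ (+ L) (+ lam) (+ ∑w²) ⟩
          + lam *ᶻ (+ L *ᶻ (+ lam *ᶻ + ∑w²)) ∎)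
          where
          import Data.Nat as ℕ
          open ℤₚ.≤-Reasoning
          ringᶻ : ∀ L l s → L *ᶻ (l *ᶻ + 0 +ᶻ l *ᶻ l *ᶻ s) ≡ l *ᶻ (L *ᶻ (l *ᶻ s))
          ringᶻ = solveᶻ-∀

        -- `T x` depends only on the label of `x`, and each of the `L` functions labels at most
        -- `2n/L` vertices, so the sum is at most `2n` times the average over all functions.
        ∑T²≤ : ∑T² ≤ᶻ + (2 * n * (lam * ∑w²))
        ∑T²≤ = ℤₚ.*-cancelˡ-≤-pos _ _ (+ L) {{ℤ.positive (ℤ.+<+ (n≢0⇒n>0 (ℕ.≢-nonZero⁻¹ L)))}} (begin
          + L *ᶻ ∑T²
            ≡⟨ cong (+ L *ᶻ_) (trans (sumᶻ-cong {n} (λ x → cong₂ _*ᶻ_ (T≡S x) (T≡S x)))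
                 (trans (FibreSum.sum-fibre ℤₚ.+-*-semiring X (λ φ _ → S φ *ᶻ S φ))
                   (sumᶻ-cong {L} (λ φ → trans (sym (*-distribʳ-sumᶻ (S φ *ᶻ S φ) (λ x → ι (does (X x ≟ φ)))))
                     (cong (_*ᶻ (S φ *ᶻ S φ)) (trans (sumᶻ-cong {n} (λ x → ι≡𝟙 (does (X x ≟ φ)))) (sumᶻ-+ (λ x → 𝟙 (does (X x ≟ φ)))))))))) ⟩
          + L *ᶻ sumᶻ (λ φ → + size X φ *ᶻ (S φ *ᶻ S φ))
            ≡⟨ *-distribˡ-sumᶻ (+ L) (λ φ → + size X φ *ᶻ (S φ *ᶻ S φ)) ⟩
          sumᶻ (λ φ → + L *ᶻ (+ size X φ *ᶻ (S φ *ᶻ S φ)))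
            ≤⟨ sumᶻ-mono {L} (λ φ → ℤₚ.≤-trans (ℤₚ.≤-reflexive (trans (sym (ℤₚ.*-assoc (+ L) (+ size X φ) _))
                   (cong (_*ᶻ (S φ *ᶻ S φ)) (sym (ℤₚ.pos-* L (size X φ))))))
                 (ℤₚ.*-monoʳ-≤-nonNeg (S φ *ᶻ S φ) {{ℤ.nonNegative (sq≥0 (S φ))}}
                   (ℤ.+≤+ (≤-trans (size-upper (proj₂ (trivialPartition L n)) φ) (+-monoʳ-≤ n L≤n))))) ⟩
          sumᶻ (λ φ → + (n + n) *ᶻ (S φ *ᶻ S φ))
            ≡⟨ sym (*-distribˡ-sumᶻ (+ (n + n)) (λ φ → S φ *ᶻ S φ)) ⟩
          + (n + n) *ᶻ sumᶻ (λ φ → S φ *ᶻ S φ)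
            ≤⟨ ℤₚ.*-monoˡ-≤-nonNeg (+ (n + n)) ∑S²≤ ⟩
          + (n + n) *ᶻ (+ L *ᶻ (+ lam *ᶻ + ∑w²))
            ≡⟨ ringᶻ (+ (n + n)) (+ L) (+ lam *ᶻ + ∑w²) ⟩
          + L *ᶻ (+ (n + n) *ᶻ (+ lam *ᶻ + ∑w²))
            ≡⟨ cong (+ L *ᶻ_) (trans (cong (+ (n + n) *ᶻ_) (sym (ℤₚ.pos-* lam ∑w²)))
                 (trans (sym (ℤₚ.pos-* (n + n) (lam * ∑w²))) (cong +_ (ring n (lam * ∑w²))))) ⟩
          + L *ᶻ + (2 * n * (lam * ∑w²)) ∎)
          where
          import Data.Nat as ℕ
          open ℤₚ.≤-Reasoning
          ringᶻ : ∀ a b c → a *ᶻ (b *ᶻ c) ≡ b *ᶻ (a *ᶻ c)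
          ringᶻ = solveᶻ-∀
          ring : ∀ n s → (n + n) * s ≡ 2 * n * s
          ring = solve-∀

        η²∑T²≤ : + (η * η) *ᶻ ∑T² ≤ᶻ + (n * (n * n))
        η²∑T²≤ = ℤₚ.≤-trans (ℤₚ.*-monoˡ-≤-nonNeg (+ (η * η)) ∑T²≤)
          (ℤₚ.≤-trans (ℤₚ.≤-reflexive (sym (ℤₚ.pos-* (η * η) _))) (ℤ.+≤+ (*-cancelˡ-≤ 2 (begin
            2 * (η * η * (2 * n * (lam * ∑w²)))
              ≡⟨ ring₁ (η * η) n lam ∑w² ⟩
            n * (M * ∑w²)
              ≤⟨ *-monoʳ-≤ n M∑w²≤ ⟩
            n * (2 * (n * n))
              ≡⟨ ring₂ n ⟩
            2 * (n * (n * n)) ∎))))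
          where
          open ℕₚ.≤-Reasoning
          ring₁ : ∀ e n l s → 2 * (e * (2 * n * (l * s))) ≡ n * (4 * l * e * s)
          ring₁ = solve-∀
          ring₂ : ∀ n → n * (2 * (n * n)) ≡ 2 * (n * (n * n))
          ring₂ = solve-∀

        u = ∑[ x < n ] 𝟙 (U x)
        ω = ∑[ y < n ] 𝟙 (W y)

      cnt : ℕ
      cnt = ∑[ x < n ] ∑[ y < n ] (𝟙 (U x) * (𝟙 (W y) * 𝟙 (does (α ≟ hue x y))))

      private
        ∑UT : sumᶻ (λ x → ι (U x) *ᶻ T x) +ᶻ + (u * ω) ≡ + (lam * cnt)
        ∑UT = begin
          sumᶻ (λ x → ι (U x) *ᶻ T x) +ᶻ + (u * ω)
            ≡⟨ cong₂ _+ᶻ_ (sumᶻ-cong {n} (λ x → *-distribˡ-sumᶻ (ι (U x)) (λ y → ι (W y) *ᶻ v (hue x y))))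
                 (trans (cong +_ (sym (sum-∑∑ (𝟙 ∘ U) (𝟙 ∘ W)))) (sym (sumᶻ₂-+ (λ x y → 𝟙 (U x) * 𝟙 (W y))))) ⟩
          sumᶻ (λ x → sumᶻ (λ y → ι (U x) *ᶻ (ι (W y) *ᶻ v (hue x y)))) +ᶻ sumᶻ (λ x → sumᶻ (λ y → + (𝟙 (U x) * 𝟙 (W y))))
            ≡⟨ sym (sumᶻ₂-distrib-+ (λ x y → ι (U x) *ᶻ (ι (W y) *ᶻ v (hue x y))) _) ⟩
          sumᶻ (λ x → sumᶻ (λ y → ι (U x) *ᶻ (ι (W y) *ᶻ v (hue x y)) +ᶻ + (𝟙 (U x) * 𝟙 (W y))))
            ≡⟨ sumᶻ₂-cong (λ x y → pointwise (U x) (W y) (does (α ≟ hue x y))) ⟩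
          sumᶻ (λ x → sumᶻ (λ y → + (lam * (𝟙 (U x) * (𝟙 (W y) * 𝟙 (does (α ≟ hue x y)))))))
            ≡⟨ sumᶻ₂-+ (λ x y → lam * (𝟙 (U x) * (𝟙 (W y) * 𝟙 (does (α ≟ hue x y))))) ⟩
          + ∑[ x < n ] ∑[ y < n ] (lam * (𝟙 (U x) * (𝟙 (W y) * 𝟙 (does (α ≟ hue x y)))))
            ≡⟨ cong +_ (sym (trans (*-distribˡ-sum lam (λ x → ∑[ y < n ] (𝟙 (U x) * (𝟙 (W y) * 𝟙 (does (α ≟ hue x y))))))
                 (sum-cong-≗ {n} (λ x → *-distribˡ-sum lam (λ y → 𝟙 (U x) * (𝟙 (W y) * 𝟙 (does (α ≟ hue x y)))))))) ⟩
          + (lam * cnt) ∎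
          where
          open ≡-Reasoning
          ringᶻ : ∀ a b c l → a *ᶻ (b *ᶻ (l *ᶻ c -ᶻ + 1)) +ᶻ a *ᶻ b ≡ l *ᶻ (a *ᶻ (b *ᶻ c))
          ringᶻ = solveᶻ-∀
          pointwise : ∀ a b c → ι a *ᶻ (ι b *ᶻ (+ lam *ᶻ ι c -ᶻ 1ℤ)) +ᶻ + (𝟙 a * 𝟙 b) ≡ + (lam * (𝟙 a * (𝟙 b * 𝟙 c)))
          pointwise a b c = trans (cong (ι a *ᶻ (ι b *ᶻ (+ lam *ᶻ ι c -ᶻ 1ℤ)) +ᶻ_) (trans (ℤₚ.pos-* (𝟙 a) (𝟙 b)) (sym (cong₂ _*ᶻ_ (ι≡𝟙 a) (ι≡𝟙 b)))))
            (trans (ringᶻ (ι a) (ι b) (ι c) (+ lam))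
              (trans (cong (+ lam *ᶻ_) (trans (cong₂ _*ᶻ_ (ι≡𝟙 a) (trans (cong₂ _*ᶻ_ (ι≡𝟙 b) (ι≡𝟙 c)) (sym (ℤₚ.pos-* (𝟙 b) (𝟙 c)))))
                (sym (ℤₚ.pos-* (𝟙 a) _)))) (sym (ℤₚ.pos-* lam _))))

        1≤n : 1 ≤ n
        1≤n = ≤-trans (n≢0⇒n>0 (ℕ.≢-nonZero⁻¹ L)) L≤n
          where import Data.Nat as ℕ

        -- Cauchy-Schwarz in the form `2 n η T ≤ n² + η² T²`, summed over the rows in `U`; the rows
        -- outside only increase the right side.
        ηUT≤ : + η *ᶻ sumᶻ (λ x → ι (U x) *ᶻ T x) ≤ᶻ + (n * n)
        ηUT≤ = ℤₚ.*-cancelˡ-≤-pos _ _ (+ (2 * n)) {{ℤ.positive (ℤ.+<+ (≤-trans 1≤n (m≤n*m n 2)))}} (begin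
          + (2 * n) *ᶻ (+ η *ᶻ sumᶻ (λ x → ι (U x) *ᶻ T x))
            ≡⟨ trans (cong (+ (2 * n) *ᶻ_) (*-distribˡ-sumᶻ (+ η) (λ x → ι (U x) *ᶻ T x)))
                 (*-distribˡ-sumᶻ (+ (2 * n)) (λ x → + η *ᶻ (ι (U x) *ᶻ T x))) ⟩
          sumᶻ (λ x → + (2 * n) *ᶻ (+ η *ᶻ (ι (U x) *ᶻ T x)))
            ≤⟨ sumᶻ-mono {n} (λ x → amgm (U x) (T x)) ⟩
          sumᶻ (λ x → + (n * n) +ᶻ + (η * η) *ᶻ (T x *ᶻ T x))
            ≡⟨ trans (∑ᶻ-distrib-+ {n} (λ _ → + (n * n)) _)
                 (cong₂ _+ᶻ_ (trans (sumᶻ-const n _) (sym (ℤₚ.pos-* n (n * n)))) (sym (*-distribˡ-sumᶻ (+ (η * η)) (λ x → T x *ᶻ T x)))) ⟩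
          + (n * (n * n)) +ᶻ + (η * η) *ᶻ ∑T²
            ≤⟨ ℤₚ.+-monoʳ-≤ (+ (n * (n * n))) η²∑T²≤ ⟩
          + (n * (n * n) + n * (n * n))
            ≡⟨ cong +_ (ring n) ⟩
          + (2 * n * (n * n))
            ≡⟨ ℤₚ.pos-* (2 * n) (n * n) ⟩
          + (2 * n) *ᶻ + (n * n) ∎)
          where
          open ℤₚ.≤-Reasoning
          ring : ∀ n → n * (n * n) + n * (n * n) ≡ 2 * n * (n * n)
          ring = solve-∀
          amgm : ∀ b s → + (2 * n) *ᶻ (+ η *ᶻ (ι b *ᶻ s)) ≤ᶻ + (n * n) +ᶻ + (η * η) *ᶻ (s *ᶻ s)
          amgm b s = subst₂ (λ p q → p *ᶻ (+ η *ᶻ (ι b *ᶻ s)) ≤ᶻ q) (sym (ℤₚ.pos-* 2 n))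
            (cong₂ _+ᶻ_ (sym (ℤₚ.pos-* n n)) (cong (_*ᶻ (s *ᶻ s)) (sym (ℤₚ.pos-* η η)))) (go b)
            where
            ring₁ : ∀ n e s → n *ᶻ n +ᶻ e *ᶻ e *ᶻ (s *ᶻ s) ≡ + 2 *ᶻ n *ᶻ (e *ᶻ (+ 1 *ᶻ s)) +ᶻ (n -ᶻ e *ᶻ s) *ᶻ (n -ᶻ e *ᶻ s)
            ring₁ = solveᶻ-∀
            ring₀ : ∀ n e s → n *ᶻ n +ᶻ e *ᶻ e *ᶻ (s *ᶻ s) ≡ + 2 *ᶻ n *ᶻ (e *ᶻ (+ 0 *ᶻ s)) +ᶻ (n *ᶻ n +ᶻ (e *ᶻ s) *ᶻ (e *ᶻ s))
            ring₀ = solveᶻ-∀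
            add : ∀ {a b c} → c ≡ a +ᶻ b → 0ℤ ≤ᶻ b → a ≤ᶻ c
            add {a} refl 0≤b = ℤₚ.≤-trans (ℤₚ.≤-reflexive (sym (ℤₚ.+-identityʳ a))) (ℤₚ.+-monoʳ-≤ a 0≤b)
            go : ∀ b → + 2 *ᶻ + n *ᶻ (+ η *ᶻ (ι b *ᶻ s)) ≤ᶻ + n *ᶻ + n +ᶻ + η *ᶻ + η *ᶻ (s *ᶻ s)
            go true  = add (ring₁ (+ n) (+ η) s) (sq≥0 (+ n -ᶻ + η *ᶻ s))
            go false = add (ring₀ (+ n) (+ η) s) (ℤₚ.+-mono-≤ (sq≥0 (+ n)) (sq≥0 (+ η *ᶻ s)))

      -- On every rectangle of area at least `n²/η` the hue has density at most `2/lam`. The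
      -- rectangle is arbitrary, so it may depend on the hues.
      hue-spread : η * (lam * cnt) ≤ η * (u * ω) + n * n
      hue-spread = ℤₚ.drop‿+≤+ (begin
        + (η * (lam * cnt))
          ≡⟨ trans (ℤₚ.pos-* η (lam * cnt)) (cong (+ η *ᶻ_) (sym ∑UT)) ⟩
        + η *ᶻ (sumᶻ (λ x → ι (U x) *ᶻ T x) +ᶻ + (u * ω))
          ≡⟨ ℤₚ.*-distribˡ-+ (+ η) _ _ ⟩
        + η *ᶻ sumᶻ (λ x → ι (U x) *ᶻ T x) +ᶻ + η *ᶻ + (u * ω)
          ≤⟨ ℤₚ.+-monoˡ-≤ (+ η *ᶻ + (u * ω)) ηUT≤ ⟩
        + (n * n) +ᶻ + η *ᶻ + (u * ω)
          ≡⟨ trans (ℤₚ.+-comm (+ (n * n)) (+ η *ᶻ + (u * ω))) (cong (_+ᶻ + (n * n)) (sym (ℤₚ.pos-* η (u * ω)))) ⟩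
        + (η * (u * ω) + n * n) ∎)
        where open ℤₚ.≤-Reasoning

-- Grouping hues into colours

load : (Fin R → Fin ℓ) → (Fin R → ℕ) → Fin ℓ → ℕ
load {R} f s β = ∑[ r < R ] (𝟙 (does (f r ≟ β)) * s r)

∑load : (f : Fin R → Fin ℓ) (s : Fin R → ℕ) → sum (load f s) ≡ sum s
∑load f s = sym (sum-fibre f (λ _ r → s r))

load-* : ∀ k (f : Fin R → Fin ℓ) (s : Fin R → ℕ) β → load f (λ r → k * s r) β ≡ k * load f s β
load-* {R} k f s β = trans (sum-cong-≗ {R} (λ r → ring (𝟙 (does (f r ≟ β))) k (s r)))
                           (sym (*-distribˡ-sum k (λ r → 𝟙 (does (f r ≟ β)) * s r)))
  where
  ring : ∀ a k s → a * (k * s) ≡ k * (a * s)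
  ring = solve-∀

-- Greedy packing: the items placed so far do not exceed the total capacity, so some bin is still
-- within its own, and one more item overfills it by at most `μ`.
fill : ∀ μ (s : Fin R → ℕ) (c : Fin ℓ → ℕ) .{{_ : NonZero ℓ}} → (∀ r → s r ≤ μ) → sum s ≤ sum c →
  Σ[ f ∈ (Fin R → Fin ℓ) ] ∀ β → load f s β ≤ c β + μ
fill {zero} μ s c s≤μ Σs≤Σc = (λ ()) , λ β → z≤n
fill {suc R} {ℓ} μ s c s≤μ Σs≤Σc with fill μ (s ∘ suc) c (s≤μ ∘ suc) (≤-trans (m≤n+m _ (s zero)) Σs≤Σc)
... | f , load≤ with any? (λ β → load f (s ∘ suc) β ≤? c β)
...   | no full = contradiction (begin-strict
          sum c                     <⟨ overflow ℓ (λ β → ℕₚ.≰⇒> (λ le → full (β , le))) ⟩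
          sum (load f (s ∘ suc))    ≡⟨ ∑load f (s ∘ suc) ⟩
          sum (s ∘ suc)             ≤⟨ m≤n+m _ (s zero) ⟩
          sum s                     ≤⟨ Σs≤Σc ⟩
          sum c                     ∎) (ℕₚ.<-irrefl refl)
  where
  open ℕₚ.≤-Reasoning
  overflow : ∀ n .{{_ : NonZero n}} {f g : Fin n → ℕ} → (∀ i → f i < g i) → sum f < sum g
  overflow (suc n) f<g = sum-mono-< (ℕₚ.<⇒≤ ∘ f<g) zero (f<g zero)
...   | yes (γ , room) = f′ , bound
  where
  f′ : Fin (suc R) → Fin ℓ
  f′ zero    = γ
  f′ (suc r) = f r
  bound : ∀ β → load f′ s β ≤ c β + μ
  bound β with γ ≟ β
  ... | no  _    = load≤ β
  ... | yes refl = begin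
    1 * s zero + load f (s ∘ suc) γ   ≤⟨ +-mono-≤ (≤-trans (≤-reflexive (*-identityˡ (s zero))) (s≤μ zero)) room ⟩
    μ + c γ                           ≡⟨ +-comm μ (c γ) ⟩
    c γ + μ                           ∎
    where open ℕₚ.≤-Reasoning

sum-step : ∀ ℓ k p r → k ≤ ℓ → ∑[ β < ℓ ] (if toℕ β <ᵇ k then p else r) ≡ k * p + (ℓ ∸ k) * r
sum-step ℓ       zero    p r _         = sum-const ℓ r
sum-step (suc ℓ) (suc k) p r (s≤s k≤ℓ) =
  trans (cong (_+_ p) (sum-step ℓ k p r k≤ℓ)) (sym (ℕₚ.+-assoc p (k * p) _))

-- Bounds the other terms by `X` each; it turns upper bounds for all loads into a lower bound for
-- one of them.
sum-deficit : (x : Fin n → ℕ) (X : ℕ) → (∀ i → x i ≤ X) → ∀ i → sum x + X ≤ n * X + x i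
sum-deficit {suc n} x X x≤X zero    = begin
  x zero + sum (x ∘ suc) + X          ≤⟨ +-monoˡ-≤ X (+-monoʳ-≤ (x zero) (sum-bound {n} (x≤X ∘ suc))) ⟩
  x zero + n * X + X                  ≡⟨ ring (x zero) (n * X) X ⟩
  X + n * X + x zero                  ∎
  where
  open ℕₚ.≤-Reasoning
  ring : ∀ a b c → a + b + c ≡ c + b + a
  ring = solve-∀
sum-deficit {suc n} x X x≤X (suc i) = begin
  x zero + sum (x ∘ suc) + X          ≡⟨ ℕₚ.+-assoc (x zero) _ X ⟩
  x zero + (sum (x ∘ suc) + X)        ≤⟨ +-mono-≤ (x≤X zero) (sum-deficit (x ∘ suc) X (x≤X ∘ suc) i) ⟩
  X + (n * X + x (suc i))             ≡⟨ ℕₚ.+-assoc X (n * X) _ ⟨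
  X + n * X + x (suc i)               ∎
  where open ℕₚ.≤-Reasoning

module _ {ℓ R : ℕ} .{{ℓ≢0 : NonZero ℓ}} (μ m : ℕ) .{{m≢0 : NonZero m}} where

  -- `a` and `b` are the sizes of the hues inside and outside `E`, and `m` is their total. Loads are
  -- scaled by `ℓ` to have integral capacities; the slack consists of 1 for rounding and `ℓ * μ` of
  -- greedy overflow for each of the two fillings.
  Grouping : (a b : Fin R → ℕ) → Set
  Grouping a b = Σ[ f ∈ (Fin R → Fin ℓ) ] Σ[ g ∈ (Fin R → Fin ℓ) ] ∀ β →
    ℓ * (load f a β + load g b β) ≤ m + (1 + 2 * (ℓ * μ)) ×
    (ℓ * (ℓ * load f a β) ≤ 2 * m + (ℓ + ℓ * (ℓ * μ)) ⊎ ℓ * (ℓ * load g b β) ≤ 2 * m + (ℓ + ℓ * (ℓ * μ)))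

  -- Capacities after scaling by `ℓ`: each of the first `k` colours takes `m` from `a` and nothing
  -- from `b`; each of the other `D` takes `y + 1` from `a` and `m - y` from `b`. The two bounds on
  -- `ρ` say that `y` is `ρ / D` rounded, and that both sides have room.
  module _ (k D y ρ : ℕ) (k+D≡ℓ : k + D ≡ ℓ) (ℓ≤2D : ℓ ≤ D + D) (Dy≤ρ : D * y ≤ ρ)
           (ρ≤D[1+y] : ρ ≤ D * suc y) (ρ≤m : ρ ≤ m) (y≤m : y ≤ m) where
    open ℕₚ.≤-Reasoning

    k≤ℓ : k ≤ ℓ
    k≤ℓ = ≤-trans (m≤m+n k D) (≤-reflexive k+D≡ℓ)

    cap : ℕ → ℕ → Fin ℓ → ℕ
    cap p r β = if toℕ β <ᵇ k then p else r

    ∑cap : ∀ p r → sum (cap p r) ≡ k * p + D * r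
    ∑cap p r = trans (sum-step ℓ k p r k≤ℓ) (cong (λ d → k * p + d * r)
      (trans (cong (_∸ k) (sym k+D≡ℓ)) (ℕₚ.m+n∸m≡n k D)))

    ∑capB : ∀ {A B} → ℓ * A ≡ ρ + k * m → A + B ≡ m → ℓ * B ≤ sum (cap 0 (m ∸ y))
    ∑capB {A} {B} ℓA≡ Σ≡m = ℕₚ.+-cancelˡ-≤ (ρ + k * m) _ _ (begin
      ρ + k * m + ℓ * B                 ≡⟨ cong (_+ ℓ * B) (sym ℓA≡) ⟩
      ℓ * A + ℓ * B                     ≡⟨ trans (sym (*-distribˡ-+ ℓ A B)) (cong (ℓ *_) Σ≡m) ⟩
      ℓ * m                             ≡⟨ trans (cong (_* m) (sym k+D≡ℓ)) (ℕₚ.*-distribʳ-+ m k D) ⟩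
      k * m + D * m                     ≡⟨ cong (λ s → k * m + D * s) (sym (ℕₚ.m+[n∸m]≡n y≤m)) ⟩
      k * m + D * (y + (m ∸ y))         ≡⟨ cong (_+_ (k * m)) (*-distribˡ-+ D y (m ∸ y)) ⟩
      k * m + (D * y + D * (m ∸ y))     ≤⟨ +-monoʳ-≤ (k * m) (+-monoˡ-≤ (D * (m ∸ y)) Dy≤ρ) ⟩
      k * m + (ρ + D * (m ∸ y))         ≡⟨ ring (k * m) ρ (D * (m ∸ y)) ⟩
      ρ + k * m + D * (m ∸ y)           ≡⟨ cong (λ z → ρ + k * m + (z + D * (m ∸ y))) (*-zeroʳ k) ⟨
      ρ + k * m + (k * 0 + D * (m ∸ y)) ≡⟨ cong (_+_ (ρ + k * m)) (∑cap 0 (m ∸ y)) ⟨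
      ρ + k * m + sum (cap 0 (m ∸ y))   ∎)
      where
      ring : ∀ a b c → a + (b + c) ≡ b + a + c
      ring = solve-∀

    -- Among the first `k` colours `b` is present by overflow only. In the others `a` has scaled
    -- load about `y`, and `y ≤ 2m/ℓ` because `D` is at least `ℓ/2`.
    balance : ∀ {A B c} low → ℓ * A ≤ (if low then m else suc y) + c → ℓ * B ≤ (if low then 0 else m ∸ y) + c →
      ℓ * (A + B) ≤ m + (1 + 2 * c) ×
      (ℓ * (ℓ * A) ≤ 2 * m + (ℓ + ℓ * c) ⊎ ℓ * (ℓ * B) ≤ 2 * m + (ℓ + ℓ * c))
    balance {A} {B} {c} true la lb = (begin
        ℓ * (A + B)                        ≡⟨ *-distribˡ-+ ℓ A B ⟩
        ℓ * A + ℓ * B                      ≤⟨ +-mono-≤ la lb ⟩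
        m + c + c                          ≤⟨ m≤m+n _ 1 ⟩
        m + c + c + 1                      ≡⟨ ring m c ⟩
        m + (1 + 2 * c)                    ∎)
      , inj₂ (≤-trans (*-monoʳ-≤ ℓ lb) (≤-trans (m≤n+m (ℓ * c) ℓ) (m≤n+m _ (2 * m))))
      where
      ring : ∀ m c → m + c + c + 1 ≡ m + (1 + 2 * c)
      ring = solve-∀
    balance {A} {B} {c} false la lb = (begin
        ℓ * (A + B)                        ≡⟨ *-distribˡ-+ ℓ A B ⟩
        ℓ * A + ℓ * B                      ≤⟨ +-mono-≤ la lb ⟩
        suc y + c + (m ∸ y + c)            ≡⟨ ring y c (m ∸ y) ⟩
        y + (m ∸ y) + (1 + 2 * c)          ≡⟨ cong (_+ (1 + 2 * c)) (ℕₚ.m+[n∸m]≡n y≤m) ⟩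
        m + (1 + 2 * c)                    ∎)
      , inj₁ (begin
        ℓ * (ℓ * A)                        ≤⟨ *-monoʳ-≤ ℓ la ⟩
        ℓ * (suc y + c)                    ≡⟨ ring₂ ℓ y c ⟩
        ℓ * y + (ℓ + ℓ * c)                ≤⟨ +-monoˡ-≤ _ ℓy≤2m ⟩
        2 * m + (ℓ + ℓ * c)                ∎)
      where
      ring : ∀ y c e → suc y + c + (e + c) ≡ y + e + (1 + 2 * c)
      ring = solve-∀
      ring₂ : ∀ l y c → l * (suc y + c) ≡ l * y + (l + l * c)
      ring₂ = solve-∀
      ring₃ : ∀ D y → (D + D) * y ≡ 2 * (D * y)
      ring₃ = solve-∀
      ℓy≤2m : ℓ * y ≤ 2 * m
      ℓy≤2m = begin
        ℓ * y         ≤⟨ *-monoˡ-≤ y ℓ≤2D ⟩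
        (D + D) * y   ≡⟨ ring₃ D y ⟩
        2 * (D * y)   ≤⟨ *-monoʳ-≤ 2 (≤-trans Dy≤ρ ρ≤m) ⟩
        2 * m         ∎

    group-caps : (a b : Fin R → ℕ) → (∀ r → a r ≤ μ) → (∀ r → b r ≤ μ) →
      sum a + sum b ≡ m → ℓ * sum a ≡ ρ + k * m → Grouping a b
    group-caps a b a≤μ b≤μ Σ≡m ℓa≡ = proj₁ fa , proj₁ fb , λ β → balance (toℕ β <ᵇ k)
        (subst (_≤ cap m (suc y) β + ℓ * μ) (load-* ℓ (proj₁ fa) a β) (proj₂ fa β))
        (subst (_≤ cap 0 (m ∸ y) β + ℓ * μ) (load-* ℓ (proj₁ fb) b β) (proj₂ fb β))
      where
      fa = fill (ℓ * μ) (λ r → ℓ * a r) (cap m (suc y)) (λ r → *-monoʳ-≤ ℓ (a≤μ r)) (begin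
        sum (λ r → ℓ * a r)     ≡⟨ trans (sym (*-distribˡ-sum ℓ a)) ℓa≡ ⟩
        ρ + k * m               ≤⟨ +-monoˡ-≤ (k * m) ρ≤D[1+y] ⟩
        D * suc y + k * m       ≡⟨ +-comm _ (k * m) ⟩
        k * m + D * suc y       ≡⟨ ∑cap m (suc y) ⟨
        sum (cap m (suc y))     ∎)
      fb = fill (ℓ * μ) (λ r → ℓ * b r) (cap 0 (m ∸ y)) (λ r → *-monoʳ-≤ ℓ (b≤μ r))
        (≤-trans (≤-reflexive (sym (*-distribˡ-sum ℓ b))) (∑capB ℓa≡ Σ≡m))

  -- With k = ⌊ℓa/m⌋ the first k colours are filled by a alone; the remainder
  -- of a is spread evenly over the other D = ℓ - k ≥ ℓ/2 colours.
  group-≤ : (a b : Fin R → ℕ) → (∀ r → a r ≤ μ) → (∀ r → b r ≤ μ) →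
    sum a + sum b ≡ m → sum a ≤ sum b → Grouping a b
  group-≤ a b a≤μ b≤μ Σ≡m a≤b =
    go k ρ ℓa≡ (ℕₚ.<⇒≤ (DivMod.m%n<n (ℓ * sum a) m)) 2k≤ℓ
    where
    open ℕₚ.≤-Reasoning
    k = (ℓ * sum a) / m
    ρ = (ℓ * sum a) % m
    ℓa≡ : ℓ * sum a ≡ ρ + k * m
    ℓa≡ = DivMod.m≡m%n+[m/n]*n (ℓ * sum a) m
    2k≤ℓ : k + k ≤ ℓ
    2k≤ℓ = ℕₚ.*-cancelʳ-≤ _ _ m (begin
      (k + k) * m             ≡⟨ ℕₚ.*-distribʳ-+ m k k ⟩
      k * m + k * m           ≤⟨ +-mono-≤ km≤ km≤ ⟩
      ℓ * sum a + ℓ * sum a   ≡⟨ *-distribˡ-+ ℓ (sum a) (sum a) ⟨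
      ℓ * (sum a + sum a)     ≤⟨ *-monoʳ-≤ ℓ (+-monoʳ-≤ (sum a) a≤b) ⟩
      ℓ * (sum a + sum b)     ≡⟨ cong (ℓ *_) Σ≡m ⟩
      ℓ * m                   ∎)
      where
      km≤ : k * m ≤ ℓ * sum a
      km≤ = ≤-trans (m≤n+m (k * m) ρ) (≤-reflexive (sym ℓa≡))
    go : ∀ k ρ → ℓ * sum a ≡ ρ + k * m → ρ ≤ m → k + k ≤ ℓ → Grouping a b
    go k ρ ℓa≡ ρ≤m 2k≤ℓ = group-caps k D (ρ / D) ρ k+D≡ℓ ℓ≤2D
      (≤-trans (≤-reflexive (*-comm D (ρ / D))) (DivMod.m/n*n≤m ρ D))
      (begin
        ρ                       ≡⟨ DivMod.m≡m%n+[m/n]*n ρ D ⟩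
        ρ % D + ρ / D * D       ≤⟨ +-monoˡ-≤ (ρ / D * D) (ℕₚ.<⇒≤ (DivMod.m%n<n ρ D)) ⟩
        D + ρ / D * D           ≡⟨ *-comm (suc (ρ / D)) D ⟩
        D * suc (ρ / D)         ∎)
      ρ≤m (≤-trans (DivMod.m/n≤m ρ D) ρ≤m) a b a≤μ b≤μ Σ≡m ℓa≡
      where
      D = ℓ ∸ k
      k+D≡ℓ : k + D ≡ ℓ
      k+D≡ℓ = ℕₚ.m+[n∸m]≡n (≤-trans (m≤m+n k k) 2k≤ℓ)
      k≤D : k ≤ D
      k≤D = ℕₚ.+-cancelˡ-≤ k k D (≤-trans 2k≤ℓ (≤-reflexive (sym k+D≡ℓ)))
      ℓ≤2D : ℓ ≤ D + D
      ℓ≤2D = ≤-trans (≤-reflexive (sym k+D≡ℓ)) (+-monoˡ-≤ D k≤D)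
      pos : ∀ D → ℓ ≤ D + D → 1 ≤ D
      pos zero    ℓ≤0 = contradiction (≤-trans (n≢0⇒n>0 (ℕ.≢-nonZero⁻¹ ℓ)) ℓ≤0) λ ()
      pos (suc _) _   = s≤s z≤n
      instance
        D≢0 : NonZero D
        D≢0 = >-nonZero (pos D ℓ≤2D)

  group-swap : (a b : Fin R → ℕ) → Grouping a b → Grouping b a
  group-swap a b (f , g , ok) = g , f , λ β →
    subst (λ s → ℓ * s ≤ m + (1 + 2 * (ℓ * μ))) (+-comm (load f a β) (load g b β)) (proj₁ (ok β))
    , Sum.swap (proj₂ (ok β))

  group : (a b : Fin R → ℕ) → (∀ r → a r ≤ μ) → (∀ r → b r ≤ μ) → sum a + sum b ≡ m → Grouping a b
  group a b a≤μ b≤μ Σ≡m = [ group-≤ a b a≤μ b≤μ Σ≡m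
    , (λ b≤a → group-swap b a (group-≤ b a b≤μ a≤μ (trans (+-comm (sum b) (sum a)) Σ≡m) b≤a))
    ]′ (ℕₚ.≤-total (sum a) (sum b))

  -- All colours together carry `m` and none carries much more than `m/ℓ`, so none can fall short by
  -- more than `ℓ` times the slack.
  group-lower : (a b : Fin R → ℕ) → sum a + sum b ≡ m → ((f , g , _) : Grouping a b) → ∀ β →
    m ≤ ℓ * (load f a β + load g b β) + ℓ * (1 + 2 * (ℓ * μ))
  group-lower a b Σ≡m (f , g , ok) β = ℕₚ.+-cancelˡ-≤ (ℓ * m) _ _ (begin
    ℓ * m + m                                  ≤⟨ +-monoʳ-≤ (ℓ * m) (m≤m+n m c) ⟩
    ℓ * m + (m + c)                            ≡⟨ cong (_+ (m + c)) (sym ∑loads) ⟩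
    ∑[ β < ℓ ] (ℓ * (load f a β + load g b β)) + (m + c)
                                               ≤⟨ sum-deficit {ℓ} _ (m + c) (proj₁ ∘ ok) β ⟩
    ℓ * (m + c) + ℓ * (load f a β + load g b β)
                                               ≡⟨ ring ℓ m c (ℓ * (load f a β + load g b β)) ⟩
    ℓ * m + (ℓ * (load f a β + load g b β) + ℓ * c) ∎)
    where
    open ℕₚ.≤-Reasoning
    c = 1 + 2 * (ℓ * μ)
    ring : ∀ l m c s → l * (m + c) + s ≡ l * m + (s + l * c)
    ring = solve-∀
    ∑loads : ∑[ β < ℓ ] (ℓ * (load f a β + load g b β)) ≡ ℓ * m
    ∑loads = trans (sym (*-distribˡ-sum ℓ (λ β → load f a β + load g b β)))
      (cong (ℓ *_) (trans (∑-distrib-+ {ℓ} (load f a) (load g b)) (trans (cong₂ _+_ (∑load f a) (∑load g b)) Σ≡m)))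

-- Quasirandom colour classes

# : (Fin n → Bool) → ℕ
# {n} U = ∑[ x < n ] 𝟙 (U x)

cnt : (U W : Fin n → Bool) (φ : Fin n → Fin n → Bool) → ℕ
cnt {n} U W φ = ∑[ x < n ] ∑[ y < n ] (𝟙 (U x) * (𝟙 (W y) * 𝟙 (φ x y)))

sum₂-cong : {f g : Fin n → Fin t → ℕ} → (∀ x y → f x y ≡ g x y) →
  ∑[ x < n ] ∑[ y < t ] f x y ≡ ∑[ x < n ] ∑[ y < t ] g x y
sum₂-cong {n} {t} f≡g = sum-cong-≗ {n} (λ x → sum-cong-≗ {t} (f≡g x))

sum₂-mono : {f g : Fin n → Fin t → ℕ} → (∀ x y → f x y ≤ g x y) →
  ∑[ x < n ] ∑[ y < t ] f x y ≤ ∑[ x < n ] ∑[ y < t ] g x y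
sum₂-mono {n} {t} f≤g = sum-mono {n} (λ x → sum-mono {t} (f≤g x))

sum₂-distrib-+ : (f g : Fin n → Fin t → ℕ) →
  ∑[ x < n ] ∑[ y < t ] (f x y + g x y) ≡ ∑[ x < n ] ∑[ y < t ] f x y + ∑[ x < n ] ∑[ y < t ] g x y
sum₂-distrib-+ {n} {t} f g = trans (sum-cong-≗ {n} (λ x → ∑-distrib-+ {t} (f x) (g x))) (∑-distrib-+ {n} _ _)

cnt-flip : (U W : Fin n → Bool) (φ : Fin n → Fin n → Bool) → cnt U W φ ≡ cnt W U (flip φ)
cnt-flip {n} U W φ = trans (∑-comm {n} {n} _)
  (sum₂-cong (λ y x → ring (𝟙 (U x)) (𝟙 (W y)) (𝟙 (φ x y))))
  where
  ring : ∀ a b c → a * (b * c) ≡ b * (a * c)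
  ring = solve-∀

_⊆ᴮ_ : (U V : Fin n → Bool) → Set
U ⊆ᴮ V = ∀ x → U x ≡ true → V x ≡ true

#-mono : {U V : Fin n → Bool} → U ⊆ᴮ V → # U ≤ # V
#-mono {n} {U} {V} U⊆V = sum-mono {n} (λ x → le (U x) (V x) (U⊆V x))
  where
  le : ∀ a b → (a ≡ true → b ≡ true) → 𝟙 a ≤ 𝟙 b
  le false b f = z≤n
  le true  b f = ≤-reflexive (cong 𝟙 (sym (f refl)))

cell : (Fin n → Fin t) → Fin t → Fin n → Bool
cell p i x = does (p x ≟ i)

cell⇒≡ : (p : Fin n → Fin t) (i : Fin t) (x : Fin n) → cell p i x ≡ true → p x ≡ i
cell⇒≡ p i x e with p x ≟ i
... | yes px≡i = px≡i

cnt-cong : (U W : Fin n → Bool) {φ ψ : Fin n → Fin n → Bool} →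
  (∀ x y → U x ≡ true → W y ≡ true → φ x y ≡ ψ x y) → cnt U W φ ≡ cnt U W ψ
cnt-cong U W {φ} {ψ} eq = sum₂-cong (λ x y → go x y (U x) (W y) refl refl)
  where
  go : ∀ x y a b → U x ≡ a → W y ≡ b → 𝟙 a * (𝟙 b * 𝟙 (φ x y)) ≡ 𝟙 a * (𝟙 b * 𝟙 (ψ x y))
  go x y true  true  ux wy = cong (λ c → 1 * (1 * 𝟙 c)) (eq x y ux wy)
  go x y true  false _  _  = refl
  go x y false _     _  _  = refl

module _ (p : Fin n → Fin t) (q : ℕ) (φ : Fin n → Fin n → Bool) (c : ℤ) (i j : Fin t)
         (¬irr : ¬ Irregular p (λ x y → + (q * 𝟙 (φ x y))) c i j) where

  private
    F : Fin n → Fin n → ℤ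
    F x y = + (q * 𝟙 (φ x y))
    Vᵢ Vⱼ : Fin n → Bool
    Vᵢ = cell p i
    Vⱼ = cell p j
    m = # Vᵢ * # Vⱼ

  -- The scale `q` lets an integer weight `c` stand for the density `c/q`: a deviation of at most
  -- `m` is a density error of `1/q` relative to the whole pair of parts.
  deviation : (U W : Fin n → Bool) → ℤ
  deviation U W = + (q * cnt U W φ) -ᶻ c *ᶻ + (# U * # W)

  gain-eval : ∀ θ {U W} → U ⊆ᴮ Vᵢ → W ⊆ᴮ Vⱼ →
    gain p F i j c θ (lookup (tabulate U)) (lookup (tabulate W))
      ≡ + 2 *ᶻ θ *ᶻ deviation U W -ᶻ θ *ᶻ θ *ᶻ + (# U * # W)
  gain-eval θ {U} {W} U⊆ W⊆ = begin
    gain p F i j c θ (lookup (tabulate U)) (lookup (tabulate W))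
      ≡⟨ sumᶻ₂-cong (λ x y → cong₂ (λ a b → ι (Vᵢ x) *ᶻ (ι (Vⱼ y) *ᶻ (ι (a ∧ b) *ᶻ (+ 2 *ᶻ θ *ᶻ (F x y -ᶻ c) -ᶻ θ *ᶻ θ))))
           (lookup∘tabulate U x) (lookup∘tabulate W y)) ⟩
    sumᶻ (λ x → sumᶻ (λ y → ι (Vᵢ x) *ᶻ (ι (Vⱼ y) *ᶻ (ι (U x ∧ W y) *ᶻ (+ 2 *ᶻ θ *ᶻ (F x y -ᶻ c) -ᶻ θ *ᶻ θ)))))
      ≡⟨ sumᶻ₂-cong (λ x y → pointwise (φ x y) (Vᵢ x) (U x) (Vⱼ y) (W y) (U⊆ x) (W⊆ y)) ⟩
    sumᶻ (λ x → sumᶻ (λ y → + 2 *ᶻ θ *ᶻ + q *ᶻ + κ x y +ᶻ (- (+ 2 *ᶻ θ *ᶻ c) -ᶻ θ *ᶻ θ) *ᶻ + ν x y))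
      ≡⟨ trans (sumᶻ₂-distrib-+ (λ x y → + 2 *ᶻ θ *ᶻ + q *ᶻ + κ x y) _)
           (cong₂ _+ᶻ_ (pull (+ 2 *ᶻ θ *ᶻ + q) κ) (trans (pull (- (+ 2 *ᶻ θ *ᶻ c) -ᶻ θ *ᶻ θ) ν)
             (cong (λ s → (- (+ 2 *ᶻ θ *ᶻ c) -ᶻ θ *ᶻ θ) *ᶻ + s) (sum-∑∑ (𝟙 ∘ U) (𝟙 ∘ W))))) ⟩
    + 2 *ᶻ θ *ᶻ + q *ᶻ + cnt U W φ +ᶻ (- (+ 2 *ᶻ θ *ᶻ c) -ᶻ θ *ᶻ θ) *ᶻ + (# U * # W)
      ≡⟨ ring θ (+ q) (+ cnt U W φ) c (+ (# U * # W)) ⟩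
    + 2 *ᶻ θ *ᶻ (+ q *ᶻ + cnt U W φ -ᶻ c *ᶻ + (# U * # W)) -ᶻ θ *ᶻ θ *ᶻ + (# U * # W)
      ≡⟨ cong (λ s → + 2 *ᶻ θ *ᶻ (s -ᶻ c *ᶻ + (# U * # W)) -ᶻ θ *ᶻ θ *ᶻ + (# U * # W)) (sym (ℤₚ.pos-* q (cnt U W φ))) ⟩
    + 2 *ᶻ θ *ᶻ deviation U W -ᶻ θ *ᶻ θ *ᶻ + (# U * # W) ∎
    where
    open ≡-Reasoning
    κ ν : Fin n → Fin n → ℕ
    κ x y = 𝟙 (U x) * (𝟙 (W y) * 𝟙 (φ x y))
    ν x y = 𝟙 (U x) * 𝟙 (W y)
    pull : ∀ d (f : Fin n → Fin n → ℕ) → sumᶻ (λ x → sumᶻ (λ y → d *ᶻ + f x y)) ≡ d *ᶻ + ∑[ x < n ] ∑[ y < n ] f x y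
    pull d f = sym (trans (cong (d *ᶻ_) (sym (sumᶻ₂-+ f)))
      (trans (*-distribˡ-sumᶻ d (λ x → sumᶻ (λ y → + f x y)))
        (sumᶻ-cong {n} (λ x → *-distribˡ-sumᶻ d (λ y → + f x y)))))
    ring : ∀ θ q k c b → + 2 *ᶻ θ *ᶻ q *ᶻ k +ᶻ (- (+ 2 *ᶻ θ *ᶻ c) -ᶻ θ *ᶻ θ) *ᶻ b ≡
      + 2 *ᶻ θ *ᶻ (q *ᶻ k -ᶻ c *ᶻ b) -ᶻ θ *ᶻ θ *ᶻ b
    ring = solveᶻ-∀
    ring₁ : ∀ θ q k c → + 1 *ᶻ (+ 1 *ᶻ (+ 1 *ᶻ (+ 2 *ᶻ θ *ᶻ (q *ᶻ k -ᶻ c) -ᶻ θ *ᶻ θ))) ≡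
      + 2 *ᶻ θ *ᶻ q *ᶻ k +ᶻ (- (+ 2 *ᶻ θ *ᶻ c) -ᶻ θ *ᶻ θ) *ᶻ + 1
    ring₁ = solveᶻ-∀
    ring₀ : ∀ θ q a c a′ b′ → a′ *ᶻ (b′ *ᶻ (+ 0 *ᶻ (+ 2 *ᶻ θ *ᶻ (a -ᶻ c) -ᶻ θ *ᶻ θ))) ≡
      + 2 *ᶻ θ *ᶻ q *ᶻ + 0 +ᶻ (- (+ 2 *ᶻ θ *ᶻ c) -ᶻ θ *ᶻ θ) *ᶻ + 0
    ring₀ = solveᶻ-∀
    pointwise : ∀ f vᵢ u vⱼ w → (u ≡ true → vᵢ ≡ true) → (w ≡ true → vⱼ ≡ true) →
      ι vᵢ *ᶻ (ι vⱼ *ᶻ (ι (u ∧ w) *ᶻ (+ 2 *ᶻ θ *ᶻ (+ (q * 𝟙 f) -ᶻ c) -ᶻ θ *ᶻ θ))) ≡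
      + 2 *ᶻ θ *ᶻ + q *ᶻ + (𝟙 u * (𝟙 w * 𝟙 f)) +ᶻ (- (+ 2 *ᶻ θ *ᶻ c) -ᶻ θ *ᶻ θ) *ᶻ + (𝟙 u * 𝟙 w)
    pointwise f vᵢ false vⱼ w     _ _ = ring₀ θ (+ q) (+ (q * 𝟙 f)) c (ι vᵢ) (ι vⱼ)
    pointwise f vᵢ true  vⱼ false _ _ = ring₀ θ (+ q) (+ (q * 𝟙 f)) c (ι vᵢ) (ι vⱼ)
    pointwise f vᵢ true  vⱼ true  a b with a refl | b refl
    ... | refl | refl = trans (cong (λ s → + 1 *ᶻ (+ 1 *ᶻ (+ 1 *ᶻ (+ 2 *ᶻ θ *ᶻ (s -ᶻ c) -ᶻ θ *ᶻ θ)))) (ℤₚ.pos-* q (𝟙 f)))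
          (trans (ring₁ θ (+ q) (+ 𝟙 f) c) (cong (λ s → + 2 *ᶻ θ *ᶻ + q *ᶻ + s +ᶻ (- (+ 2 *ᶻ θ *ᶻ c) -ᶻ θ *ᶻ θ) *ᶻ + 1)
            (sym (trans (*-identityˡ _) (*-identityˡ _)))))

  area≤ : ∀ {U W} → U ⊆ᴮ Vᵢ → W ⊆ᴮ Vⱼ → # U * # W ≤ m
  area≤ U⊆ W⊆ = *-mono-≤ (#-mono U⊆) (#-mono W⊆)

  private
    halve : ∀ {θ d b} → θ *ᶻ θ ≡ 1ℤ → + 2 *ᶻ θ *ᶻ d -ᶻ θ *ᶻ θ *ᶻ + b ≤ᶻ + m → b ≤ m → θ *ᶻ d ≤ᶻ + m
    halve {θ} {d} {b} θ² le b≤m = ℤₚ.*-cancelˡ-≤-pos _ _ (+ 2) (begin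
      + 2 *ᶻ (θ *ᶻ d)                                       ≡⟨ ring θ d (+ b) ⟩
      (+ 2 *ᶻ θ *ᶻ d -ᶻ + 1 *ᶻ + b) +ᶻ + b                  ≡⟨ cong (λ s → (+ 2 *ᶻ θ *ᶻ d -ᶻ s *ᶻ + b) +ᶻ + b) (sym θ²) ⟩
      (+ 2 *ᶻ θ *ᶻ d -ᶻ θ *ᶻ θ *ᶻ + b) +ᶻ + b               ≤⟨ ℤₚ.+-mono-≤ le (ℤ.+≤+ b≤m) ⟩
      + m +ᶻ + m                                            ≡⟨ ring₂ (+ m) ⟩
      + 2 *ᶻ + m                                            ∎)
      where
      open ℤₚ.≤-Reasoning
      ring : ∀ θ d b → + 2 *ᶻ (θ *ᶻ d) ≡ (+ 2 *ᶻ θ *ᶻ d -ᶻ + 1 *ᶻ b) +ᶻ b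
      ring = solveᶻ-∀
      ring₂ : ∀ m → m +ᶻ m ≡ + 2 *ᶻ m
      ring₂ = solveᶻ-∀

    not-gainful : ∀ θ → ¬ Gainful p F c i j θ → ∀ {U W} → U ⊆ᴮ Vᵢ → W ⊆ᴮ Vⱼ →
      + 2 *ᶻ θ *ᶻ deviation U W -ᶻ θ *ᶻ θ *ᶻ + (# U * # W) ≤ᶻ + m
    not-gainful θ ¬g {U} {W} U⊆ W⊆ = subst (_≤ᶻ + m) (gain-eval θ U⊆ W⊆)
      (ℤₚ.<⇒≤ (ℤₚ.≰⇒> (λ le → ¬g (tabulate U , tabulate W , le))))

  -- If neither sign is gainful, `2 θ deviation - area < m` for `θ = ±1`; since the area is at most
  -- `m`, halving gives the bound.
  deviation≤ : ∀ {U W} → U ⊆ᴮ Vᵢ → W ⊆ᴮ Vⱼ → deviation U W ≤ᶻ + m × - deviation U W ≤ᶻ + m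
  deviation≤ {U} {W} U⊆ W⊆ =
      subst (_≤ᶻ + m) (ℤₚ.*-identityˡ _)
        (halve {1ℤ} refl (not-gainful 1ℤ (¬irr ∘ inj₁) U⊆ W⊆) (area≤ U⊆ W⊆))
    , subst (_≤ᶻ + m) (ℤₚ.-1*i≡-i _)
        (halve { -1ℤ} refl (not-gainful -1ℤ (¬irr ∘ inj₂) U⊆ W⊆) (area≤ U⊆ W⊆))

  -- The weight `c` need not be the true density. Subtracting the estimate for the whole pair of
  -- parts eliminates it, at the price of doubling the error.
  regular-density : ∀ {U W} → U ⊆ᴮ Vᵢ → W ⊆ᴮ Vⱼ →
    q * (m * cnt U W φ) ≤ q * (cnt Vᵢ Vⱼ φ * (# U * # W)) + 2 * (m * m) ×
    q * (cnt Vᵢ Vⱼ φ * (# U * # W)) ≤ q * (m * cnt U W φ) + 2 * (m * m)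
  regular-density {U} {W} U⊆ W⊆ =
      transfer (q * (m * K)) (q * (S * B)) (ℤₚ.≤-trans (ℤₚ.≤-reflexive cross)
        (bound dUW (proj₁ dev) (proj₂ devV)))
    , transfer (q * (S * B)) (q * (m * K)) (ℤₚ.≤-trans (ℤₚ.≤-reflexive cross′)
        (bound (- dUW) (proj₂ dev) (ℤₚ.≤-trans (ℤₚ.≤-reflexive (ℤₚ.neg-involutive dV)) (proj₁ devV))))
    where
    K = cnt U W φ
    S = cnt Vᵢ Vⱼ φ
    B = # U * # W
    dUW = deviation U W
    dV = deviation Vᵢ Vⱼ
    dev = deviation≤ U⊆ W⊆
    devV = deviation≤ {Vᵢ} {Vⱼ} (λ _ e → e) (λ _ e → e)
    cast₃ : ∀ a b c → + (a * (b * c)) ≡ + a *ᶻ (+ b *ᶻ + c)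
    cast₃ a b c = trans (ℤₚ.pos-* a (b * c)) (cong (+ a *ᶻ_) (ℤₚ.pos-* b c))
    ring : ∀ q m K S B c → q *ᶻ (m *ᶻ K) -ᶻ q *ᶻ (S *ᶻ B) ≡ m *ᶻ (q *ᶻ K -ᶻ c *ᶻ B) +ᶻ B *ᶻ - (q *ᶻ S -ᶻ c *ᶻ m)
    ring = solveᶻ-∀
    cross : + (q * (m * K)) -ᶻ + (q * (S * B)) ≡ + m *ᶻ dUW +ᶻ + B *ᶻ - dV
    cross = trans (cong₂ _-ᶻ_ (cast₃ q m K) (cast₃ q S B)) (trans (ring (+ q) (+ m) (+ K) (+ S) (+ B) c)
      (cong₂ (λ a b → + m *ᶻ (a -ᶻ c *ᶻ + B) +ᶻ + B *ᶻ - (b -ᶻ c *ᶻ + m)) (sym (ℤₚ.pos-* q K)) (sym (ℤₚ.pos-* q S))))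
    ring′ : ∀ q m K S B c → q *ᶻ (S *ᶻ B) -ᶻ q *ᶻ (m *ᶻ K) ≡ m *ᶻ - (q *ᶻ K -ᶻ c *ᶻ B) +ᶻ B *ᶻ - - (q *ᶻ S -ᶻ c *ᶻ m)
    ring′ = solveᶻ-∀
    cross′ : + (q * (S * B)) -ᶻ + (q * (m * K)) ≡ + m *ᶻ - dUW +ᶻ + B *ᶻ - - dV
    cross′ = trans (cong₂ _-ᶻ_ (cast₃ q S B) (cast₃ q m K)) (trans (ring′ (+ q) (+ m) (+ K) (+ S) (+ B) c)
      (cong₂ (λ a b → + m *ᶻ - (a -ᶻ c *ᶻ + B) +ᶻ + B *ᶻ - - (b -ᶻ c *ᶻ + m)) (sym (ℤₚ.pos-* q K)) (sym (ℤₚ.pos-* q S))))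
    bound : ∀ d {e} → d ≤ᶻ + m → e ≤ᶻ + m → + m *ᶻ d +ᶻ + B *ᶻ e ≤ᶻ + (2 * (m * m))
    bound d {e} d≤ e≤ = ℤₚ.≤-trans (ℤₚ.+-mono-≤ (ℤₚ.*-monoˡ-≤-nonNeg (+ m) d≤) (ℤₚ.*-monoˡ-≤-nonNeg (+ B) e≤))
      (ℤₚ.≤-trans (ℤₚ.≤-reflexive (cong₂ _+ᶻ_ (sym (ℤₚ.pos-* m m)) (sym (ℤₚ.pos-* B m))))
        (ℤ.+≤+ (+-monoʳ-≤ (m * m) (≤-trans (*-monoˡ-≤ m (area≤ U⊆ W⊆)) (≤-reflexive (sym (+-identityʳ _)))))))
    transfer : ∀ a b {e} → + a -ᶻ + b ≤ᶻ + e → a ≤ b + e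
    transfer a b {e} le = ℤₚ.drop‿+≤+ (ℤₚ.≤-trans (ℤₚ.≤-reflexive (ring″ (+ a) (+ b))) (ℤₚ.+-monoʳ-≤ (+ b) le))
      where
      ring″ : ∀ a b → a ≡ b +ᶻ (a -ᶻ b)
      ring″ = solveᶻ-∀

-- A colour may receive any number of the `R` pieces, so the errors of all of them are allowed for.
load-density : ∀ {q m b e} (f : Fin R → Fin ℓ) (x y : Fin R → ℕ) →
  (∀ r → q * (m * x r) ≤ q * (y r * b) + e) → ∀ β →
  q * (m * load f x β) ≤ q * (load f y β * b) + R * e
load-density {R} {ℓ} {q} {m} {b} {e} f x y le β = begin
  q * (m * load f x β)
    ≡⟨ trans (cong (q *_) (*-distribˡ-sum m (λ r → w r * x r))) (*-distribˡ-sum q (λ r → m * (w r * x r))) ⟩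
  ∑[ r < R ] (q * (m * (w r * x r)))
    ≤⟨ sum-mono {R} (λ r → term r) ⟩
  ∑[ r < R ] (q * (w r * y r * b) + e)
    ≡⟨ trans (∑-distrib-+ {R} (λ r → q * (w r * y r * b)) (λ _ → e)) (cong₂ _+_
         (trans (sym (*-distribˡ-sum q (λ r → w r * y r * b))) (cong (q *_) (sym (*-distribʳ-sum b (λ r → w r * y r)))))
         (sum-const R e)) ⟩
  q * (load f y β * b) + R * e ∎
  where
  open ℕₚ.≤-Reasoning
  w : Fin R → ℕ
  w r = 𝟙 (does (f r ≟ β))
  ring₁ : ∀ q m w x → q * (m * (w * x)) ≡ w * (q * (m * x))
  ring₁ = solve-∀
  ring₂ : ∀ q w y b e → w * (q * (y * b) + e) ≡ q * (w * y * b) + w * e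
  ring₂ = solve-∀
  term : ∀ r → q * (m * (w r * x r)) ≤ q * (w r * y r * b) + e
  term r = begin
    q * (m * (w r * x r))               ≡⟨ ring₁ q m (w r) (x r) ⟩
    w r * (q * (m * x r))               ≤⟨ *-monoʳ-≤ (w r) (le r) ⟩
    w r * (q * (y r * b) + e)           ≡⟨ ring₂ q (w r) (y r) b e ⟩
    q * (w r * y r * b) + w r * e       ≤⟨ +-monoʳ-≤ (q * (w r * y r * b))
                                             (≤-trans (*-monoˡ-≤ e (𝟙≤1 (does (f r ≟ β)))) (≤-reflexive (*-identityˡ e))) ⟩
    q * (w r * y r * b) + e             ∎

load-density′ : ∀ {q m b e} (f : Fin R → Fin ℓ) (x y : Fin R → ℕ) →
  (∀ r → q * (y r * b) ≤ q * (m * x r) + e) → ∀ β →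
  q * (load f y β * b) ≤ q * (m * load f x β) + R * e
load-density′ {R} {ℓ} {q} {m} {b} {e} f x y le β =
  subst₂ (λ u v → q * u ≤ q * v + R * e) (*-comm b _) (*-comm _ m)
    (load-density {R} {ℓ} {q} {b} {m} {e} f y x
      (λ r → subst₂ (λ u v → q * u ≤ q * v + e) (*-comm (y r) b) (*-comm m (x r)) (le r)) β)

-- Arithmetic of the error terms

module Arithmetic (p ℓ lam m : ℕ) .{{_ : NonZero p}} .{{_ : NonZero ℓ}} .{{_ : NonZero lam}} .{{_ : NonZero m}} where
  open ℕₚ.≤-Reasoning

  -- Up to `2 lam` pieces in a colour, each with error `2 m²`, add up to `4 lam m²`, which is
  -- `q m²/(2 ℓ p)`.
  q : ℕ
  q = 8 * (lam * (ℓ * p))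

  private
    cancel₄ : ∀ {x y} → q * x ≤ q * y + (lam * (2 * (m * m)) + lam * (2 * (m * m))) →
              2 * (ℓ * p) * x ≤ 2 * (ℓ * p) * y + m * m
    cancel₄ {x} {y} le = *-cancelˡ-≤ (4 * lam) {{m*n≢0 4 lam}} (begin
      4 * lam * (2 * (ℓ * p) * x)             ≡⟨ ring₁ lam (ℓ * p) x ⟩
      q * x                                   ≤⟨ le ⟩
      q * y + (lam * (2 * (m * m)) + lam * (2 * (m * m))) ≡⟨ ring₂ lam (ℓ * p) y (m * m) ⟩
      4 * lam * (2 * (ℓ * p) * y + m * m)     ∎)
      where
      ring₁ : ∀ l a x → 4 * l * (2 * a * x) ≡ 8 * (l * a) * x
      ring₁ = solve-∀
      ring₂ : ∀ l a y e → 8 * (l * a) * y + (l * (2 * e) + l * (2 * e)) ≡ 4 * l * (2 * a * y + e)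
      ring₂ = solve-∀

    instance
      2m≢0 : NonZero (2 * m)
      2m≢0 = m*n≢0 2 m

  upper : ∀ {M S b c} → q * (m * M) ≤ q * (S * b) + (lam * (2 * (m * m)) + lam * (2 * (m * m))) →
    ℓ * S ≤ m + c → 2 * (p * (ℓ * c)) ≤ m → b ≤ m → p * (ℓ * M) ≤ p * b + m
  upper {M} {S} {b} {c} le S≤ c≤ b≤m = *-cancelˡ-≤ (2 * m) (begin
    2 * m * (p * (ℓ * M))                     ≡⟨ ring₁ m p ℓ M ⟩
    2 * (ℓ * p) * (m * M)                     ≤⟨ cancel₄ le ⟩
    2 * (ℓ * p) * (S * b) + m * m             ≡⟨ cong (_+ m * m) (ring₂ ℓ p S b) ⟩
    2 * p * b * (ℓ * S) + m * m               ≤⟨ +-monoˡ-≤ (m * m) (*-monoʳ-≤ (2 * p * b) S≤) ⟩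
    2 * p * b * (m + c) + m * m               ≡⟨ ring₃ p b m c ⟩
    2 * m * (p * b) + m * m + 2 * (p * c) * b ≤⟨ +-monoʳ-≤ (2 * m * (p * b) + m * m) (*-mono-≤
                                                   (≤-trans (*-monoʳ-≤ 2 (*-monoʳ-≤ p (m≤n*m c ℓ))) c≤) b≤m) ⟩
    2 * m * (p * b) + m * m + m * m           ≡⟨ ring₄ m p b ⟩
    2 * m * (p * b + m)                       ∎)
    where
    ring₁ : ∀ m p l M → 2 * m * (p * (l * M)) ≡ 2 * (l * p) * (m * M)
    ring₁ = solve-∀
    ring₂ : ∀ l p S b → 2 * (l * p) * (S * b) ≡ 2 * p * b * (l * S)
    ring₂ = solve-∀
    ring₃ : ∀ p b m c → 2 * p * b * (m + c) + m * m ≡ 2 * m * (p * b) + m * m + 2 * (p * c) * b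
    ring₃ = solve-∀
    ring₄ : ∀ m p b → 2 * m * (p * b) + m * m + m * m ≡ 2 * m * (p * b + m)
    ring₄ = solve-∀

  lower : ∀ {M S b c} → q * (S * b) ≤ q * (m * M) + (lam * (2 * (m * m)) + lam * (2 * (m * m))) →
    m ≤ ℓ * S + ℓ * c → 2 * (p * (ℓ * c)) ≤ m → b ≤ m → p * b ≤ p * (ℓ * M) + m
  lower {M} {S} {b} {c} le ≤S c≤ b≤m = *-cancelˡ-≤ (2 * m) (begin
    2 * m * (p * b)                           ≡⟨ ring₀ m p b ⟩
    2 * p * b * m                             ≤⟨ *-monoʳ-≤ (2 * p * b) ≤S ⟩
    2 * p * b * (ℓ * S + ℓ * c)               ≡⟨ ring₁ p b ℓ S c ⟩
    2 * (ℓ * p) * (S * b) + 2 * (p * (ℓ * c)) * b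
                                              ≤⟨ +-mono-≤ (cancel₄ le) (*-mono-≤ c≤ b≤m) ⟩
    2 * (ℓ * p) * (m * M) + m * m + m * m     ≡⟨ ring₂ ℓ p m M ⟩
    2 * m * (p * (ℓ * M) + m)                 ∎)
    where
    ring₀ : ∀ m p b → 2 * m * (p * b) ≡ 2 * p * b * m
    ring₀ = solve-∀
    ring₁ : ∀ p b l S c → 2 * p * b * (l * S + l * c) ≡ 2 * (l * p) * (S * b) + 2 * (p * (l * c)) * b
    ring₁ = solve-∀
    ring₂ : ∀ l p m M → 2 * (l * p) * (m * M) + m * m + m * m ≡ 2 * m * (p * (l * M) + m)
    ring₂ = solve-∀

  -- A load of at most `3m/ℓ²` means density `3/ℓ²`, up to an error `m/(4 p ℓ)`; multiplication by
  -- `4 p ℓ²` clears the denominators.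
  minor : ∀ {M S b} → q * (m * M) ≤ q * (S * b) + lam * (2 * (m * m)) → ℓ * (ℓ * S) ≤ 3 * m →
    4 * (p * (ℓ * ℓ)) * M ≤ 12 * (p * b) + ℓ * m
  minor {M} {S} {b} le S≤ = *-cancelˡ-≤ (2 * lam * m) {{m*n≢0 (2 * lam) m {{m*n≢0 2 lam}}}} (begin
    2 * lam * m * (4 * (p * (ℓ * ℓ)) * M)     ≡⟨ ring₁ lam m p ℓ M ⟩
    ℓ * (q * (m * M))                         ≤⟨ *-monoʳ-≤ ℓ le ⟩
    ℓ * (q * (S * b) + lam * (2 * (m * m)))   ≡⟨ ring₂ lam m p ℓ S b ⟩
    8 * lam * p * b * (ℓ * (ℓ * S)) + ℓ * (lam * (2 * (m * m)))
                                              ≤⟨ +-monoˡ-≤ _ (*-monoʳ-≤ (8 * lam * p * b) S≤) ⟩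
    8 * lam * p * b * (3 * m) + ℓ * (lam * (2 * (m * m)))
                                              ≡⟨ ring₃ lam m p ℓ b ⟩
    2 * lam * m * (12 * (p * b) + ℓ * m)      ∎)
    where
    ring₁ : ∀ k m p l M → 2 * k * m * (4 * (p * (l * l)) * M) ≡ l * (8 * (k * (l * p)) * (m * M))
    ring₁ = solve-∀
    ring₂ : ∀ k m p l S b → l * (8 * (k * (l * p)) * (S * b) + k * (2 * (m * m))) ≡
      8 * k * p * b * (l * (l * S)) + l * (k * (2 * (m * m)))
    ring₂ = solve-∀
    ring₃ : ∀ k m p l b → 8 * k * p * b * (3 * m) + l * (k * (2 * (m * m))) ≡ 2 * k * m * (12 * (p * b) + l * m)
    ring₃ = solve-∀

module Slack (p ℓ m μ : ℕ) .{{_ : NonZero p}} (4pℓ≤m : 4 * (p * ℓ) ≤ m)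
             (μ-small : 16 * (p * (ℓ * ℓ)) * μ ≤ 2 * m) where
  open ℕₚ.≤-Reasoning

  -- The two hypotheses of the module pay `m/2` each, one for rounding and one for the greedy
  -- overflow.
  slack : 2 * (p * (ℓ * (1 + 2 * (ℓ * μ)))) ≤ m
  slack = *-cancelˡ-≤ 4 (begin
    4 * (2 * (p * (ℓ * (1 + 2 * (ℓ * μ)))))   ≡⟨ ring₁ p ℓ μ ⟩
    2 * (4 * (p * ℓ)) + 16 * (p * (ℓ * ℓ)) * μ ≤⟨ +-mono-≤ (*-monoʳ-≤ 2 4pℓ≤m) μ-small ⟩
    2 * m + 2 * m                             ≡⟨ ring₂ m ⟩
    4 * m                                     ∎)
    where
    ring₁ : ∀ p l u → 4 * (2 * (p * (l * (1 + 2 * (l * u))))) ≡ 2 * (4 * (p * l)) + 16 * (p * (l * l)) * u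
    ring₁ = solve-∀
    ring₂ : ∀ m → 2 * m + 2 * m ≡ 4 * m
    ring₂ = solve-∀

  slack′ : 2 * m + (ℓ + ℓ * (ℓ * μ)) ≤ 3 * m
  slack′ = ≤-trans (+-monoʳ-≤ (2 * m) (*-cancelˡ-≤ 16 (begin
    16 * (ℓ + ℓ * (ℓ * μ))                    ≤⟨ m≤n*m _ p ⟩
    p * (16 * (ℓ + ℓ * (ℓ * μ)))              ≡⟨ ring₁ p ℓ μ ⟩
    4 * (4 * (p * ℓ)) + 16 * (p * (ℓ * ℓ)) * μ ≤⟨ +-mono-≤ (*-monoʳ-≤ 4 4pℓ≤m) μ-small ⟩
    4 * m + 2 * m                             ≡⟨ ℕₚ.*-distribʳ-+ m 4 2 ⟨
    6 * m                                     ≤⟨ *-monoˡ-≤ m (m≤m+n 6 10) ⟩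
    16 * m                                    ∎))) (≤-reflexive (ring₂ m))
    where
    ring₁ : ∀ p l u → p * (16 * (l + l * (l * u))) ≡ 4 * (4 * (p * l)) + 16 * (p * (l * l)) * u
    ring₁ = solve-∀
    ring₂ : ∀ m → 2 * m + m ≡ 3 * m
    ring₂ = solve-∀

sel : Bool → Bool → Bool
sel e b = if e then b else not b

-- Up to an error of 1/p, the colour class is quasirandom of density 1/ℓ, and its
-- part inside or outside the graph E has density O(1/ℓ²).
module _ (p ℓ : ℕ) (E : Fin n → Fin n → Bool) (colour : Fin n → Fin n → Fin ℓ) (part : Fin n → Fin t) where

  Uniform : Fin t → Fin t → Fin ℓ → Set
  Uniform i j β = ∀ {U W} → U ⊆ᴮ cell part i → W ⊆ᴮ cell part j →
    p * (ℓ * cnt U W (λ x y → does (colour x y ≟ β))) ≤ p * (# U * # W) + size part i * size part j ×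
    p * (# U * # W) ≤ p * (ℓ * cnt U W (λ x y → does (colour x y ≟ β))) + size part i * size part j

  Sparse : Bool → Fin t → Fin t → Fin ℓ → Set
  Sparse e i j β = ∀ {U W} → U ⊆ᴮ cell part i → W ⊆ᴮ cell part j →
    4 * (p * (ℓ * ℓ)) * cnt U W (λ x y → sel e (E x y) ∧ does (colour x y ≟ β))
      ≤ 12 * (p * (# U * # W)) + ℓ * (size part i * size part j)

  Good : Fin t → Fin t → Set
  Good i j = ∀ β → Uniform i j β × (Sparse true i j β ⊎ Sparse false i j β)

  good-sym : (∀ x y → E x y ≡ E y x) → (∀ x y → colour x y ≡ colour y x) →
    ∀ i j → Good i j → Good j i
  good-sym E-sym c-sym i j good β = uniform , Sum.map (sparse true) (sparse false) (proj₂ (good β))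
    where
    flipped : (φ : Fin n → Fin n → Bool) → (∀ x y → φ x y ≡ φ y x) → ∀ U W → cnt W U φ ≡ cnt U W φ
    flipped φ φ-sym U W = trans (cnt-flip W U φ) (cnt-cong U W (λ x y _ _ → φ-sym y x))
    areas : (U W : Fin n → Bool) → # W * # U ≡ # U * # W
    areas U W = *-comm (# W) (# U)
    sizes : size part i * size part j ≡ size part j * size part i
    sizes = *-comm (size part i) (size part j)
    uniform : Uniform j i β
    uniform {U} {W} U⊆ W⊆ = let up , lo = proj₁ (good β) W⊆ U⊆ in
        subst₂ _≤_ (cong (λ c → p * (ℓ * c)) cs) (cong₂ (λ a s → p * a + s) (areas U W) sizes) up
      , subst₂ _≤_ (cong (p *_) (areas U W)) (cong₂ (λ c s → p * (ℓ * c) + s) cs sizes) lo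
      where
      cs = flipped (λ x y → does (colour x y ≟ β)) (λ x y → cong (λ c → does (c ≟ β)) (c-sym x y)) U W
    sparse : ∀ e → Sparse e i j β → Sparse e j i β
    sparse e sp {U} {W} U⊆ W⊆ = subst₂ _≤_
      (cong (4 * (p * (ℓ * ℓ)) *_) (flipped (λ x y → sel e (E x y) ∧ does (colour x y ≟ β))
        (λ x y → cong₂ (λ a c → sel e a ∧ does (c ≟ β)) (E-sym x y) (c-sym x y)) U W))
      (cong₂ (λ a s → 12 * (p * a) + ℓ * s) (areas U W) sizes) (sp W⊆ U⊆)

-- Hues split by a graph

module Pieces (lam ℓ : ℕ) (E : Fin n → Fin n → Bool) (hue : Fin n → Fin n → Fin lam) where

  piece : Bool → Fin lam → Fin n → Fin n → Bool
  piece e α x y = sel e (E x y) ∧ does (α ≟ hue x y)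

  𝟙-≟-sym : ∀ {k} (a b : Fin k) → 𝟙 (does (a ≟ b)) ≡ 𝟙 (does (b ≟ a))
  𝟙-≟-sym a b = ℕₚ.≤-antisym (𝟙-mono (a ≟ b) (b ≟ a) sym) (𝟙-mono (b ≟ a) (a ≟ b) sym)

  sum-hue : (φ : Fin lam → ℕ) (e : Bool) (x y : Fin n) →
    ∑[ α < lam ] (φ α * 𝟙 (piece e α x y)) ≡ 𝟙 (sel e (E x y)) * φ (hue x y)
  sum-hue φ e x y = trans (sum-cong-≗ {lam} (λ α → trans (cong (φ α *_)
        (trans (𝟙-∧ s (does (α ≟ hue x y))) (cong (𝟙 s *_) (𝟙-≟-sym α (hue x y)))))
        (ring (φ α) (𝟙 s) (𝟙 (does (hue x y ≟ α))))))
    (trans (sym (*-distribˡ-sum (𝟙 s) (λ α → 𝟙 (does (hue x y ≟ α)) * φ α)))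
      (cong (𝟙 s *_) (sum-δ (hue x y) φ)))
    where
    s = sel e (E x y)
    ring : ∀ a b c → a * (b * c) ≡ b * (c * a)
    ring = solve-∀

  sum-cnt : (φ : Fin lam → ℕ) (e : Bool) (U W : Fin n → Bool) →
    ∑[ α < lam ] (φ α * cnt U W (piece e α)) ≡
    ∑[ x < n ] ∑[ y < n ] (𝟙 (U x) * (𝟙 (W y) * (𝟙 (sel e (E x y)) * φ (hue x y))))
  sum-cnt φ e U W = begin
    ∑[ α < lam ] (φ α * cnt U W (piece e α))
      ≡⟨ sum-cong-≗ {lam} (λ α → trans (*-distribˡ-sum (φ α) (λ x → ∑[ y < n ] k α x y))
           (sum-cong-≗ {n} (λ x → *-distribˡ-sum (φ α) (k α x)))) ⟩
    ∑[ α < lam ] ∑[ x < n ] ∑[ y < n ] (φ α * k α x y)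
      ≡⟨ trans (∑-comm {lam} {n} (λ α x → ∑[ y < n ] (φ α * k α x y)))
           (sum-cong-≗ {n} (λ x → ∑-comm {lam} {n} (λ α y → φ α * k α x y))) ⟩
    ∑[ x < n ] ∑[ y < n ] ∑[ α < lam ] (φ α * k α x y)
      ≡⟨ sum₂-cong (λ x y → trans (sum-cong-≗ {lam} (λ α → ring (φ α) (𝟙 (U x)) (𝟙 (W y)) (𝟙 (piece e α x y))))
           (trans (sym (*-distribˡ-sum (𝟙 (U x) * 𝟙 (W y)) (λ α → φ α * 𝟙 (piece e α x y))))
             (trans (cong (𝟙 (U x) * 𝟙 (W y) *_) (sum-hue φ e x y)) (*-assoc (𝟙 (U x)) (𝟙 (W y)) _)))) ⟩
    ∑[ x < n ] ∑[ y < n ] (𝟙 (U x) * (𝟙 (W y) * (𝟙 (sel e (E x y)) * φ (hue x y)))) ∎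
    where
    open ≡-Reasoning
    k : Fin lam → Fin n → Fin n → ℕ
    k α x y = 𝟙 (U x) * (𝟙 (W y) * 𝟙 (piece e α x y))
    ring : ∀ f u w s → f * (u * (w * s)) ≡ u * w * (f * s)
    ring = solve-∀

  -- The two halves of a hue, inside and outside `E`, have independent destinations, so every colour
  -- is a union of pieces.
  assign : (f g : Fin lam → Fin ℓ) → Fin n → Fin n → Fin ℓ
  assign f g x y = if E x y then f (hue x y) else g (hue x y)

  private
    pick : ∀ (f g : Fin lam → Fin ℓ) e x y β →
      𝟙 (sel e (E x y)) * 𝟙 (does ((if e then f else g) (hue x y) ≟ β)) ≡
      𝟙 (sel e (E x y) ∧ does (assign f g x y ≟ β))
    pick f g true  x y β with E x y
    ... | true  = *-identityˡ _
    ... | false = refl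
    pick f g false x y β with E x y
    ... | true  = refl
    ... | false = *-identityˡ _

  -- A piece goes to one colour as a whole, so pairs of a colour on one side of `E` are counted by
  -- the load of a bin; this links the grouping to the graph.
  load-piece : (f g : Fin lam → Fin ℓ) (e : Bool) (U W : Fin n → Bool) (β : Fin ℓ) →
    load (if e then f else g) (λ α → cnt U W (piece e α)) β ≡
    cnt U W (λ x y → sel e (E x y) ∧ does (assign f g x y ≟ β))
  load-piece f g e U W β = trans
    (sum-cnt (λ α → 𝟙 (does ((if e then f else g) α ≟ β))) e U W)
    (sum₂-cong (λ x y → cong (λ s → 𝟙 (U x) * (𝟙 (W y) * s)) (pick f g e x y β)))

  cnt-split : (U W : Fin n → Bool) (φ : Fin n → Fin n → Bool) →
    cnt U W (λ x y → sel true (E x y) ∧ φ x y) + cnt U W (λ x y → sel false (E x y) ∧ φ x y) ≡ cnt U W φ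
  cnt-split U W φ = trans (sym (sum₂-distrib-+ (λ x y → 𝟙 (U x) * (𝟙 (W y) * 𝟙 (E x y ∧ φ x y))) _))
    (sum₂-cong (λ x y → trans (sym (ring (𝟙 (U x)) (𝟙 (W y)) _ _)) (cong (λ s → 𝟙 (U x) * (𝟙 (W y) * s)) (go (E x y) (φ x y)))))
    where
    ring : ∀ u w a b → u * (w * (a + b)) ≡ u * (w * a) + u * (w * b)
    ring = solve-∀
    go : ∀ a b → 𝟙 (a ∧ b) + 𝟙 (not a ∧ b) ≡ 𝟙 b
    go true  b = +-identityʳ _
    go false b = refl

  ∑pieces : (U W : Fin n → Bool) →
    ∑[ α < lam ] cnt U W (piece true α) + ∑[ α < lam ] cnt U W (piece false α) ≡ # U * # W
  ∑pieces U W = trans (cong₂ _+_ (one true) (one false))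
    (trans (sym (sum₂-distrib-+ (λ x y → 𝟙 (U x) * (𝟙 (W y) * (𝟙 (E x y) * 1))) _))
      (trans (sum₂-cong (λ x y → trans (sym (ring (𝟙 (U x)) (𝟙 (W y)) _ _)) (go (𝟙 (U x)) (𝟙 (W y)) (E x y)))) (sum-∑∑ (𝟙 ∘ U) (𝟙 ∘ W))))
    where
    one : ∀ e → ∑[ α < lam ] cnt U W (piece e α) ≡ _
    one e = trans (sum-cong-≗ {lam} (λ α → sym (*-identityˡ _))) (sum-cnt (λ _ → 1) e U W)
    ring : ∀ u w a b → u * (w * (a + b)) ≡ u * (w * a) + u * (w * b)
    ring = solve-∀
    go : ∀ u w a → u * (w * (𝟙 a * 1 + 𝟙 (not a) * 1)) ≡ u * w
    go u w true  = cong (u *_) (*-identityʳ w)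
    go u w false = cong (u *_) (*-identityʳ w)

-- The coloured partition

record Coloured (p ℓ h : ℕ) {n} (A : Fin n → Bool) (E : Fin n → Fin n → Bool) (t : ℕ) : Set where
  field
    part       : Fin n → Fin t
    equitable  : Equitable part
    colour     : Fin n → Fin n → Fin ℓ
    colour-sym : ∀ x y → colour x y ≡ colour y x
    Γ          : Fin t → Fin t → Bool
    Γ-sym      : ∀ i j → Γ i j ≡ Γ j i
    #Γ         : h * ∑[ i < t ] ∑[ j < t ] 𝟙 (Γ i j) ≤ 4 * (t * t)
    pure       : ∀ i j → Γ i j ≡ false → ∀ x y → part x ≡ i → part y ≡ i → A x ≡ A y
    good       : ∀ i j → i ≢ j → Γ i j ≡ false → Good p ℓ E colour part i j

module Construct (t₀ p ℓ h : ℕ) .{{p≢0 : NonZero p}} .{{ℓ≢0 : NonZero ℓ}} .{{h≢0 : NonZero h}} where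

  -- A single hue then fills at most `m/(8 p ℓ²)` of a pair of parts, negligible even against the
  -- `m/ℓ²` allowed on the sparse side.
  lam : ℕ
  lam = 16 * (p * (ℓ * ℓ))

  q : ℕ
  q = 8 * (lam * (ℓ * p))

  instance
    lam≢0 : NonZero lam
    lam≢0 = m*n≢0 16 (p * (ℓ * ℓ)) {{_}} {{m*n≢0 p (ℓ * ℓ) {{p≢0}} {{m*n≢0 ℓ ℓ}}}}

  open RegularityLemma (lam + lam) (q * q) h
  open Regularity (lam + lam) (q * q) h using (State)

  -- The bound `T` uses the number `2 lam` of functions and the bound `q²` on their squares, not the
  -- hues themselves, so `η` may depend on it. Parts have at least `n/(2T)` vertices, hence pairs of
  -- parts have area at least `n²/η`, as needed for `hue-spread`. The `suc` keeps `η` nonzero.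
  T η : ℕ
  T = suc (bound (fuel t₀) (t₁ t₀))
  η = 4 * (T * T)

  open Colouring lam η using (hueThreshold; hue; hue-spread)

  -- The terms serve, in this order, the regularity lemma, the spread of the hues, the bound
  -- `4 p ℓ ≤ |Vᵢ||Vⱼ|` that absorbs rounding, and nonempty parts.
  N : ℕ
  N = (2 * t₁ t₀ ⊔ threshold (fuel t₀) (t₁ t₀)) ⊔ (hueThreshold ⊔ (η * (4 * (p * ℓ)) ⊔ 2 * T))

  module _ {n} (N≤n : N ≤ n) (A : Fin n → Bool) (E : Fin n → Fin n → Bool)
           (E-sym : ∀ x y → E x y ≡ E y x) where
    private
      n≥reg : 2 * t₁ t₀ ⊔ threshold (fuel t₀) (t₁ t₀) ≤ n
      n≥reg = ≤-trans (m≤m⊔n _ (hueThreshold ⊔ (η * (4 * (p * ℓ)) ⊔ 2 * T))) N≤n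
      n≥rest : hueThreshold ⊔ (η * (4 * (p * ℓ)) ⊔ 2 * T) ≤ n
      n≥rest = ≤-trans (m≤n⊔m (2 * t₁ t₀ ⊔ threshold (fuel t₀) (t₁ t₀)) _) N≤n
      n≥hue : hueThreshold ≤ n
      n≥hue = ≤-trans (m≤m⊔n hueThreshold (η * (4 * (p * ℓ)) ⊔ 2 * T)) n≥rest
      n≥last : η * (4 * (p * ℓ)) ⊔ 2 * T ≤ n
      n≥last = ≤-trans (m≤n⊔m hueThreshold _) n≥rest
      n≥η : η * (4 * (p * ℓ)) ≤ n
      n≥η = ≤-trans (m≤m⊔n _ (2 * T)) n≥last
      n≥2T : 2 * T ≤ n
      n≥2T = ≤-trans (m≤n⊔m (η * (4 * (p * ℓ))) _) n≥last
      1≤n : 1 ≤ n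
      1≤n = ≤-trans (s≤s z≤n) n≥2T

      hueₙ : Fin n → Fin n → Fin lam
      hueₙ = hue n n≥hue

      open Pieces lam ℓ E hueₙ

      family : Fin (lam + lam) → Fin n → Fin n → Bool
      family r = [ piece true , piece false ]′ (splitAt lam r)

      F : Fin (lam + lam) → Fin n → Fin n → ℤ
      F r x y = + (q * 𝟙 (family r x y))

      F²≤ : ∀ r x y → F r x y *ᶻ F r x y ≤ᶻ + (q * q)
      F²≤ r x y = ℤₚ.≤-trans (ℤₚ.≤-reflexive (sym (ℤₚ.pos-* (q * 𝟙 (family r x y)) (q * 𝟙 (family r x y))))) (ℤ.+≤+ (*-mono-≤ q𝟙≤q q𝟙≤q))
        where
        q𝟙≤q : q * 𝟙 (family r x y) ≤ q
        q𝟙≤q = ≤-trans (*-monoʳ-≤ q (𝟙≤1 (family r x y))) (≤-reflexive (*-identityʳ q))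

    module WithState {t} (t≤T : t ≤ T) (S : State F A t) (reg : Regular F A F²≤ S) where
      open State S

      m : Fin t → Fin t → ℕ
      m i j = size part i * size part j

      2t≤n : 2 * t ≤ n
      2t≤n = ≤-trans (*-monoʳ-≤ 2 t≤T) n≥2T

      n²≤ηm : ∀ i j → n * n ≤ η * m i j
      n²≤ηm i j = ≤-trans (*-mono-≤ (le i) (le j)) (≤-reflexive (ring T (size part i) (size part j)))
        where
        le : ∀ i → n ≤ 2 * (T * size part i)
        le i = ≤-trans (size-lower₂ equitable 2t≤n i) (*-monoʳ-≤ 2 (*-monoˡ-≤ (size part i) t≤T))
        ring : ∀ T a b → 2 * (T * a) * (2 * (T * b)) ≡ 4 * (T * T) * (a * b)
        ring = solve-∀

      m≥4pℓ : ∀ i j → 4 * (p * ℓ) ≤ m i j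
      m≥4pℓ i j = *-cancelˡ-≤ η (≤-trans n≥η
        (≤-trans (ℕₚ.m≤m*n n n {{>-nonZero 1≤n}}) (n²≤ηm i j)))

      m≢0 : ∀ i j → NonZero (m i j)
      m≢0 i j = >-nonZero (≤-trans (>-nonZero⁻¹ (4 * (p * ℓ)) {{m*n≢0 4 (p * ℓ) {{_}} {{m*n≢0 p ℓ}}}}) (m≥4pℓ i j))

      mass : Bool → Fin t → Fin t → Fin lam → ℕ
      mass e i j α = cnt (cell part i) (cell part j) (piece e α)

      lam*mass≤ : ∀ e i j α → lam * mass e i j α ≤ 2 * m i j
      lam*mass≤ e i j α = *-cancelˡ-≤ η (begin
        η * (lam * mass e i j α)
          ≤⟨ *-monoʳ-≤ η (*-monoʳ-≤ lam (sum₂-mono (λ x y → *-monoʳ-≤ (𝟙 (cell part i x))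
               (*-monoʳ-≤ (𝟙 (cell part j y)) (drop (sel e (E x y)) (does (α ≟ hueₙ x y))))))) ⟩
        η * (lam * cnt (cell part i) (cell part j) (λ x y → does (α ≟ hueₙ x y)))
          ≤⟨ hue-spread n n≥hue α (cell part i) (cell part j) ⟩
        η * m i j + n * n
          ≤⟨ +-monoʳ-≤ (η * m i j) (n²≤ηm i j) ⟩
        η * m i j + η * m i j
          ≡⟨ ring η (m i j) ⟩
        η * (2 * m i j) ∎)
        where
        open ℕₚ.≤-Reasoning
        ring : ∀ e m → e * m + e * m ≡ e * (2 * m)
        ring = solve-∀
        drop : ∀ a b → 𝟙 (a ∧ b) ≤ 𝟙 b
        drop true  b = ℕₚ.≤-refl
        drop false b = z≤n

      μ : Fin t → Fin t → ℕ
      μ i j = 2 * m i j / lam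

      mass≤μ : ∀ e i j α → mass e i j α ≤ μ i j
      mass≤μ e i j α = ≤-trans (≤-reflexive (sym (DivMod.m*n/n≡m (mass e i j α) lam)))
        (DivMod./-monoˡ-≤ lam (≤-trans (≤-reflexive (*-comm (mass e i j α) lam)) (lam*mass≤ e i j α)))

      lamμ≤2m : ∀ i j → lam * μ i j ≤ 2 * m i j
      lamμ≤2m i j = ≤-trans (≤-reflexive (*-comm lam (μ i j))) (DivMod.m/n*n≤m (2 * m i j) lam)

      ∑mass : ∀ i j → sum (mass true i j) + sum (mass false i j) ≡ m i j
      ∑mass i j = ∑pieces (cell part i) (cell part j)

      grouping : ∀ i j → Grouping {ℓ} {lam} (μ i j) (m i j) {{m≢0 i j}} (mass true i j) (mass false i j)
      grouping i j = group (μ i j) (m i j) {{m≢0 i j}} (mass true i j) (mass false i j)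
        (mass≤μ true i j) (mass≤μ false i j) (∑mass i j)

      class : Bool → Fin t → Fin t → Fin lam → Fin ℓ
      class true  i j = proj₁ (grouping i j)
      class false i j = proj₁ (proj₂ (grouping i j))

      assigned : Fin t → Fin t → Fin n → Fin n → Fin ℓ
      assigned i j = assign (class true i j) (class false i j)

      choose : Bool → Bool → Fin t → Fin t → Fin n → Fin n → Fin ℓ
      choose true  _     i j x y = assigned i j x y
      -- Arguments are exchanged here because hues are not symmetric; this makes `colour` so.
      choose false true  i j x y = assigned j i y x
      -- Inside one part any colour will do; the first exists because `ℓ` is positive.
      choose false false i j x y = fromℕ< (>-nonZero⁻¹ ℓ)

      colourOf : Fin t → Fin t → Fin n → Fin n → Fin ℓ
      colourOf i j = choose (does (i Finₚ.<? j)) (does (j Finₚ.<? i)) i j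

      colour : Fin n → Fin n → Fin ℓ
      colour x y = colourOf (part x) (part y) x y

      colourOf-< : ∀ {i j} → i Fin.< j → ∀ x y → colourOf i j x y ≡ assigned i j x y
      colourOf-< {i} {j} i<j x y = cong (λ b → choose b (does (j Finₚ.<? i)) i j x y) (dec-true (i Finₚ.<? j) i<j)

      colourOf-> : ∀ {i j} → i Fin.< j → ∀ x y → colourOf j i y x ≡ assigned i j x y
      colourOf-> {i} {j} i<j x y = cong₂ (λ b c → choose b c j i y x)
        (dec-false (j Finₚ.<? i) (ℕₚ.<-asym i<j)) (dec-true (i Finₚ.<? j) i<j)

      colour-sym : ∀ x y → colour x y ≡ colour y x
      colour-sym x y = go (Finₚ.<-cmp (part x) (part y))
        where
        go : _ → colour x y ≡ colour y x
        go (tri< i<j _ _) = trans (colourOf-< i<j x y) (sym (colourOf-> i<j x y))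
        go (tri> _ _ j<i) = trans (colourOf-> j<i y x) (sym (colourOf-< j<i y x))
        go (tri≈ ¬< _ ¬>) = trans
          (cong₂ (λ b c → choose b c (part x) (part y) x y) (dec-false (part x Finₚ.<? part y) ¬<) (dec-false (part y Finₚ.<? part x) ¬>))
          (sym (cong₂ (λ b c → choose b c (part y) (part x) y x) (dec-false (part y Finₚ.<? part x) ¬>) (dec-false (part x Finₚ.<? part y) ¬<)))

      -- `Bad` concerns ordered pairs of parts, so both orders are excluded. Impure parts are
      -- excluded with all their pairs, which costs about as many pairs again.
      Γ : Fin t → Fin t → Bool
      Γ i j = (impure i ∨ impure j) ∨ (does (bad? i j) ∨ does (bad? j i))

      Γ-sym : ∀ i j → Γ i j ≡ Γ j i
      Γ-sym i j = cong₂ _∨_ (𝔹ₚ.∨-comm (impure i) (impure j)) (𝔹ₚ.∨-comm (does (bad? i j)) (does (bad? j i)))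

      #Γ : h * ∑[ i < t ] ∑[ j < t ] 𝟙 (Γ i j) ≤ 4 * (t * t)
      #Γ = begin
        h * ∑[ i < t ] ∑[ j < t ] 𝟙 (Γ i j)
          ≤⟨ *-monoʳ-≤ h (sum₂-mono (λ i j → ≤-trans (𝟙-∨ (impure i ∨ impure j) _)
               (+-mono-≤ (𝟙-∨ (impure i) (impure j)) (𝟙-∨ (does (bad? i j)) (does (bad? j i)))))) ⟩
        h * ∑[ i < t ] ∑[ j < t ] ((ι₁ i + ι₁ j) + (β i j + β j i))
          ≡⟨ cong (h *_) (trans (sum₂-distrib-+ (λ i j → ι₁ i + ι₁ j) (λ i j → β i j + β j i))
               (cong₂ _+_ (sum₂-distrib-+ (λ i j → ι₁ i) (λ i j → ι₁ j))
                 (trans (sum₂-distrib-+ β (λ i j → β j i)) (cong (λ s → #bad + s) (∑-comm {t} {t} (λ i j → β j i)))))) ⟩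
        h * ((∑[ i < t ] ∑[ j < t ] ι₁ i + ∑[ i < t ] ∑[ j < t ] ι₁ j) + (#bad + #bad))
          ≡⟨ cong (λ s → h * (s + (#bad + #bad))) (cong₂ _+_
               (trans (sum-cong-≗ {t} (λ i → sum-const t (ι₁ i))) (sym (*-distribˡ-sum t ι₁)))
               (sum-const t (sum ι₁))) ⟩
        h * ((t * sum ι₁ + t * sum ι₁) + (#bad + #bad))
          ≡⟨ ring h t (sum ι₁) #bad ⟩
        2 * (t * (h * sum ι₁)) + 2 * (h * #bad)
          ≤⟨ +-mono-≤ (*-monoʳ-≤ 2 (*-monoʳ-≤ t #impure)) (*-monoʳ-≤ 2 reg) ⟩
        2 * (t * t) + 2 * (t * t)
          ≡⟨ ring₂ (t * t) ⟩
        4 * (t * t) ∎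
        where
        open ℕₚ.≤-Reasoning
        ι₁ : Fin t → ℕ
        ι₁ i = 𝟙 (impure i)
        β : Fin t → Fin t → ℕ
        β i j = 𝟙 (does (bad? i j))
        ring : ∀ h t s b → h * ((t * s + t * s) + (b + b)) ≡ 2 * (t * (h * s)) + 2 * (h * b)
        ring = solve-∀
        ring₂ : ∀ s → 2 * s + 2 * s ≡ 4 * s
        ring₂ = solve-∀

      module _ (i j : Fin t) (i<j : i Fin.< j) (¬bad : ¬ Bad i j) where
        private
          c : Fin (lam + lam) → ℤ
          c r = g r i j
          index : Bool → Fin lam → Fin (lam + lam)
          index true  α = α ↑ˡ lam
          index false α = lam ↑ʳ α

          regularPiece : ∀ e α → ¬ Irregular part (λ x y → + (q * 𝟙 (piece e α x y))) (c (index e α)) i j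
          regularPiece true α = subst (λ φ → ¬ Irregular part (λ x y → + (q * 𝟙 (φ x y))) (c (α ↑ˡ lam)) i j)
            (cong [ piece true , piece false ]′ (Finₚ.splitAt-↑ˡ lam α lam)) (λ irr → ¬bad (α ↑ˡ lam , irr))
          regularPiece false α = subst (λ φ → ¬ Irregular part (λ x y → + (q * 𝟙 (φ x y))) (c (lam ↑ʳ α)) i j)
            (cong [ piece true , piece false ]′ (Finₚ.splitAt-↑ʳ lam lam α)) (λ irr → ¬bad (lam ↑ʳ α , irr))

          mᵢⱼ = m i j
          μᵢⱼ = μ i j
          instance
            mᵢⱼ≢0 : NonZero mᵢⱼ
            mᵢⱼ≢0 = m≢0 i j

          open Arithmetic p ℓ lam mᵢⱼ using (upper; lower; minor)
          open Slack p ℓ mᵢⱼ μᵢⱼ (m≥4pℓ i j) (lamμ≤2m i j)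

          L : Bool → Fin ℓ → ℕ
          L e = load (class e i j) (mass e i j)

          inColour : Bool → (U W : Fin n → Bool) → Fin ℓ → ℕ
          inColour e U W β = cnt U W (λ x y → sel e (E x y) ∧ does (colour x y ≟ β))

          pickClass : ∀ e → (if e then class true i j else class false i j) ≡ class e i j
          pickClass true  = refl
          pickClass false = refl

          inColour≡ : ∀ e {U W} → U ⊆ᴮ cell part i → W ⊆ᴮ cell part j → ∀ β →
            load (class e i j) (λ α → cnt U W (piece e α)) β ≡ inColour e U W β
          inColour≡ e {U} {W} U⊆ W⊆ β = trans
            (cong (λ f → load f (λ α → cnt U W (piece e α)) β) (sym (pickClass e)))
            (trans (load-piece (class true i j) (class false i j) e U W β)
              (cnt-cong U W (λ x y ux wy → cong (λ γ → sel e (E x y) ∧ does (γ ≟ β)) (sym (agrees x y ux wy)))))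
            where
            agrees : ∀ x y → U x ≡ true → W y ≡ true → colour x y ≡ assigned i j x y
            agrees x y ux wy = trans
              (cong₂ (λ a b → colourOf a b x y) (cell⇒≡ part i x (U⊆ x ux)) (cell⇒≡ part j y (W⊆ y wy)))
              (colourOf-< i<j x y)

          density : ∀ e {U W} → U ⊆ᴮ cell part i → W ⊆ᴮ cell part j → ∀ β →
            q * (mᵢⱼ * inColour e U W β) ≤ q * (L e β * (# U * # W)) + lam * (2 * (mᵢⱼ * mᵢⱼ)) ×
            q * (L e β * (# U * # W)) ≤ q * (mᵢⱼ * inColour e U W β) + lam * (2 * (mᵢⱼ * mᵢⱼ))
          density e {U} {W} U⊆ W⊆ β =
              subst (λ k → q * (mᵢⱼ * k) ≤ q * (L e β * (# U * # W)) + lam * (2 * (mᵢⱼ * mᵢⱼ))) (inColour≡ e U⊆ W⊆ β)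
                (load-density {lam} {ℓ} {q} {mᵢⱼ} {# U * # W} (class e i j) (λ α → cnt U W (piece e α)) (mass e i j)
                  (λ α → proj₁ (regular-density part q (piece e α) (c (index e α)) i j (regularPiece e α) U⊆ W⊆)) β)
            , subst (λ k → q * (L e β * (# U * # W)) ≤ q * (mᵢⱼ * k) + lam * (2 * (mᵢⱼ * mᵢⱼ))) (inColour≡ e U⊆ W⊆ β)
                (load-density′ {lam} {ℓ} {q} {mᵢⱼ} {# U * # W} (class e i j) (λ α → cnt U W (piece e α)) (mass e i j)
                  (λ α → proj₂ (regular-density part q (piece e α) (c (index e α)) i j (regularPiece e α) U⊆ W⊆)) β)

          loads : ∀ β → ℓ * (L true β + L false β) ≤ mᵢⱼ + (1 + 2 * (ℓ * μᵢⱼ)) ×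
            (ℓ * (ℓ * L true β) ≤ 2 * mᵢⱼ + (ℓ + ℓ * (ℓ * μᵢⱼ)) ⊎ ℓ * (ℓ * L false β) ≤ 2 * mᵢⱼ + (ℓ + ℓ * (ℓ * μᵢⱼ)))
          loads = proj₂ (proj₂ (grouping i j))

          loads-lower : ∀ β → mᵢⱼ ≤ ℓ * (L true β + L false β) + ℓ * (1 + 2 * (ℓ * μᵢⱼ))
          loads-lower = group-lower μᵢⱼ mᵢⱼ (mass true i j) (mass false i j) (∑mass i j) (grouping i j)

        -- Uniformity adds up the pieces of the colour on both sides of `E`; sparsity looks only at
        -- the side on which the grouping has left a small load.
        good-< : Good p ℓ E colour part i j
        good-< β = uniform , Sum.map (sparse true) (sparse false) (proj₂ (loads β))
          where
          uniform : Uniform p ℓ E colour part i j β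
          uniform {U} {W} U⊆ W⊆ =
              upper {M} {L true β + L false β} {B} {1 + 2 * (ℓ * μᵢⱼ)} up (proj₁ (loads β)) slack (*-mono-≤ (#-mono U⊆) (#-mono W⊆))
            , lower {M} {L true β + L false β} {B} {1 + 2 * (ℓ * μᵢⱼ)} lo (loads-lower β) slack (*-mono-≤ (#-mono U⊆) (#-mono W⊆))
            where
            B = # U * # W
            M = cnt U W (λ x y → does (colour x y ≟ β))
            e = lam * (2 * (mᵢⱼ * mᵢⱼ))
            M≡ : inColour true U W β + inColour false U W β ≡ M
            M≡ = cnt-split U W (λ x y → does (colour x y ≟ β))
            ring₁ : ∀ q m a b → q * (m * (a + b)) ≡ q * (m * a) + q * (m * b)
            ring₁ = solve-∀
            ring₂ : ∀ q s s′ b → q * ((s + s′) * b) ≡ q * (s * b) + q * (s′ * b)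
            ring₂ = solve-∀
            ring₃ : ∀ a b e → (a + e) + (b + e) ≡ (a + b) + (e + e)
            ring₃ = solve-∀
            qM : q * (mᵢⱼ * M) ≡ q * (mᵢⱼ * inColour true U W β) + q * (mᵢⱼ * inColour false U W β)
            qM = trans (cong (λ k → q * (mᵢⱼ * k)) (sym M≡)) (ring₁ q mᵢⱼ (inColour true U W β) (inColour false U W β))
            qS : q * ((L true β + L false β) * B) ≡ q * (L true β * B) + q * (L false β * B)
            qS = ring₂ q (L true β) (L false β) B
            up : q * (mᵢⱼ * M) ≤ q * ((L true β + L false β) * B) + (e + e)
            up = ≤-trans (≤-reflexive qM)
              (≤-trans (+-mono-≤ (proj₁ (density true U⊆ W⊆ β)) (proj₁ (density false U⊆ W⊆ β)))
                (≤-reflexive (trans (ring₃ (q * (L true β * B)) (q * (L false β * B)) e) (cong (_+ (e + e)) (sym qS)))))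
            lo : q * ((L true β + L false β) * B) ≤ q * (mᵢⱼ * M) + (e + e)
            lo = ≤-trans (≤-reflexive qS)
              (≤-trans (+-mono-≤ (proj₂ (density true U⊆ W⊆ β)) (proj₂ (density false U⊆ W⊆ β)))
                (≤-reflexive (trans (ring₃ (q * (mᵢⱼ * inColour true U W β)) (q * (mᵢⱼ * inColour false U W β)) e)
                  (cong (_+ (e + e)) (sym qM)))))
          sparse : ∀ e → ℓ * (ℓ * L e β) ≤ 2 * mᵢⱼ + (ℓ + ℓ * (ℓ * μᵢⱼ)) → Sparse p ℓ E colour part e i j β
          sparse e le {U} {W} U⊆ W⊆ = minor {inColour e U W β} {L e β} {# U * # W}
            (proj₁ (density e U⊆ W⊆ β)) (≤-trans le slack′)

      coloured : Coloured p ℓ h A E t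
      coloured = record
        { part = part ; equitable = equitable ; colour = colour ; colour-sym = colour-sym
        ; Γ = Γ ; Γ-sym = Γ-sym ; #Γ = #Γ
        ; pure = λ i j e → pure i (𝔹ₚ.∨-conicalˡ (impure i) (impure j) (𝔹ₚ.∨-conicalˡ (impure i ∨ impure j) _ e))
        ; good = good }
        where
        notBad : ∀ i j → Γ i j ≡ false → ¬ Bad i j × ¬ Bad j i
        notBad i j e = does⇒¬ (bad? i j) (𝔹ₚ.∨-conicalˡ _ _ e′) , does⇒¬ (bad? j i) (𝔹ₚ.∨-conicalʳ (does (bad? i j)) _ e′)
          where
          e′ : does (bad? i j) ∨ does (bad? j i) ≡ false
          e′ = 𝔹ₚ.∨-conicalʳ (impure i ∨ impure j) _ e
        good : ∀ i j → i ≢ j → Γ i j ≡ false → Good p ℓ E colour part i j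
        good i j i≢j e = go (Finₚ.<-cmp i j)
          where
          go : _ → Good p ℓ E colour part i j
          go (tri< i<j _ _) = good-< i j i<j (proj₁ (notBad i j e))
          go (tri≈ _ i≡j _) = contradiction i≡j i≢j
          go (tri> _ _ j<i) = good-sym p ℓ E colour part E-sym colour-sym j i (good-< j i j<i (proj₂ (notBad i j e)))

    colouredPartition : ∃[ t ] (t₀ ≤ t × t ≤ T × 2 * t ≤ n) × Coloured p ℓ h A E t
    colouredPartition =
      let t , (lo , hi) , S , reg = regularity t₀ F A F²≤ n≥reg
          t≤T = ≤-trans hi (ℕₚ.n≤1+n _)
      in t , (lo , t≤T , WithState.2t≤n t≤T S reg) , WithState.coloured t≤T S reg

-- Triangles

module Triangles (p ℓ : ℕ) .{{_ : NonZero p}} (ℓ³≤p : ℓ * ℓ * ℓ ≤ p) .{{_ : NonZero ℓ}}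
    (E : Fin n → Fin n → Bool) (colour : Fin n → Fin n → Fin ℓ) (part : Fin n → Fin t) where

  nbr : Fin t → Fin ℓ → Fin n → Fin n → Bool
  nbr i α x y = cell part i y ∧ does (colour x y ≟ α)

  nbr⊆ : ∀ i α x → nbr i α x ⊆ᴮ cell part i
  nbr⊆ i α x y e = go (cell part i y) e
    where
    go : ∀ a {b} → a ∧ b ≡ true → a ≡ true
    go true _ = refl

  module _ (e : Bool) (i j k : Fin t) (α β γ : Fin ℓ) where

    inE : Fin n → Fin n → Bool
    inE y z = sel e (E y z) ∧ does (colour y z ≟ γ)

    tri : ℕ
    tri = ∑[ x < n ] (𝟙 (cell part i x) * cnt (nbr j α x) (nbr k β x) inE)

    cherries : ℕ
    cherries = ∑[ x < n ] (𝟙 (cell part i x) * (# (nbr j α x) * # (nbr k β x)))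

    private
      sᵢ = size part i
      sⱼ = size part j
      sₖ = size part k
      v = sᵢ * (sⱼ * sₖ)
      back : Fin n → Fin n → Bool
      back z x = cell part i x ∧ does (colour x z ≟ β)
      back⊆ : ∀ z → back z ⊆ᴮ cell part i
      back⊆ z x e′ = go (cell part i x) e′
        where
        go : ∀ a {b} → a ∧ b ≡ true → a ≡ true
        go true _ = refl
      open ℕₚ.≤-Reasoning

    -- Summing over the centre `x` would need a bound for each product of degrees. With `z` fixed
    -- first, the centres form a subset of part `i`, to which uniformity of colour `α` applies
    -- directly.
    cherries-by-z : cherries ≡
      ∑[ z < n ] (𝟙 (cell part k z) * cnt (back z) (cell part j) (λ x y → does (colour x y ≟ α)))
    cherries-by-z = begin-equality
      ∑[ x < n ] (I x * (# (nbr j α x) * # (nbr k β x)))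
        ≡⟨ sum-cong-≗ {n} (λ x → cong (I x *_) (trans (*-distribˡ-sum (# (nbr j α x)) (λ z → 𝟙 (nbr k β x z)))
             (sum-cong-≗ {n} (λ z → *-distribʳ-sum (𝟙 (nbr k β x z)) (λ y → 𝟙 (nbr j α x y)))))) ⟩
      ∑[ x < n ] (I x * ∑[ z < n ] ∑[ y < n ] (𝟙 (nbr j α x y) * 𝟙 (nbr k β x z)))
        ≡⟨ sum-cong-≗ {n} (λ x → trans (*-distribˡ-sum (I x) (λ z → ∑[ y < n ] (𝟙 (nbr j α x y) * 𝟙 (nbr k β x z))))
             (sum-cong-≗ {n} (λ z → *-distribˡ-sum (I x) (λ y → 𝟙 (nbr j α x y) * 𝟙 (nbr k β x z))))) ⟩
      ∑[ x < n ] ∑[ z < n ] ∑[ y < n ] (I x * (𝟙 (nbr j α x y) * 𝟙 (nbr k β x z)))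
        ≡⟨ ∑-comm {n} {n} (λ x z → ∑[ y < n ] (I x * (𝟙 (nbr j α x y) * 𝟙 (nbr k β x z)))) ⟩
      ∑[ z < n ] ∑[ x < n ] ∑[ y < n ] (I x * (𝟙 (nbr j α x y) * 𝟙 (nbr k β x z)))
        ≡⟨ sum-cong-≗ {n} (λ z → sum₂-cong (λ x y → pointwise x y z)) ⟩
      ∑[ z < n ] ∑[ x < n ] ∑[ y < n ] (𝟙 (cell part k z) * (𝟙 (back z x) * (𝟙 (cell part j y) * 𝟙 (does (colour x y ≟ α)))))
        ≡⟨ sum-cong-≗ {n} (λ z → sym (trans (*-distribˡ-sum (𝟙 (cell part k z)) (λ x → ∑[ y < n ] (𝟙 (back z x) * (𝟙 (cell part j y) * 𝟙 (does (colour x y ≟ α))))))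
             (sum-cong-≗ {n} (λ x → *-distribˡ-sum (𝟙 (cell part k z)) (λ y → 𝟙 (back z x) * (𝟙 (cell part j y) * 𝟙 (does (colour x y ≟ α)))))))) ⟩
      ∑[ z < n ] (𝟙 (cell part k z) * cnt (back z) (cell part j) (λ x y → does (colour x y ≟ α))) ∎
      where
      I : Fin n → ℕ
      I x = 𝟙 (cell part i x)
      ring : ∀ i j a k b → i * (j * a * (k * b)) ≡ k * (i * b * (j * a))
      ring = solve-∀
      pointwise : ∀ x y z → I x * (𝟙 (nbr j α x y) * 𝟙 (nbr k β x z)) ≡
        𝟙 (cell part k z) * (𝟙 (back z x) * (𝟙 (cell part j y) * 𝟙 (does (colour x y ≟ α))))
      pointwise x y z = trans
        (cong₂ (λ s t → I x * (s * t)) (𝟙-∧ (cell part j y) (does (colour x y ≟ α))) (𝟙-∧ (cell part k z) (does (colour x z ≟ β))))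
        (trans (ring (I x) (𝟙 (cell part j y)) (𝟙 (does (colour x y ≟ α))) (𝟙 (cell part k z)) (𝟙 (does (colour x z ≟ β))))
          (cong (λ s → 𝟙 (cell part k z) * (s * (𝟙 (cell part j y) * 𝟙 (does (colour x y ≟ α))))) (sym (𝟙-∧ (cell part i x) (does (colour x z ≟ β))))))

    ∑back : ∑[ z < n ] (𝟙 (cell part k z) * # (back z)) ≡
      cnt (cell part i) (cell part k) (λ x z → does (colour x z ≟ β))
    ∑back = trans (sum-cong-≗ {n} (λ z → *-distribˡ-sum (𝟙 (cell part k z)) (λ x → 𝟙 (back z x))))
      (trans (∑-comm {n} {n} (λ z x → 𝟙 (cell part k z) * 𝟙 (back z x)))
        (sum₂-cong (λ x z → trans (cong (𝟙 (cell part k z) *_) (𝟙-∧ (cell part i x) (does (colour x z ≟ β))))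
          (ring (𝟙 (cell part k z)) (𝟙 (cell part i x)) (𝟙 (does (colour x z ≟ β)))))))
      where
      ring : ∀ k i b → k * (i * b) ≡ i * (k * b)
      ring = solve-∀

    ℓ≤p : ℓ ≤ p
    ℓ≤p = ≤-trans (≤-trans (m≤n*m ℓ (ℓ * ℓ) {{m*n≢0 ℓ ℓ}}) (≤-reflexive refl)) ℓ³≤p

    -- Uniformity of `α` gives one factor `1/ℓ` for each `z`, and that of `β` the other after
    -- summation over `z`. The main term is `v/ℓ²`; each of the two errors costs at most as much
    -- because `ℓ² ≤ p` follows from `ℓ³ ≤ p`.
    cherries≤ : Uniform p ℓ E colour part i j α → Uniform p ℓ E colour part i k β →
      ℓ * ℓ * cherries ≤ 3 * v
    cherries≤ uα uβ = *-cancelˡ-≤ p (begin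
      p * (ℓ * ℓ * cherries)
        ≡⟨ ring₁ p ℓ cherries ⟩
      ℓ * (p * ℓ * cherries)
        ≤⟨ *-monoʳ-≤ ℓ first ⟩
      ℓ * (p * sⱼ * M + v)
        ≡⟨ ring₂ ℓ p sⱼ M v ⟩
      sⱼ * (p * (ℓ * M)) + ℓ * v
        ≤⟨ +-mono-≤ (*-monoʳ-≤ sⱼ (proj₁ (uβ {cell part i} {cell part k} (λ _ e → e) (λ _ e → e)))) (*-monoˡ-≤ v ℓ≤p) ⟩
      sⱼ * (p * (sᵢ * sₖ) + sᵢ * sₖ) + p * v
        ≡⟨ ring₃ sᵢ sⱼ sₖ p ⟩
      2 * p * v + v
        ≤⟨ +-monoʳ-≤ (2 * p * v) (m≤n*m v p) ⟩
      2 * p * v + p * v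
        ≡⟨ ring₄ p v ⟩
      p * (3 * v) ∎)
      where
      M = cnt (cell part i) (cell part k) (λ x z → does (colour x z ≟ β))
      Φ : Fin n → ℕ
      Φ z = cnt (back z) (cell part j) (λ x y → does (colour x y ≟ α))
      K : Fin n → ℕ
      K z = 𝟙 (cell part k z)
      ring₁ : ∀ p l c → p * (l * l * c) ≡ l * (p * l * c)
      ring₁ = solve-∀
      ring₂ : ∀ l p s M v → l * (p * s * M + v) ≡ s * (p * (l * M)) + l * v
      ring₂ = solve-∀
      ring₃ : ∀ a b c p → b * (p * (a * c) + a * c) + p * (a * (b * c)) ≡ 2 * p * (a * (b * c)) + a * (b * c)
      ring₃ = solve-∀
      ring₄ : ∀ p v → 2 * p * v + p * v ≡ p * (3 * v)
      ring₄ = solve-∀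
      ring₅ : ∀ p l k c → p * l * (k * c) ≡ k * (p * (l * c))
      ring₅ = solve-∀
      ring₆ : ∀ k p b s w → k * (p * (b * s) + w) ≡ p * s * (k * b) + k * w
      ring₆ = solve-∀
      ring₇ : ∀ a b c → c * (a * b) ≡ a * (b * c)
      ring₇ = solve-∀
      first : p * ℓ * cherries ≤ p * sⱼ * M + v
      first = begin
        p * ℓ * cherries
          ≡⟨ trans (cong (p * ℓ *_) cherries-by-z) (*-distribˡ-sum (p * ℓ) (λ z → K z * Φ z)) ⟩
        ∑[ z < n ] (p * ℓ * (K z * Φ z))
          ≤⟨ sum-mono {n} (λ z → ≤-trans (≤-reflexive (ring₅ p ℓ (K z) (Φ z)))
               (≤-trans (*-monoʳ-≤ (K z) (proj₁ (uα {back z} {cell part j} (back⊆ z) (λ _ e → e))))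
                 (≤-reflexive (ring₆ (K z) p (# (back z)) sⱼ (sᵢ * sⱼ))))) ⟩
        ∑[ z < n ] (p * sⱼ * (K z * # (back z)) + K z * (sᵢ * sⱼ))
          ≡⟨ trans (∑-distrib-+ {n} (λ z → p * sⱼ * (K z * # (back z))) _) (cong₂ _+_
               (trans (sym (*-distribˡ-sum (p * sⱼ) (λ z → K z * # (back z)))) (cong (p * sⱼ *_) ∑back))
               (trans (sym (*-distribʳ-sum (sᵢ * sⱼ) K)) (ring₇ sᵢ sⱼ sₖ))) ⟩
        p * sⱼ * M + v ∎

    -- Sparsity between the two neighbourhoods of each `x` gives `3/ℓ²` times the cherries, hence
    -- `9v/ℓ⁴`, plus errors of total `v/(4 p ℓ) ≤ v/(4 ℓ⁴)`. Together this is `37v/(4 ℓ⁴)`.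
    tri≤ : Uniform p ℓ E colour part i j α → Uniform p ℓ E colour part i k β →
      Sparse p ℓ E colour part e j k γ → 4 * (ℓ * ℓ * (ℓ * ℓ)) * tri ≤ 37 * v
    tri≤ uα uβ sp = *-cancelˡ-≤ p (begin
      p * (4 * (ℓ * ℓ * (ℓ * ℓ)) * tri)
        ≡⟨ ring₁ p ℓ tri ⟩
      ℓ * ℓ * (4 * (p * (ℓ * ℓ)) * tri)
        ≤⟨ *-monoʳ-≤ (ℓ * ℓ) first ⟩
      ℓ * ℓ * (12 * p * cherries + ℓ * v)
        ≡⟨ ring₂ ℓ p cherries v ⟩
      12 * p * (ℓ * ℓ * cherries) + ℓ * ℓ * ℓ * v
        ≤⟨ +-mono-≤ (*-monoʳ-≤ (12 * p) (cherries≤ uα uβ)) (*-monoˡ-≤ v ℓ³≤p) ⟩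
      12 * p * (3 * v) + p * v
        ≡⟨ ring₃ p v ⟩
      p * (37 * v) ∎)
      where
      I : Fin n → ℕ
      I x = 𝟙 (cell part i x)
      T : Fin n → ℕ
      T x = cnt (nbr j α x) (nbr k β x) inE
      B : Fin n → ℕ
      B x = # (nbr j α x) * # (nbr k β x)
      ring₁ : ∀ p l t → p * (4 * (l * l * (l * l)) * t) ≡ l * l * (4 * (p * (l * l)) * t)
      ring₁ = solve-∀
      ring₂ : ∀ l p c v → l * l * (12 * p * c + l * v) ≡ 12 * p * (l * l * c) + l * l * l * v
      ring₂ = solve-∀
      ring₃ : ∀ p v → 12 * p * (3 * v) + p * v ≡ p * (37 * v)
      ring₃ = solve-∀
      ring₄ : ∀ q i t → q * (i * t) ≡ i * (q * t)
      ring₄ = solve-∀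
      ring₅ : ∀ i p b l w → i * (12 * (p * b) + l * w) ≡ 12 * p * (i * b) + i * (l * w)
      ring₅ = solve-∀
      ring₆ : ∀ a l w → a * (l * w) ≡ l * (a * w)
      ring₆ = solve-∀
      first : 4 * (p * (ℓ * ℓ)) * tri ≤ 12 * p * cherries + ℓ * v
      first = begin
        4 * (p * (ℓ * ℓ)) * tri
          ≡⟨ *-distribˡ-sum (4 * (p * (ℓ * ℓ))) (λ x → I x * T x) ⟩
        ∑[ x < n ] (4 * (p * (ℓ * ℓ)) * (I x * T x))
          ≤⟨ sum-mono {n} (λ x → ≤-trans (≤-reflexive (ring₄ (4 * (p * (ℓ * ℓ))) (I x) (T x)))
               (≤-trans (*-monoʳ-≤ (I x) (sp {nbr j α x} {nbr k β x} (nbr⊆ j α x) (nbr⊆ k β x)))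
                 (≤-reflexive (ring₅ (I x) p (B x) ℓ (sⱼ * sₖ))))) ⟩
        ∑[ x < n ] (12 * p * (I x * B x) + I x * (ℓ * (sⱼ * sₖ)))
          ≡⟨ trans (∑-distrib-+ {n} (λ x → 12 * p * (I x * B x)) _) (cong₂ _+_
               (sym (*-distribˡ-sum (12 * p) (λ x → I x * B x)))
               (trans (sym (*-distribʳ-sum (ℓ * (sⱼ * sₖ)) I)) (ring₆ sᵢ ℓ (sⱼ * sₖ)))) ⟩
        12 * p * cherries + ℓ * v ∎

  module _ (e : Bool) (i j k : Fin t) (α β γ : Fin ℓ) where

    ordered : Fin n → Fin n → Fin n → ℕ
    ordered x y z = 𝟙 (cell part i x ∧ cell part j y ∧ cell part k z ∧
      does (colour x y ≟ α) ∧ does (colour x z ≟ β) ∧ sel e (E y z) ∧ does (colour y z ≟ γ))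

    ∑ordered : ∑[ x < n ] ∑[ y < n ] ∑[ z < n ] ordered x y z ≡ tri e i j k α β γ
    ∑ordered = sum-cong-≗ {n} (λ x → trans (sum₂-cong (λ y z → pointwise x y z))
      (sym (trans (*-distribˡ-sum (𝟙 (cell part i x)) (λ y → ∑[ z < n ] κ x y z))
        (sum-cong-≗ {n} (λ y → *-distribˡ-sum (𝟙 (cell part i x)) (κ x y))))))
      where
      κ : Fin n → Fin n → Fin n → ℕ
      κ x y z = 𝟙 (nbr j α x y) * (𝟙 (nbr k β x z) * 𝟙 (inE e i j k α β γ y z))
      go : ∀ a b c d f g → 𝟙 (a ∧ b ∧ c ∧ d ∧ f ∧ g) ≡ 𝟙 a * (𝟙 (b ∧ d) * (𝟙 (c ∧ f) * 𝟙 g))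
      go false b     c     d     f     g = refl
      go true  false c     d     f     g = refl
      go true  true  false false f     g = refl
      go true  true  false true  f     g = refl
      go true  true  true  false f     g = refl
      go true  true  true  true  false g = refl
      go true  true  true  true  true  g = ring (𝟙 g)
        where
        ring : ∀ g → g ≡ 1 * (1 * (1 * g))
        ring = solve-∀
      pointwise : ∀ x y z → ordered x y z ≡ 𝟙 (cell part i x) * κ x y z
      pointwise x y z = go (cell part i x) (cell part j y) (cell part k z)
        (does (colour x y ≟ α)) (does (colour x z ≟ β)) (sel e (E y z) ∧ does (colour y z ≟ γ))

-- Rational estimates

toℚᵘ-↑ : ∀ k → toℚᵘ (↑ k) ℚᵘ.≃ mkℚᵘ (+ k) 0
toℚᵘ-↑ k = ℚₚ.toℚᵘ-fromℚᵘ (mkℚᵘ (+ k) 0)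

↑-* : ∀ a b → ↑ (a ℕ.* b) ≡ ↑ a ℚ.* ↑ b
↑-* a b = ℚₚ.toℚᵘ-injective (begin
  toℚᵘ (↑ (a ℕ.* b))                  ≈⟨ toℚᵘ-↑ (a ℕ.* b) ⟩
  mkℚᵘ (+ (a ℕ.* b)) 0                ≈⟨ *≡* (cong (ℤ._* + 1) (ℤₚ.pos-* a b)) ⟩
  mkℚᵘ (+ a) 0 ℚᵘ.* mkℚᵘ (+ b) 0      ≈⟨ ℚᵘₚ.*-cong (toℚᵘ-↑ a) (toℚᵘ-↑ b) ⟨
  toℚᵘ (↑ a) ℚᵘ.* toℚᵘ (↑ b)          ≈⟨ ℚₚ.toℚᵘ-homo-* (↑ a) (↑ b) ⟨
  toℚᵘ (↑ a ℚ.* ↑ b)                    ∎)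
  where open ℚᵘₚ.≃-Reasoning

↑-+ : ∀ a b → ↑ (a ℕ.+ b) ≡ ↑ a ℚ.+ ↑ b
↑-+ a b = ℚₚ.toℚᵘ-injective (begin
  toℚᵘ (↑ (a ℕ.+ b))                  ≈⟨ toℚᵘ-↑ (a ℕ.+ b) ⟩
  mkℚᵘ (+ (a ℕ.+ b)) 0                ≈⟨ *≡* (cong (ℤ._* + 1) (sym (cong₂ ℤ._+_ (ℤₚ.*-identityʳ (+ a)) (ℤₚ.*-identityʳ (+ b))))) ⟩
  mkℚᵘ (+ a) 0 ℚᵘ.+ mkℚᵘ (+ b) 0      ≈⟨ ℚᵘₚ.+-cong (toℚᵘ-↑ a) (toℚᵘ-↑ b) ⟨
  toℚᵘ (↑ a) ℚᵘ.+ toℚᵘ (↑ b)          ≈⟨ ℚₚ.toℚᵘ-homo-+ (↑ a) (↑ b) ⟨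
  toℚᵘ (↑ a ℚ.+ ↑ b)                    ∎)
  where open ℚᵘₚ.≃-Reasoning

↑-mono : ∀ {a b} → a ℕ.≤ b → ↑ a ℚ.≤ ↑ b
↑-mono {a} {b} a≤b = ℚₚ.toℚᵘ-cancel-≤ (begin
  toℚᵘ (↑ a)      ≃⟨ toℚᵘ-↑ a ⟩
  mkℚᵘ (+ a) 0    ≤⟨ ℚᵘ.*≤* (ℤₚ.*-monoʳ-≤-nonNeg (+ 1) (ℤ.+≤+ a≤b)) ⟩
  mkℚᵘ (+ b) 0    ≃⟨ ℚᵘₚ.≃-sym (toℚᵘ-↑ b) ⟩
  toℚᵘ (↑ b)      ∎)
  where open ℚᵘₚ.≤-Reasoning

↑-nonNeg : ∀ k → NonNegative (↑ k)
↑-nonNeg k = nonNegative (↑-mono {0} {k} ℕ.z≤n)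

↑-pos : ∀ k .{{_ : NonZero k}} → Positive (↑ k)
↑-pos (suc k) = positive (ℚₚ.<-≤-trans (ℚₚ.positive⁻¹ (↑ 1)) (↑-mono {1} {suc k} (ℕ.s≤s ℕ.z≤n)))

ratio-* : ∀ e m .{{_ : NonZero m}} → ↑ e ≡ (+ e ℚ./ m) ℚ.* ↑ m
ratio-* e (suc m) = ℚₚ.toℚᵘ-injective (begin
  toℚᵘ (↑ e)                              ≈⟨ toℚᵘ-↑ e ⟩
  mkℚᵘ (+ e) 0                            ≈⟨ *≡* (trans (cong (λ s → + e ℤ.* + s) (*-identityʳ (suc m))) (sym (ℤₚ.*-identityʳ (+ e ℤ.* + suc m)))) ⟩
  mkℚᵘ (+ e) m ℚᵘ.* mkℚᵘ (+ suc m) 0      ≈⟨ ℚᵘₚ.*-cong (ℚₚ.toℚᵘ-fromℚᵘ (mkℚᵘ (+ e) m)) (toℚᵘ-↑ (suc m)) ⟨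
  toℚᵘ (+ e ℚ./ suc m) ℚᵘ.* toℚᵘ (↑ (suc m)) ≈⟨ ℚₚ.toℚᵘ-homo-* (+ e ℚ./ suc m) (↑ (suc m)) ⟨
  toℚᵘ ((+ e ℚ./ suc m) ℚ.* ↑ (suc m))        ∎)
  where open ℚᵘₚ.≃-Reasoning

1≰0 : ¬ ↑ 1 ℚ.≤ 0ℚ
1≰0 le = ℚₚ.<-irrefl refl (ℚₚ.<-≤-trans (ℚₚ.positive⁻¹ (↑ 1)) le)

archimedean : ∀ ε → 0ℚ ℚ.< ε → ∃[ k ] ↑ 1 ℚ.≤ ε ℚ.* ↑ (suc k)
-- The denominator of `ε` will do: `ε` times it is the positive numerator.
archimedean ε@(mkℚ +[1+ n ] d c) _ = d ,
  subst (↑ 1 ℚ.≤_) (trans (ratio-* (suc n) (suc d)) (cong (ℚ._* ↑ (suc d)) (ℚₚ.↥p/↧p≡p ε)))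
    (↑-mono {1} {suc n} (ℕ.s≤s ℕ.z≤n))
archimedean (mkℚ (+ 0)    d c) 0<ε with positive 0<ε
... | ()
archimedean (mkℚ -[1+ n ] d c) 0<ε with positive 0<ε
... | ()

abs≤ : ∀ {x y} → x ℚ.≤ y → ℚ.- x ℚ.≤ y → ℚ.∣ x ∣ ℚ.≤ y
abs≤ {x} {y} x≤y -x≤y with ℚₚ.∣p∣≡p∨∣p∣≡-p x
... | inj₁ e = subst (ℚ._≤ y) (sym e) x≤y
... | inj₂ e = subst (ℚ._≤ y) (sym e) -x≤y

-- Here and below `k` stands for an upper bound of `1/ε`, so that estimates can be carried out in
-- `ℕ`. The hypothesis also forces `ε` to be nonnegative.
scale≤ : ∀ {ε k x y} → ↑ 1 ℚ.≤ ε ℚ.* ↑ k → k ℕ.* x ℕ.≤ y → ↑ x ℚ.≤ ε ℚ.* ↑ y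
scale≤ {ε} {k} {x} {y} 1≤εk kx≤y = begin
  ↑ x                   ≡⟨ ℚₚ.*-identityˡ (↑ x) ⟨
  ↑ 1 ℚ.* ↑ x             ≤⟨ ℚₚ.*-monoʳ-≤-nonNeg (↑ x) {{↑-nonNeg x}} 1≤εk ⟩
  ε ℚ.* ↑ k ℚ.* ↑ x         ≡⟨ trans (ℚₚ.*-assoc ε (↑ k) (↑ x)) (cong (ε ℚ.*_) (sym (↑-* k x))) ⟩
  ε ℚ.* ↑ (k ℕ.* x)       ≤⟨ ε-mono ⟩
  ε ℚ.* ↑ y               ∎
  where
  open ℚₚ.≤-Reasoning
  ε≥0 : 0ℚ ℚ.≤ ε
  ε≥0 with ℚₚ.≤-total 0ℚ ε
  ... | inj₁ 0≤ε = 0≤ε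
  ... | inj₂ ε≤0 = contradiction
        (ℚₚ.≤-trans 1≤εk (ℚₚ.≤-trans (ℚₚ.*-monoʳ-≤-nonNeg (↑ k) {{↑-nonNeg k}} ε≤0) (ℚₚ.≤-reflexive (ℚₚ.*-zeroˡ (↑ k)))))
        1≰0
  ε-mono : ε ℚ.* ↑ (k ℕ.* x) ℚ.≤ ε ℚ.* ↑ y
  ε-mono = ℚₚ.*-monoˡ-≤-nonNeg ε {{nonNegative ε≥0}} (↑-mono kx≤y)

-- |a - (F/K) b| ≤ ε C, with the denominators cleared.
bridge : ∀ {ε d k K F a b C} .{{_ : NonZero K}} → ↑ 1 ℚ.≤ ε ℚ.* ↑ k → ↑ F ≡ d ℚ.* ↑ K →
  k ℕ.* (K ℕ.* a) ℕ.≤ k ℕ.* (F ℕ.* b) ℕ.+ K ℕ.* C →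
  k ℕ.* (F ℕ.* b) ℕ.≤ k ℕ.* (K ℕ.* a) ℕ.+ K ℕ.* C →
  ℚ.∣ ↑ a ℚ.- d ℚ.* ↑ b ∣ ℚ.≤ ε ℚ.* ↑ C
bridge {ε} {d} {zero} {K} {F} {a} {b} {C} 1≤εk F≡dK _ _ = contradiction
  (ℚₚ.≤-trans 1≤εk (ℚₚ.≤-reflexive (ℚₚ.*-zeroʳ ε))) 1≰0
bridge {ε} {d} {k@(suc _)} {K} {F} {a} {b} {C} 1≤εk F≡dK le₁ le₂ = abs≤ (one (↑ a ℚ.- d ℚ.* ↑ b) eq₁ le₁)
  (one (ℚ.- (↑ a ℚ.- d ℚ.* ↑ b)) eq₂ le₂)
  where
  open ℚₚ.≤-Reasoning
  open +-*-Solver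
  cast : ∀ x y z → ↑ (x ℕ.* (y ℕ.* z)) ≡ ↑ x ℚ.* (↑ y ℚ.* ↑ z)
  cast x y z = trans (↑-* x (y ℕ.* z)) (cong (↑ x ℚ.*_) (↑-* y z))
  castF : ↑ (k ℕ.* (F ℕ.* b)) ≡ ↑ k ℚ.* (d ℚ.* ↑ K ℚ.* ↑ b)
  castF = trans (cast k F b) (cong (λ f → ↑ k ℚ.* (f ℚ.* ↑ b)) F≡dK)
  eq₁ : ↑ (k ℕ.* (K ℕ.* a)) ≡ ↑ k ℚ.* ↑ K ℚ.* (↑ a ℚ.- d ℚ.* ↑ b) ℚ.+ ↑ (k ℕ.* (F ℕ.* b))
  eq₁ = trans (cast k K a) (trans
    (solve 5 (λ k K a d b → k :* (K :* a) := k :* K :* (a :- d :* b) :+ k :* (d :* K :* b)) refl (↑ k) (↑ K) (↑ a) d (↑ b))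
    (cong (λ s → ↑ k ℚ.* ↑ K ℚ.* (↑ a ℚ.- d ℚ.* ↑ b) ℚ.+ s) (sym castF)))
  eq₂ : ↑ (k ℕ.* (F ℕ.* b)) ≡ ↑ k ℚ.* ↑ K ℚ.* (ℚ.- (↑ a ℚ.- d ℚ.* ↑ b)) ℚ.+ ↑ (k ℕ.* (K ℕ.* a))
  eq₂ = trans castF (trans
    (solve 5 (λ k K a d b → k :* (d :* K :* b) := k :* K :* (:- (a :- d :* b)) :+ k :* (K :* a)) refl (↑ k) (↑ K) (↑ a) d (↑ b))
    (cong (λ s → ↑ k ℚ.* ↑ K ℚ.* (ℚ.- (↑ a ℚ.- d ℚ.* ↑ b)) ℚ.+ s) (sym (cast k K a))))
  one : ∀ x {A B} → ↑ A ≡ ↑ k ℚ.* ↑ K ℚ.* x ℚ.+ ↑ B → A ℕ.≤ B ℕ.+ K ℕ.* C → x ℚ.≤ ε ℚ.* ↑ C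
  one x {A} {B} A≡ A≤ = ℚₚ.*-cancelˡ-≤-pos (↑ k) {{↑-pos k}} (ℚₚ.*-cancelˡ-≤-pos (↑ K) {{↑-pos K}} (begin
    ↑ K ℚ.* (↑ k ℚ.* x)
      ≡⟨ solve 4 (λ K k x B → K :* (k :* x) := k :* K :* x :+ B :- B) refl (↑ K) (↑ k) x (↑ B) ⟩
    ↑ k ℚ.* ↑ K ℚ.* x ℚ.+ ↑ B ℚ.- ↑ B
      ≡⟨ cong (ℚ._- ↑ B) (sym A≡) ⟩
    ↑ A ℚ.- ↑ B
      ≤⟨ ℚₚ.+-monoˡ-≤ (ℚ.- ↑ B) (↑-mono A≤) ⟩
    ↑ (B ℕ.+ K ℕ.* C) ℚ.- ↑ B
      ≡⟨ cong (ℚ._- ↑ B) (trans (↑-+ B (K ℕ.* C)) (cong (λ s → ↑ B ℚ.+ s) (↑-* K C))) ⟩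
    ↑ B ℚ.+ ↑ K ℚ.* ↑ C ℚ.- ↑ B
      ≡⟨ solve 3 (λ B K C → B :+ K :* C :- B := K :* C) refl (↑ B) (↑ K) (↑ C) ⟩
    ↑ K ℚ.* ↑ C
      ≤⟨ ℚₚ.*-monoˡ-≤-nonNeg (↑ K) {{↑-nonNeg K}} C≤ ⟩
    ↑ K ℚ.* (↑ k ℚ.* (ε ℚ.* ↑ C)) ∎))
    where
    C≤ : ↑ C ℚ.≤ ↑ k ℚ.* (ε ℚ.* ↑ C)
    C≤ = begin
      ↑ C                   ≡⟨ ℚₚ.*-identityˡ (↑ C) ⟨
      ↑ 1 ℚ.* ↑ C             ≤⟨ ℚₚ.*-monoʳ-≤-nonNeg (↑ C) {{↑-nonNeg C}} 1≤εk ⟩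
      ε ℚ.* ↑ k ℚ.* ↑ C         ≡⟨ solve 3 (λ e k C → e :* k :* C := k :* (e :* C)) refl ε (↑ k) (↑ C) ⟩
      ↑ k ℚ.* (ε ℚ.* ↑ C)       ∎

-- Discrepancy of bipartite graphs

card≡# : (U : Subset n) → card U ≡ # (lookup U)
card≡# []          = refl
card≡# (true  ∷ U) = cong suc (card≡# U)
card≡# (false ∷ U) = card≡# U

⊆⇒⊆ᴮ : {U′ U : Subset n} → U′ ⊆ U → lookup U′ ⊆ᴮ lookup U
⊆⇒⊆ᴮ {U′ = U′} {U} U′⊆U x e = []=⇒lookup (U′⊆U (lookup⇒[]= x U′ e))

-- `edgeCount` runs over `x < y` whereas `cnt` runs over ordered pairs in `U × W`; an edge may be
-- met in either orientation.
sum-halves : (a : Fin n → Fin n → ℕ) → (∀ x → a x x ≡ 0) →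
  ∑[ x < n ] ∑[ y < n ] (𝟙 (does (x <? y)) * (a x y + a y x)) ≡ ∑[ x < n ] ∑[ y < n ] a x y
sum-halves {n} a diag = begin
  ∑[ x < n ] ∑[ y < n ] (lt x y * (a x y + a y x))
    ≡⟨ sum₂-cong (λ x y → *-distribˡ-+ (lt x y) (a x y) (a y x)) ⟩
  ∑[ x < n ] ∑[ y < n ] (lt x y * a x y + lt x y * a y x)
    ≡⟨ trans (sum₂-distrib-+ (λ x y → lt x y * a x y) _)
         (cong (λ s → ∑[ x < n ] ∑[ y < n ] (lt x y * a x y) + s) (∑-comm {n} {n} (λ x y → lt x y * a y x))) ⟩
  ∑[ x < n ] ∑[ y < n ] (lt x y * a x y) + ∑[ x < n ] ∑[ y < n ] (lt y x * a x y)
    ≡⟨ sym (sum₂-distrib-+ (λ x y → lt x y * a x y) _) ⟩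
  ∑[ x < n ] ∑[ y < n ] (lt x y * a x y + lt y x * a x y)
    ≡⟨ sum₂-cong pointwise ⟩
  ∑[ x < n ] ∑[ y < n ] a x y ∎
  where
  open ≡-Reasoning
  lt : Fin n → Fin n → ℕ
  lt x y = 𝟙 (does (x <? y))
  pointwise : ∀ x y → lt x y * a x y + lt y x * a x y ≡ a x y
  pointwise x y = go (Finₚ.<-cmp x y)
    where
    go : _ → lt x y * a x y + lt y x * a x y ≡ a x y
    go (tri< x<y _ ¬>) = trans (cong₂ (λ s t → s * a x y + t * a x y) (𝟙-yes (x <? y) x<y) (𝟙-no (y <? x) ¬>))
      (trans (+-identityʳ _) (*-identityˡ _))
    go (tri> ¬< _ y<x) = trans (cong₂ (λ s t → s * a x y + t * a x y) (𝟙-no (x <? y) ¬<) (𝟙-yes (y <? x) y<x))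
      (*-identityˡ _)
    go (tri≈ _ refl _) = trans (cong (λ s → lt x x * s + lt x x * s) (diag x))
      (trans (cong₂ _+_ (*-zeroʳ (lt x x)) (*-zeroʳ (lt x x))) (sym (diag x)))

𝟙≡0⇒ : ∀ {b} → ¬ (b ≡ true) → b ≡ false
𝟙≡0⇒ {true}  ¬t = contradiction refl ¬t
𝟙≡0⇒ {false} _  = refl

∧-true : ∀ a b → a ∧ b ≡ true → a ≡ true × b ≡ true
∧-true true true _ = refl , refl

∨-true : ∀ a b → a ∨ b ≡ true → a ≡ true ⊎ b ≡ true
∨-true true  b _ = inj₁ refl
∨-true false b e = inj₂ e

module Bipartite (U W : Subset n) (G : Graph n) (φ : Fin n → Fin n → Bool)
    (disjoint : ∀ x → lookup U x ≡ true → lookup W x ≡ true → ⊥)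
    (G≡φ : ∀ x y → lookup U x ≡ true → lookup W y ≡ true → adj G x y ≡ φ x y)
    (crossing : ∀ x y → adj G x y ≡ true →
      (lookup U x ≡ true × lookup W y ≡ true) ⊎ (lookup W x ≡ true × lookup U y ≡ true)) where

  edgeCount-K₂ : (U′ W′ : Subset n) → U′ ⊆ U → W′ ⊆ W →
    edgeCount (G ∩ᴳ K₂ U′ W′) ≡ cnt (lookup U′) (lookup W′) φ
  edgeCount-K₂ U′ W′ U′⊆U W′⊆W = trans (sum₂-cong pointwise) (sum-halves a diag)
    where
    u = lookup U′
    w = lookup W′
    a : Fin n → Fin n → ℕ
    a x y = 𝟙 (u x) * (𝟙 (w y) * 𝟙 (φ x y))
    u⇒U = ⊆⇒⊆ᴮ {U′ = U′} {U} U′⊆U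
    w⇒W = ⊆⇒⊆ᴮ {U′ = W′} {W} W′⊆W
    apart : ∀ x → u x ≡ true → w x ≡ false
    apart x ux = 𝟙≡0⇒ (λ wx → disjoint x (u⇒U x ux) (w⇒W x wx))
    diag : ∀ x → a x x ≡ 0
    diag x = go (u x) (w x) (apart x)
      where
      go : ∀ b c → (b ≡ true → c ≡ false) → 𝟙 b * (𝟙 c * 𝟙 (φ x x)) ≡ 0
      go false c _ = refl
      go true  c f = cong (λ c → 𝟙 c * 𝟙 (φ x x) + 0) (f refl)
    inner : ∀ x y b₁ b₂ b₃ b₄ → u x ≡ b₁ → w y ≡ b₂ → w x ≡ b₃ → u y ≡ b₄ →
      𝟙 (adj G x y ∧ (b₁ ∧ b₂ ∨ b₃ ∧ b₄)) ≡ 𝟙 b₁ * (𝟙 b₂ * 𝟙 (φ x y)) + 𝟙 b₄ * (𝟙 b₃ * 𝟙 (φ y x))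
    inner x y true b₂ true b₄ e₁ e₂ e₃ e₄ with () ← trans (sym e₃) (apart x e₁)
    inner x y b₁ true b₃ true e₁ e₂ e₃ e₄ with () ← trans (sym e₂) (apart y e₄)
    inner x y true true false false e₁ e₂ e₃ e₄ = trans (cong 𝟙 (trans (𝔹ₚ.∧-identityʳ _)
      (G≡φ x y (u⇒U x e₁) (w⇒W y e₂)))) (sym (ring (𝟙 (φ x y))))
      where
      ring : ∀ a → 1 * (1 * a) + 0 ≡ a
      ring = solve-∀
    inner x y false false true true e₁ e₂ e₃ e₄ = trans (cong 𝟙 (trans (𝔹ₚ.∧-identityʳ _)
      (trans (Graph.adj-sym G x y) (G≡φ y x (u⇒U y e₄) (w⇒W x e₃))))) (sym (ring (𝟙 (φ y x))))
      where
      ring : ∀ a → 1 * (1 * a) ≡ a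
      ring = solve-∀
    inner x y true  false false false _ _ _ _ = cong 𝟙 (𝔹ₚ.∧-zeroʳ (adj G x y))
    inner x y true  false false true  _ _ _ _ = cong 𝟙 (𝔹ₚ.∧-zeroʳ (adj G x y))
    inner x y false b₂    false false _ _ _ _ = cong 𝟙 (𝔹ₚ.∧-zeroʳ (adj G x y))
    inner x y false false false true  _ _ _ _ = cong 𝟙 (𝔹ₚ.∧-zeroʳ (adj G x y))
    inner x y false b₂    true  false _ _ _ _ = cong 𝟙 (𝔹ₚ.∧-zeroʳ (adj G x y))
    pointwise : ∀ x y → 𝟙 (does (x <? y) ∧ adj (G ∩ᴳ K₂ U′ W′) x y) ≡ 𝟙 (does (x <? y)) * (a x y + a y x)
    pointwise x y = trans (𝟙-∧ (does (x <? y)) _) (go (x <? y))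
      where
      go : (d : Dec (x Fin.< y)) → 𝟙 (does d) * 𝟙 (adj (G ∩ᴳ K₂ U′ W′) x y) ≡ 𝟙 (does d) * (a x y + a y x)
      go (no _)    = refl
      go (yes x<y) = cong (1 *_) (trans
        (cong (λ b → 𝟙 (adj G x y ∧ (not b ∧ (u x ∧ w y ∨ w x ∧ u y))))
          (dec-false (x ≟ y) (λ e → ℕₚ.<-irrefl (cong Fin.toℕ e) x<y)))
        (inner x y (u x) (w y) (w x) (u y) refl refl refl refl))

  edgeCount-G : edgeCount G ≡ cnt (lookup U) (lookup W) φ
  edgeCount-G = trans (sum₂-cong (λ x y → cong (λ b → 𝟙 (does (x <? y) ∧ b)) (within x y)))
    (edgeCount-K₂ U W (λ z → z) (λ z → z))
    where
    within : ∀ x y → adj G x y ≡ adj (G ∩ᴳ K₂ U W) x y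
    within x y = go (adj G x y) refl
      where
      go : ∀ b → adj G x y ≡ b → b ≡ b ∧ adj (K₂ U W) x y
      go false _ = refl
      go true  e = sym (cong₂ (λ d c → not d ∧ c) (dec-false (x ≟ y) x≢y) member)
        where
        x≢y : x ≢ y
        x≢y refl with () ← trans (sym e) (Graph.irrefl G x)
        member : lookup U x ∧ lookup W y ∨ lookup W x ∧ lookup U y ≡ true
        member = [ (λ (p , q) → cong₂ (λ s t → s ∧ t ∨ lookup W x ∧ lookup U y) p q)
                 , (λ (p , q) → trans (cong₂ (λ s t → lookup U x ∧ lookup W y ∨ s ∧ t) p q) (𝔹ₚ.∨-zeroʳ _)) ]′ (crossing x y e)

  module _ (p k c ℓ : ℕ) .{{_ : NonZero ℓ}} .{{_ : NonZero c}} (p≡ : p ≡ 2 * (k * c)) {ε : ℚ} (1≤εk : ↑ 1 ℚ.≤ ε ℚ.* ↑ k)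
      (m≢0 : NonZero (# (lookup U) * # (lookup W)))
      (uniform : ∀ {U′ W′ : Fin n → Bool} → U′ ⊆ᴮ lookup U → W′ ⊆ᴮ lookup W →
        p * (ℓ * cnt U′ W′ φ) ≤ p * (# U′ * # W′) + # (lookup U) * # (lookup W) ×
        p * (# U′ * # W′) ≤ p * (ℓ * cnt U′ W′ φ) + # (lookup U) * # (lookup W)) where
    private
      m S : ℕ
      m = # (lookup U) * # (lookup W)
      S = cnt (lookup U) (lookup W) φ
      m≡ : card U * card W ≡ m
      m≡ = cong₂ _*_ (card≡# U) (card≡# W)
      instance
        m≢0′ : NonZero m
        m≢0′ = m≢0
      whole = uniform {lookup U} {lookup W} (λ _ e → e) (λ _ e → e)

      open ℕₚ.≤-Reasoning

      halve : ∀ x y z → p * x ≤ p * y + 2 * z → k * c * x ≤ k * c * y + z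
      halve x y z le = *-cancelˡ-≤ 2 (begin
        2 * (k * c * x)               ≡⟨ trans (sym (*-assoc 2 (k * c) x)) (cong (_* x) (sym p≡)) ⟩
        p * x                         ≤⟨ le ⟩
        p * y + 2 * z                 ≡⟨ cong (λ s → s * y + 2 * z) p≡ ⟩
        2 * (k * c) * y + 2 * z       ≡⟨ ring (k * c) y z ⟩
        2 * (k * c * y + z)           ∎)
        where
        ring : ∀ a y z → 2 * a * y + 2 * z ≡ 2 * (a * y + z)
        ring = solve-∀

      reduce : ∀ {X Y Z} → p * X ≤ p * Y + 2 * Z → k * X ≤ k * Y + Z
      reduce {X} {Y} {Z} le = *-cancelˡ-≤ c (begin
        c * (k * X)         ≡⟨ ring₁ c k X ⟩
        k * c * X           ≤⟨ halve X Y Z le ⟩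
        k * c * Y + Z       ≤⟨ +-monoʳ-≤ (k * c * Y) (m≤n*m Z c) ⟩
        k * c * Y + c * Z   ≡⟨ ring₂ k c Y Z ⟩
        c * (k * Y + Z)     ∎)
        where
        ring₁ : ∀ c k x → c * (k * x) ≡ k * c * x
        ring₁ = solve-∀
        ring₂ : ∀ k c y z → k * c * y + c * z ≡ c * (k * y + z)
        ring₂ = solve-∀

      module _ {U′ W′ : Fin n → Bool} (U⊆ : U′ ⊆ᴮ lookup U) (W⊆ : W′ ⊆ᴮ lookup W) where
        private
          M = cnt U′ W′ φ
          B = # U′ * # W′
          B≤m : B ≤ m
          B≤m = *-mono-≤ (#-mono U⊆) (#-mono W⊆)
          here = uniform U⊆ W⊆
          twice : ∀ m → m * m + m * m ≡ 2 * (m * m)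
          twice = solve-∀
          expand : ∀ {X Y} → p * (ℓ * X) ≤ p * (ℓ * Y) + 2 * (m * m) → p * X ≤ p * Y + 2 * (m * m)
          expand {X} {Y} le = *-cancelˡ-≤ ℓ (begin
            ℓ * (p * X)                       ≡⟨ ring ℓ p X ⟩
            p * (ℓ * X)                       ≤⟨ le ⟩
            p * (ℓ * Y) + 2 * (m * m)         ≤⟨ +-monoʳ-≤ (p * (ℓ * Y)) (m≤n*m _ ℓ) ⟩
            p * (ℓ * Y) + ℓ * (2 * (m * m))   ≡⟨ ring₂ ℓ p Y (2 * (m * m)) ⟩
            ℓ * (p * Y + 2 * (m * m))         ∎)
            where
            ring : ∀ l p x → l * (p * x) ≡ p * (l * x)
            ring = solve-∀
            ring₂ : ∀ l p y z → p * (l * y) + l * z ≡ l * (p * y + z)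
            ring₂ = solve-∀

        over : k * (m * M) ≤ k * (S * B) + m * m
        over = reduce (expand (begin
          p * (ℓ * (m * M))                 ≡⟨ ring₁ p ℓ m M ⟩
          m * (p * (ℓ * M))                 ≤⟨ *-monoʳ-≤ m (proj₁ here) ⟩
          m * (p * B + m)                   ≡⟨ ring₂ m p B ⟩
          B * (p * m) + m * m               ≤⟨ +-monoˡ-≤ (m * m) (*-monoʳ-≤ B (proj₂ whole)) ⟩
          B * (p * (ℓ * S) + m) + m * m     ≡⟨ ring₃ B p ℓ S m ⟩
          p * (ℓ * (S * B)) + (B * m + m * m) ≤⟨ +-monoʳ-≤ (p * (ℓ * (S * B))) (+-monoˡ-≤ (m * m) (*-monoˡ-≤ m B≤m)) ⟩
          p * (ℓ * (S * B)) + (m * m + m * m) ≡⟨ cong (λ s → p * (ℓ * (S * B)) + s) (twice m) ⟩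
          p * (ℓ * (S * B)) + 2 * (m * m)   ∎))
          where
          ring₁ : ∀ p l m M → p * (l * (m * M)) ≡ m * (p * (l * M))
          ring₁ = solve-∀
          ring₂ : ∀ m p B → m * (p * B + m) ≡ B * (p * m) + m * m
          ring₂ = solve-∀
          ring₃ : ∀ B p l S m → B * (p * (l * S) + m) + m * m ≡ p * (l * (S * B)) + (B * m + m * m)
          ring₃ = solve-∀

        under : k * (S * B) ≤ k * (m * M) + m * m
        under = reduce (expand (begin
          p * (ℓ * (S * B))                 ≡⟨ ring₁ p ℓ S B ⟩
          B * (p * (ℓ * S))                 ≤⟨ *-monoʳ-≤ B (proj₁ whole) ⟩
          B * (p * m + m)                   ≡⟨ ring₂ B p m ⟩
          m * (p * B) + B * m               ≤⟨ +-mono-≤ (*-monoʳ-≤ m (proj₂ here)) (*-monoˡ-≤ m B≤m) ⟩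
          m * (p * (ℓ * M) + m) + m * m     ≡⟨ ring₃ m p ℓ M ⟩
          p * (ℓ * (m * M)) + 2 * (m * m)   ∎))
          where
          ring₁ : ∀ p l S B → p * (l * (S * B)) ≡ B * (p * (l * S))
          ring₁ = solve-∀
          ring₂ : ∀ B p m → B * (p * m + m) ≡ m * (p * B) + B * m
          ring₂ = solve-∀
          ring₃ : ∀ m p l M → m * (p * (l * M) + m) + m * m ≡ p * (l * (m * M)) + 2 * (m * m)
          ring₃ = solve-∀

    -- Uniformity compares with `1/ℓ`, but `disc₂` with the actual density `S/m`. Comparing with the
    -- whole pair doubles the error, which the 2 in `p` pays for; the factor `c` is extra precision
    -- and is discarded by `reduce`.
    disc₂-at-uniform : disc₂-at ε (+ 1 ℚ./ ℓ) U W G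
    disc₂-at-uniform = (+ S ℚ./ m , S≡ , regular) , density
      where
      S≡ : ↑ (edgeCount G) ≡ (+ S ℚ./ m) ℚ.* ↑ (card U * card W)
      S≡ = trans (cong ↑ edgeCount-G) (trans (ratio-* S m) (cong (λ s → (+ S ℚ./ m) ℚ.* ↑ s) (sym m≡)))
      Close : ℚ → ℕ → ℕ → ℕ → Set
      Close d s b v = ℚ.∣ ↑ s ℚ.- d ℚ.* ↑ b ∣ ℚ.≤ ε ℚ.* ↑ v
      regular : (U′ W′ : Subset n) → U′ ⊆ U → W′ ⊆ W →
        Close (+ S ℚ./ m) (edgeCount (G ∩ᴳ K₂ U′ W′)) (card U′ * card W′) (card U * card W)
      regular U′ W′ U′⊆ W′⊆ =
        subst (λ s → Close (+ S ℚ./ m) s (card U′ * card W′) (card U * card W)) (sym (edgeCount-K₂ U′ W′ U′⊆ W′⊆))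
          (subst₂ (λ b v → Close (+ S ℚ./ m) (cnt (lookup U′) (lookup W′) φ) b v)
            (sym (cong₂ _*_ (card≡# U′) (card≡# W′))) (sym m≡)
            (bridge {ε} {+ S ℚ./ m} {k} {m} {S} 1≤εk (ratio-* S m)
              (over (⊆⇒⊆ᴮ {U′ = U′} {U} U′⊆) (⊆⇒⊆ᴮ {U′ = W′} {W} W′⊆))
              (under (⊆⇒⊆ᴮ {U′ = U′} {U} U′⊆) (⊆⇒⊆ᴮ {U′ = W′} {W} W′⊆))))
      widen : ∀ x → x + m ≤ x + 2 * m
      widen x = +-monoʳ-≤ x (m≤n*m m 2)
      density : Close (+ 1 ℚ./ ℓ) (edgeCount G) (card U * card W) (card U * card W)
      density = subst₂ (λ s v → Close (+ 1 ℚ./ ℓ) s v v) (sym edgeCount-G) (sym m≡)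
        (bridge {ε} {+ 1 ℚ./ ℓ} {k} {ℓ} {1} 1≤εk (ratio-* 1 ℓ)
          (≤-trans (reduce (≤-trans (proj₁ whole) (widen (p * m))))
            (+-mono-≤ (*-monoʳ-≤ k (≤-reflexive (sym (*-identityˡ m)))) (m≤n*m m ℓ)))
          (≤-trans (*-monoʳ-≤ k (≤-reflexive (*-identityˡ m)))
            (≤-trans (reduce (≤-trans (proj₂ whole) (widen (p * (ℓ * S)))))
              (+-monoʳ-≤ (k * (ℓ * S)) (m≤n*m m ℓ)))))

-- Triads

∑³ : (Fin n → Fin n → Fin n → ℕ) → ℕ
∑³ {n} f = ∑[ x < n ] ∑[ y < n ] ∑[ z < n ] f x y z

∑³-mono : {f g : Fin n → Fin n → Fin n → ℕ} → (∀ x y z → f x y z ≤ g x y z) → ∑³ f ≤ ∑³ g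
∑³-mono {n} f≤g = sum-mono {n} (λ x → sum₂-mono (f≤g x))

∑³-+ : (f g : Fin n → Fin n → Fin n → ℕ) → ∑³ (λ x y z → f x y z + g x y z) ≡ ∑³ f + ∑³ g
∑³-+ {n} f g = trans (sum-cong-≗ {n} (λ x → sum₂-distrib-+ (f x) (g x))) (∑-distrib-+ {n} _ _)

∑³-swap₁₂ : (f : Fin n → Fin n → Fin n → ℕ) → ∑³ (λ x y z → f y x z) ≡ ∑³ f
∑³-swap₁₂ {n} f = ∑-comm {n} {n} (λ x y → ∑[ z < n ] f y x z)

∑³-swap₂₃ : (f : Fin n → Fin n → Fin n → ℕ) → ∑³ (λ x y z → f x z y) ≡ ∑³ f
∑³-swap₂₃ {n} f = sum-cong-≗ {n} (λ x → ∑-comm {n} {n} (λ y z → f x z y))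

triples : (Fin n → Fin n → Fin n → Bool) → ℕ
triples {n} f = ∑[ x < n ] ∑[ y < n ] ∑[ z < n ] 𝟙 (does (x <? y) ∧ does (y <? z) ∧ f x y z)

triples-mono : {f g : Fin n → Fin n → Fin n → Bool} → (∀ x y z → f x y z ≡ true → g x y z ≡ true) →
  triples f ≤ triples g
triples-mono f⇒g = ∑³-mono (λ x y z → le (does (x <? y)) (does (y <? z)) (f⇒g x y z))
  where
  le : ∀ b c {p q} → (p ≡ true → q ≡ true) → 𝟙 (b ∧ c ∧ p) ≤ 𝟙 (b ∧ c ∧ q)
  le false _     _ = z≤n
  le true  false _ = z≤n
  le true  true {false} _ = z≤n
  le true  true {true}  f = ≤-reflexive (cong 𝟙 (sym (f refl)))

triples-∨ : {f g k : Fin n → Fin n → Fin n → Bool} →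
  (∀ x y z → f x y z ≡ true → g x y z ≡ true ⊎ k x y z ≡ true) → triples f ≤ triples g + triples k
triples-∨ {f = f} {g} {k} cover = ≤-trans (∑³-mono (λ x y z → le (does (x <? y)) (does (y <? z)) (cover x y z)))
  (≤-reflexive (∑³-+ (λ x y z → 𝟙 (does (x <? y) ∧ does (y <? z) ∧ g x y z))
                        (λ x y z → 𝟙 (does (x <? y) ∧ does (y <? z) ∧ k x y z))))
  where
  le : ∀ b c {p q r} → (p ≡ true → q ≡ true ⊎ r ≡ true) → 𝟙 (b ∧ c ∧ p) ≤ 𝟙 (b ∧ c ∧ q) + 𝟙 (b ∧ c ∧ r)
  le false _     _ = z≤n
  le true  false _ = z≤n
  le true  true {false} _ = z≤n
  le true  true {true} {q} {r} f with f refl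
  ... | inj₁ refl = s≤s z≤n
  ... | inj₂ refl = m≤n+m 1 (𝟙 q)

triples≤∑³ : (f : Fin n → Fin n → Fin n → Bool) → triples f ≤ ∑³ (λ x y z → 𝟙 (f x y z))
triples≤∑³ f = ∑³-mono (λ x y z → le (does (x <? y)) (does (y <? z)) (f x y z))
  where
  le : ∀ b c d → 𝟙 (b ∧ c ∧ d) ≤ 𝟙 d
  le false _     d = z≤n
  le true  false d = z≤n
  le true  true  d = ℕₚ.≤-refl

module _ (part : Fin n → Fin t) {i j k : Fin t} where

  -- Each triple meeting the three parts once has one of six orderings.
  triples≤6 : (f : Fin n → Fin n → Fin n → Bool) →
    (∀ x y z → f x y z ≡ f y x z) → (∀ x y z → f x y z ≡ f x z y) →
    (∀ x y z → f x y z ≡ true → Distinct (part x) (part y) (part z)) →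
    (∀ x y z → f x y z ≡ true → part x ≡ i ⊎ part x ≡ j ⊎ part x ≡ k) →
    (J : Fin n → Fin n → Fin n → ℕ) →
    (∀ x y z → f x y z ≡ true → part x ≡ i → part y ≡ j → part z ≡ k → 1 ≤ J x y z) →
    triples f ≤ 6 * ∑³ J
  triples≤6 f f₁₂ f₂₃ distinct inside J J≥1 = ≤-trans (triples≤∑³ f) (≤-trans
    (∑³-mono pointwise) (≤-reflexive total))
    where
    J₁ J₂ J₃ J₄ J₅ : Fin n → Fin n → Fin n → ℕ
    J₁ x y z = J x z y
    J₂ x y z = J y x z
    J₃ x y z = J y z x
    J₄ x y z = J z x y
    J₅ x y z = J z y x
    sumJ : Fin n → Fin n → Fin n → ℕ
    sumJ x y z = J x y z + (J₁ x y z + (J₂ x y z + (J₃ x y z + (J₄ x y z + J₅ x y z))))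
    S = ∑³ J
    s₁ : ∑³ J₁ ≡ S
    s₁ = ∑³-swap₂₃ J
    s₂ : ∑³ J₂ ≡ S
    s₂ = ∑³-swap₁₂ J
    s₃ : ∑³ J₃ ≡ S
    s₃ = trans (∑³-swap₁₂ (λ x y z → J x z y)) s₁
    s₄ : ∑³ J₄ ≡ S
    s₄ = trans (∑³-swap₂₃ (λ x y z → J y x z)) s₂
    s₅ : ∑³ J₅ ≡ S
    s₅ = trans (∑³-swap₂₃ (λ x y z → J y z x)) s₃
    total : ∑³ sumJ ≡ 6 * S
    total = trans (∑³-+ J _) (trans (cong (λ s → S + s) (trans (∑³-+ J₁ _) (cong₂ _+_ s₁ (trans (∑³-+ J₂ _)
      (cong₂ _+_ s₂ (trans (∑³-+ J₃ _) (cong₂ _+_ s₃ (trans (∑³-+ J₄ J₅) (cong₂ _+_ s₄ s₅)))))))))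
      (ring S))
      where
      ring : ∀ s → s + (s + (s + (s + (s + s)))) ≡ 6 * s
      ring = solve-∀
    pointwise : ∀ x y z → 𝟙 (f x y z) ≤ sumJ x y z
    pointwise x y z = go (f x y z) refl
      where
      P : Fin n → Set
      P w = part w ≡ i ⊎ part w ≡ j ⊎ part w ≡ k
      clash : ∀ {u w} {l : Fin t} {B : Set} → part u ≢ part w → part u ≡ l → part w ≡ l → B
      clash ≢ e e′ = contradiction (trans e (sym e′)) ≢
      cases : f x y z ≡ true → P x → P y → P z → Distinct (part x) (part y) (part z) → 1 ≤ sumJ x y z
      cases e (inj₁ a) (inj₂ (inj₁ b)) (inj₂ (inj₂ c)) _ =
        ≤-trans (J≥1 x y z e a b c) (m≤m+n _ _)
      cases e (inj₁ a) (inj₂ (inj₂ b)) (inj₂ (inj₁ c)) _ =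
        ≤-trans (J≥1 x z y (trans (sym (f₂₃ x y z)) e) a c b)
          (≤-trans (m≤m+n _ _) (m≤n+m _ (J x y z)))
      cases e (inj₂ (inj₁ a)) (inj₁ b) (inj₂ (inj₂ c)) _ =
        ≤-trans (J≥1 y x z (trans (sym (f₁₂ x y z)) e) b a c)
          (≤-trans (m≤m+n _ _) (≤-trans (m≤n+m _ (J₁ x y z)) (m≤n+m _ (J x y z))))
      cases e (inj₂ (inj₂ a)) (inj₁ b) (inj₂ (inj₁ c)) _ =
        ≤-trans (J≥1 y z x (trans (sym (trans (f₁₂ x y z) (f₂₃ y x z))) e) b c a)
          (≤-trans (m≤m+n _ _) (≤-trans (m≤n+m _ (J₂ x y z))
            (≤-trans (m≤n+m _ (J₁ x y z)) (m≤n+m _ (J x y z)))))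
      cases e (inj₂ (inj₁ a)) (inj₂ (inj₂ b)) (inj₁ c) _ =
        ≤-trans (J≥1 z x y (trans (sym (trans (f₂₃ x y z) (f₁₂ x z y))) e) c a b)
          (≤-trans (m≤m+n _ _) (≤-trans (m≤n+m _ (J₃ x y z)) (≤-trans (m≤n+m _ (J₂ x y z))
            (≤-trans (m≤n+m _ (J₁ x y z)) (m≤n+m _ (J x y z))))))
      cases e (inj₂ (inj₂ a)) (inj₂ (inj₁ b)) (inj₁ c) _ =
        ≤-trans (J≥1 z y x (trans (sym (trans (f₁₂ x y z) (trans (f₂₃ y x z) (f₁₂ y z x)))) e) c b a)
          (≤-trans (m≤n+m _ (J₄ x y z)) (≤-trans (m≤n+m _ (J₃ x y z)) (≤-trans (m≤n+m _ (J₂ x y z))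
            (≤-trans (m≤n+m _ (J₁ x y z)) (m≤n+m _ (J x y z))))))
      cases e (inj₁ a) (inj₁ b) _ (xy , _) = clash xy a b
      cases e (inj₂ (inj₁ a)) (inj₂ (inj₁ b)) _ (xy , _) = clash xy a b
      cases e (inj₂ (inj₂ a)) (inj₂ (inj₂ b)) _ (xy , _) = clash xy a b
      cases e (inj₁ a) _ (inj₁ c) (_ , xz , _) = clash xz a c
      cases e (inj₂ (inj₁ a)) _ (inj₂ (inj₁ c)) (_ , xz , _) = clash xz a c
      cases e (inj₂ (inj₂ a)) _ (inj₂ (inj₂ c)) (_ , xz , _) = clash xz a c
      cases e _ (inj₁ b) (inj₁ c) (_ , _ , yz) = clash yz b c
      cases e _ (inj₂ (inj₁ b)) (inj₂ (inj₁ c)) (_ , _ , yz) = clash yz b c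
      cases e _ (inj₂ (inj₂ b)) (inj₂ (inj₂ c)) (_ , _ , yz) = clash yz b c
      go : ∀ b → f x y z ≡ b → 𝟙 b ≤ sumJ x y z
      go false _ = z≤n
      go true  e = cases e (inside x y z e)
        (inside y x z (trans (sym (f₁₂ x y z)) e))
        (inside z x y (trans (sym (trans (f₂₃ x y z) (f₁₂ x z y))) e))
        (distinct x y z e)

Bool-ext : ∀ a b → (a ≡ true → b ≡ true) → (b ≡ true → a ≡ true) → a ≡ b
Bool-ext true  b     f _ = sym (f refl)
Bool-ext false true  _ g = g refl
Bool-ext false false _ _ = refl

-- Recovering parts and colours from a triad

module Parts (part : Fin n → Fin t) {ℓ : ℕ} (colour : Fin n → Fin n → Fin ℓ) where

  -- `V` and `pair` repeat the bodies used in `Decomposition`, so that results about them carry over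
  -- by `refl`.
  V : Fin t → Subset n
  V i = tabulate (λ x → does (part x ≟ i))

  pair : Fin t → Fin t → Fin ℓ → Fin n → Fin n → Bool
  pair i j α x y = adj (K₂ (V i) (V j)) x y ∧ does (colour x y ≟ α)

  V-cell : ∀ i x → lookup (V i) x ≡ cell part i x
  V-cell i x = lookup∘tabulate (λ x → does (part x ≟ i)) x

  V⇒≡ : ∀ i x → lookup (V i) x ≡ true → part x ≡ i
  V⇒≡ i x e = cell⇒≡ part i x (trans (sym (V-cell i x)) e)

  ≡⇒V : ∀ i x → part x ≡ i → lookup (V i) x ≡ true
  ≡⇒V i x e = trans (V-cell i x) (dec-true (part x ≟ i) e)

  K₂⇒parts : ∀ i j x y → adj (K₂ (V i) (V j)) x y ≡ true →
    (part x ≡ i × part y ≡ j) ⊎ (part x ≡ j × part y ≡ i)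
  K₂⇒parts i j x y e with ∨-true _ _ (proj₂ (∧-true (not (does (x ≟ y))) _ e))
  ... | inj₁ e′ = let a , b = ∧-true (lookup (V i) x) _ e′ in inj₁ (V⇒≡ i x a , V⇒≡ j y b)
  ... | inj₂ e′ = let a , b = ∧-true (lookup (V j) x) _ e′ in inj₂ (V⇒≡ j x a , V⇒≡ i y b)

  parts⇒K₂ : ∀ {i j} x y → i ≢ j → part x ≡ i → part y ≡ j → adj (K₂ (V i) (V j)) x y ≡ true
  parts⇒K₂ {i} {j} x y i≢j px py = cong₂ (λ d m → not d ∧ m)
    (dec-false (x ≟ y) (λ { refl → i≢j (trans (sym px) py) }))
    (cong₂ (λ s r → s ∧ r ∨ lookup (V j) x ∧ lookup (V i) y) (≡⇒V i x px) (≡⇒V j y py))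

  pair⇒ : ∀ i j α x y → pair i j α x y ≡ true →
    ((part x ≡ i × part y ≡ j) ⊎ (part x ≡ j × part y ≡ i)) × colour x y ≡ α
  pair⇒ i j α x y e = let a , b = ∧-true (adj (K₂ (V i) (V j)) x y) _ e in
    K₂⇒parts i j x y a , does⇒ (colour x y ≟ α) b

  module Triple {i j k : Fin t} (ijk : Distinct i j k) (α β γ : Fin ℓ) (colour-sym : ∀ x y → colour x y ≡ colour y x)
                (G : Graph n) (G-spec : ∀ x y → adj G x y ≡ pair i j α x y ∨ (pair i k β x y ∨ pair j k γ x y)) where
    private
      i≢j = proj₁ ijk
      i≢k = proj₁ (proj₂ ijk)
      j≢k = proj₂ (proj₂ ijk)

    data Link (x y : Fin n) : Set where
      ij : part x ≡ i → part y ≡ j → colour x y ≡ α → Link x y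
      ji : part x ≡ j → part y ≡ i → colour x y ≡ α → Link x y
      ik : part x ≡ i → part y ≡ k → colour x y ≡ β → Link x y
      ki : part x ≡ k → part y ≡ i → colour x y ≡ β → Link x y
      jk : part x ≡ j → part y ≡ k → colour x y ≡ γ → Link x y
      kj : part x ≡ k → part y ≡ j → colour x y ≡ γ → Link x y

    link : ∀ x y → adj G x y ≡ true → Link x y
    link x y e with ∨-true (pair i j α x y) _ (trans (sym (G-spec x y)) e)
    ... | inj₁ e₁ = [ (λ (p , q) → ij p q c) , (λ (p , q) → ji p q c) ]′ (proj₁ (pair⇒ i j α x y e₁))
      where c = proj₂ (pair⇒ i j α x y e₁)
    ... | inj₂ e₁ with ∨-true (pair i k β x y) _ e₁
    ...   | inj₁ e₂ = [ (λ (p , q) → ik p q c) , (λ (p , q) → ki p q c) ]′ (proj₁ (pair⇒ i k β x y e₂))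
      where c = proj₂ (pair⇒ i k β x y e₂)
    ...   | inj₂ e₂ = [ (λ (p , q) → jk p q c) , (λ (p , q) → kj p q c) ]′ (proj₁ (pair⇒ j k γ x y e₂))
      where c = proj₂ (pair⇒ j k γ x y e₂)

    link-in : ∀ {x y} → Link x y → part x ≡ i ⊎ part x ≡ j ⊎ part x ≡ k
    link-in (ij p _ _) = inj₁ p
    link-in (ji p _ _) = inj₂ (inj₁ p)
    link-in (ik p _ _) = inj₁ p
    link-in (ki p _ _) = inj₂ (inj₂ p)
    link-in (jk p _ _) = inj₂ (inj₁ p)
    link-in (kj p _ _) = inj₂ (inj₂ p)

    link-≢ : ∀ {x y} → Link x y → part x ≢ part y
    link-≢ (ij p q _) e = i≢j (trans (sym p) (trans e q))
    link-≢ (ji p q _) e = i≢j (sym (trans (sym p) (trans e q)))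
    link-≢ (ik p q _) e = i≢k (trans (sym p) (trans e q))
    link-≢ (ki p q _) e = i≢k (sym (trans (sym p) (trans e q)))
    link-≢ (jk p q _) e = j≢k (trans (sym p) (trans e q))
    link-≢ (kj p q _) e = j≢k (sym (trans (sym p) (trans e q)))

    link-ij : ∀ {x y} → Link x y → part x ≡ i → part y ≡ j → colour x y ≡ α
    link-ij (ij _ _ c) _ _ = c
    link-ij (ji p _ _) p′ _ = contradiction (trans (sym p′) p) i≢j
    link-ij (ik _ q _) _ q′ = contradiction (trans (sym q′) q) j≢k
    link-ij (ki p _ _) p′ _ = contradiction (trans (sym p′) p) i≢k
    link-ij (jk p _ _) p′ _ = contradiction (trans (sym p′) p) i≢j
    link-ij (kj p _ _) p′ _ = contradiction (trans (sym p′) p) i≢k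

    link-ik : ∀ {x y} → Link x y → part x ≡ i → part y ≡ k → colour x y ≡ β
    link-ik (ij _ q _) _ q′ = contradiction (trans (sym q) q′) j≢k
    link-ik (ji p _ _) p′ _ = contradiction (trans (sym p′) p) i≢j
    link-ik (ik _ _ c) _ _ = c
    link-ik (ki p _ _) p′ _ = contradiction (trans (sym p′) p) i≢k
    link-ik (jk p _ _) p′ _ = contradiction (trans (sym p′) p) i≢j
    link-ik (kj p _ _) p′ _ = contradiction (trans (sym p′) p) i≢k

    link-jk : ∀ {x y} → Link x y → part x ≡ j → part y ≡ k → colour x y ≡ γ
    link-jk (ij p _ _) p′ _ = contradiction (trans (sym p) p′) i≢j
    link-jk (ji _ q _) _ q′ = contradiction (trans (sym q) q′) i≢k
    link-jk (ik p _ _) p′ _ = contradiction (trans (sym p) p′) i≢j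
    link-jk (ki p _ _) p′ _ = contradiction (trans (sym p′) p) j≢k
    link-jk (jk _ _ c) _ _ = c
    link-jk (kj p _ _) p′ _ = contradiction (trans (sym p′) p) j≢k

    links : ∀ x y z → edge (K₃ G) x y z ≡ true → Link x y × Link x z × Link y z
    links x y z e = let e₁ , e₂ = ∧-true (adj G x y) _ e
                        e₃ , e₄ = ∧-true (adj G x z) _ e₂
                    in link x y e₁ , link x z e₃ , link y z e₄

    private
      same-ij : ∀ x y → adj G x y ∧ adj (K₂ (V i) (V j)) x y ≡ pair i j α x y
      same-ij x y = Bool-ext (adj G x y ∧ adj (K₂ (V i) (V j)) x y) (pair i j α x y)
        (λ e → let g , κ = ∧-true (adj G x y) _ e in
          cong₂ _∧_ κ (dec-true (colour x y ≟ α) ([ (λ (p , q) → link-ij (link x y g) p q)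
            , (λ (p , q) → trans (colour-sym x y) (link-ij (link y x (trans (Graph.adj-sym G y x) g)) q p)) ]′ (K₂⇒parts i j x y κ))))
        (λ e → cong₂ _∧_ (trans (G-spec x y) (cong (_∨ (pair i k β x y ∨ pair j k γ x y)) e)) (proj₁ (∧-true _ _ e)))

      same-ik : ∀ x y → adj G x y ∧ adj (K₂ (V i) (V k)) x y ≡ pair i k β x y
      same-ik x y = Bool-ext (adj G x y ∧ adj (K₂ (V i) (V k)) x y) (pair i k β x y)
        (λ e → let g , κ = ∧-true (adj G x y) _ e in
          cong₂ _∧_ κ (dec-true (colour x y ≟ β) ([ (λ (p , q) → link-ik (link x y g) p q)
            , (λ (p , q) → trans (colour-sym x y) (link-ik (link y x (trans (Graph.adj-sym G y x) g)) q p)) ]′ (K₂⇒parts i k x y κ))))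
        (λ e → cong₂ _∧_ (trans (G-spec x y) (trans (cong (λ s → pair i j α x y ∨ (s ∨ pair j k γ x y)) e) (𝔹ₚ.∨-zeroʳ _))) (proj₁ (∧-true _ _ e)))

      same-jk : ∀ x y → adj G x y ∧ adj (K₂ (V j) (V k)) x y ≡ pair j k γ x y
      same-jk x y = Bool-ext (adj G x y ∧ adj (K₂ (V j) (V k)) x y) (pair j k γ x y)
        (λ e → let g , κ = ∧-true (adj G x y) _ e in
          cong₂ _∧_ κ (dec-true (colour x y ≟ γ) ([ (λ (p , q) → link-jk (link x y g) p q)
            , (λ (p , q) → trans (colour-sym x y) (link-jk (link y x (trans (Graph.adj-sym G y x) g)) q p)) ]′ (K₂⇒parts j k x y κ))))
        (λ e → cong₂ _∧_ (trans (G-spec x y) (trans (cong (λ s → pair i j α x y ∨ (pair i k β x y ∨ s)) e)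
            (trans (cong (pair i j α x y ∨_) (𝔹ₚ.∨-zeroʳ _)) (𝔹ₚ.∨-zeroʳ _)))) (proj₁ (∧-true _ _ e)))

    -- `disc₂,₃` tests the restrictions of the triad to two parts; as the three parts are distinct,
    -- these restrictions are the original colour classes.
    triad-pairs : (∀ x y → adj (G [ V i , V j ]) x y ≡ pair i j α x y) ×
                  (∀ x y → adj (G [ V i , V k ]) x y ≡ pair i k β x y) ×
                  (∀ x y → adj (G [ V j , V k ]) x y ≡ pair j k γ x y)
    triad-pairs = same-ij , same-ik , same-jk

-- Discrepancy of triads

module _ (H : ThreeGraph n) (G : Graph n) where
  private
    F K : ℕ
    F = tripleCount (H ∩³ K₃ G)
    K = tripleCount (K₃ G)

    side : Bool → Fin n → Fin n → Fin n → Bool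
    side e x y z = edge (K₃ G) x y z ∧ sel e (edge H x y z)

    ∧-intro : ∀ {a b} → a ≡ true → b ≡ true → a ∧ b ≡ true
    ∧-intro refl refl = refl

    split : ∀ {a} b → a ≡ true → b ∧ a ≡ true ⊎ a ∧ not b ≡ true
    split true  e = inj₁ e
    split false e = inj₂ (∧-intro e refl)

    F≤side : F ≤ triples (side true)
    F≤side = triples-mono {f = edge (H ∩³ K₃ G)} {side true} (λ x y z e → let p , q = ∧-true (edge H x y z) _ e in ∧-intro q p)

    F≤K : F ≤ K
    F≤K = triples-mono {f = edge (H ∩³ K₃ G)} {edge (K₃ G)} (λ x y z e → proj₂ (∧-true (edge H x y z) _ e))

    K≤F+side : K ≤ F + triples (side false)
    K≤F+side = triples-∨ {f = edge (K₃ G)} {edge (H ∩³ K₃ G)} {side false} (λ x y z e → split (edge H x y z) e)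

    module _ (G′ : Graph n) (G′⊆G : G′ ⊆ᴳ G) where
      a b : ℕ
      a = tripleCount ((H ∩³ K₃ G) ∩³ K₃ G′)
      b = tripleCount (K₃ G′)

      K₃⊆ : ∀ x y z → edge (K₃ G′) x y z ≡ true → edge (K₃ G) x y z ≡ true
      K₃⊆ x y z e = let p , q = ∧-true (adj G′ x y) _ e
                        r , s = ∧-true (adj G′ x z) _ q
                    in ∧-intro (G′⊆G x y p) (∧-intro (G′⊆G x z r) (G′⊆G y z s))

      b≤K : b ≤ K
      b≤K = triples-mono {f = edge (K₃ G′)} {edge (K₃ G)} K₃⊆

      a≤b : a ≤ b
      a≤b = triples-mono {f = edge ((H ∩³ K₃ G) ∩³ K₃ G′)} {edge (K₃ G′)} (λ x y z e → proj₂ (∧-true (edge H x y z ∧ edge (K₃ G) x y z) _ e))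

      a≤F : a ≤ F
      a≤F = triples-mono {f = edge ((H ∩³ K₃ G) ∩³ K₃ G′)} {edge (H ∩³ K₃ G)} (λ x y z e → proj₁ (∧-true _ (edge (K₃ G′) x y z) e))

      b≤a+side : b ≤ a + triples (side false)
      b≤a+side = triples-∨ {f = edge (K₃ G′)} {edge ((H ∩³ K₃ G) ∩³ K₃ G′)} {side false} cover
        where
        cover : ∀ x y z → edge (K₃ G′) x y z ≡ true →
          (edge H x y z ∧ edge (K₃ G) x y z) ∧ edge (K₃ G′) x y z ≡ true ⊎ side false x y z ≡ true
        cover x y z e = [ (λ p → inj₁ (∧-intro p e)) , inj₂ ]′ (split (edge H x y z) (K₃⊆ x y z e))

      cleared : ∀ e {k C} → k * triples (side e) ≤ C →
        k * (K * a) ≤ k * (F * b) + K * C × k * (F * b) ≤ k * (K * a) + K * C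
      cleared true {k} {C} kB≤C =
          ≤-trans (swap-bound (≤-trans a≤F F≤side)) (m≤n+m (K * C) _)
        , ≤-trans (≤-trans (*-monoʳ-≤ k (≤-trans (≤-reflexive (*-comm F b)) (*-monoˡ-≤ F b≤K)))
            (swap-bound F≤side)) (m≤n+m (K * C) _)
        where
        ring : ∀ k K x → k * (K * x) ≡ K * (k * x)
        ring = solve-∀
        swap-bound : ∀ {x} → x ≤ triples (side true) → k * (K * x) ≤ K * C
        swap-bound {x} x≤ = ≤-trans (≤-reflexive (ring k K x))
          (*-monoʳ-≤ K (≤-trans (*-monoʳ-≤ k x≤) kB≤C))
      cleared false {k} {C} kB≤C = (begin
          k * (K * a)               ≤⟨ *-monoʳ-≤ k (*-mono-≤ K≤F+side a≤b) ⟩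
          k * ((F + B) * b)         ≡⟨ ring₁ k F B b ⟩
          k * (F * b) + b * (k * B) ≤⟨ +-monoʳ-≤ (k * (F * b)) (*-mono-≤ b≤K kB≤C) ⟩
          k * (F * b) + K * C       ∎)
        , (begin
          k * (F * b)               ≤⟨ *-monoʳ-≤ k (*-mono-≤ F≤K b≤a+side) ⟩
          k * (K * (a + B))         ≡⟨ ring₂ k K a B ⟩
          k * (K * a) + K * (k * B) ≤⟨ +-monoʳ-≤ (k * (K * a)) (*-monoʳ-≤ K kB≤C) ⟩
          k * (K * a) + K * C       ∎)
        where
        open ℕₚ.≤-Reasoning
        B = triples (side false)
        ring₁ : ∀ k F B b → k * ((F + B) * b) ≡ k * (F * b) + b * (k * B)
        ring₁ = solve-∀
        ring₂ : ∀ k K a B → k * (K * (a + B)) ≡ k * (K * a) + K * (k * B)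
        ring₂ = solve-∀

  -- Let `B` be the number of triangles on side `e`. If these are the edges, both the edge count in
  -- `G′` and `d₃` times its triangle count lie between 0 and `B`; if they are the non-edges, both
  -- lie within `B` below the triangle count of `G′`. No quasirandomness enters.
  one-sided : ∀ {ε k C} → ↑ 1 ℚ.≤ ε ℚ.* ↑ k → ∀ e → k * triples (side e) ≤ C →
    ∃[ d₃ ] ↑ (tripleCount (H ∩³ K₃ G)) ≡ d₃ ℚ.* ↑ (tripleCount (K₃ G)) ×
      ((G′ : Graph n) → G′ ⊆ᴳ G →
        ℚ.∣ ↑ (tripleCount ((H ∩³ K₃ G) ∩³ K₃ G′)) ℚ.- d₃ ℚ.* ↑ (tripleCount (K₃ G′)) ∣ ℚ.≤ ε ℚ.* ↑ C)
  one-sided {ε} {k} {C} 1≤εk e kB≤C = go K refl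
    where
    Goal : ℚ → Set
    Goal d₃ = ↑ F ≡ d₃ ℚ.* ↑ K × ((G′ : Graph n) → G′ ⊆ᴳ G →
        ℚ.∣ ↑ (tripleCount ((H ∩³ K₃ G) ∩³ K₃ G′)) ℚ.- d₃ ℚ.* ↑ (tripleCount (K₃ G′)) ∣ ℚ.≤ ε ℚ.* ↑ C)
    go : ∀ K′ → K ≡ K′ → ∃[ d₃ ] Goal d₃
    go (suc K′) K≡ = + F ℚ./ suc K′ , ratio , λ G′ G′⊆G →
      let le₁ , le₂ = cleared G′ G′⊆G e {k} {C} kB≤C in
      bridge {ε} {+ F ℚ./ suc K′} {k} {suc K′} {F} 1≤εk (ratio-* F (suc K′))
        (subst (λ K → k * (K * a G′ G′⊆G) ≤ k * (F * b G′ G′⊆G) + K * C) K≡ le₁)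
        (subst (λ K → k * (F * b G′ G′⊆G) ≤ k * (K * a G′ G′⊆G) + K * C) K≡ le₂)
      where
      ratio : ↑ F ≡ (+ F ℚ./ suc K′) ℚ.* ↑ K
      ratio = trans (ratio-* F (suc K′)) (cong (λ K → (+ F ℚ./ suc K′) ℚ.* ↑ K) (sym K≡))
    -- Without triangles there is no ratio to take, and 0 serves as density.
    go zero K≡0 = 0ℚ , trans (cong ↑ F≡0) (sym (ℚₚ.*-zeroˡ (↑ K))) , λ G′ G′⊆G →
      subst (λ s → ℚ.∣ s ∣ ℚ.≤ ε ℚ.* ↑ C)
        (sym (cong₂ ℚ._-_ (cong ↑ (a≡0 G′ G′⊆G)) (ℚₚ.*-zeroˡ (↑ (tripleCount (K₃ G′))))))
        (scale≤ {ε} {k} {0} {C} 1≤εk (≤-trans (≤-reflexive (*-zeroʳ k)) z≤n))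
      where
      F≡0 : F ≡ 0
      F≡0 = ℕₚ.n≤0⇒n≡0 (subst (F ≤_) K≡0 F≤K)
      a≡0 : ∀ G′ G′⊆G → a G′ G′⊆G ≡ 0
      a≡0 G′ G′⊆G = ℕₚ.n≤0⇒n≡0 (subst (a G′ G′⊆G ≤_) F≡0 (a≤F G′ G′⊆G))

-- Edges of `A × E` inside a triad

cylinder : (Fin n → Bool) → (Fin n → Fin n → Bool) → Fin n → Fin n → Fin n → Bool
cylinder A E x y z = (A x ∧ E y z) ∨ ((A y ∧ E x z) ∨ (A z ∧ E x y))

module _ (A : Fin n → Bool) (E : Fin n → Fin n → Bool)
         (E-sym : ∀ x y → E x y ≡ E y x) (E⇒¬A : ∀ x y → E x y ≡ true → A x ≡ false) where

  E-A-left : ∀ x y → A x ≡ true → E x y ≡ false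
  E-A-left x y ax = 𝟙≡0⇒ (λ e → contradiction (trans (sym ax) (E⇒¬A x y e)) λ ())

  E-A-right : ∀ x y → A y ≡ true → E x y ≡ false
  E-A-right x y ay = trans (E-sym x y) (E-A-left y x ay)

  private
    eval : ∀ x y z {a b c} → A x ≡ a → A y ≡ b → A z ≡ c →
      cylinder A E x y z ≡ (a ∧ E y z) ∨ ((b ∧ E x z) ∨ (c ∧ E x y))
    eval x y z refl refl refl = refl

  cylinder₁ : ∀ x y z → A x ≡ true → A y ≡ false → A z ≡ false → cylinder A E x y z ≡ E y z
  cylinder₁ x y z ax ay az = trans (eval x y z ax ay az) (𝔹ₚ.∨-identityʳ _)

  cylinder₂ : ∀ x y z → A x ≡ false → A y ≡ true → A z ≡ false → cylinder A E x y z ≡ E x z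
  cylinder₂ x y z ax ay az = trans (eval x y z ax ay az) (𝔹ₚ.∨-identityʳ _)

  cylinder₃ : ∀ x y z → A x ≡ false → A y ≡ false → A z ≡ true → cylinder A E x y z ≡ E x y
  cylinder₃ x y z ax ay az = eval x y z ax ay az

  cylinder₀ : ∀ x y z → A x ≡ false → A y ≡ false → A z ≡ false → cylinder A E x y z ≡ false
  cylinder₀ x y z ax ay az = eval x y z ax ay az

  cylinder₁₂ : ∀ x y z → A x ≡ true → A y ≡ true → cylinder A E x y z ≡ false
  cylinder₁₂ x y z ax ay = trans (eval x y z ax ay refl)
    (cong₂ _∨_ (E-A-left y z ay) (cong₂ _∨_ (E-A-left x z ax) (trans (cong (A z ∧_) (E-A-left x y ax)) (𝔹ₚ.∧-zeroʳ (A z)))))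

  cylinder₁₃ : ∀ x y z → A x ≡ true → A z ≡ true → cylinder A E x y z ≡ false
  cylinder₁₃ x y z ax az = trans (eval x y z ax refl az)
    (cong₂ _∨_ (E-A-right y z az) (cong₂ _∨_ (trans (cong (A y ∧_) (E-A-left x z ax)) (𝔹ₚ.∧-zeroʳ (A y))) (E-A-left x y ax)))

  cylinder₂₃ : ∀ x y z → A y ≡ true → A z ≡ true → cylinder A E x y z ≡ false
  cylinder₂₃ x y z ay az = trans (eval x y z refl ay az)
    (cong₂ _∨_ (trans (cong (A x ∧_) (E-A-left y z ay)) (𝔹ₚ.∧-zeroʳ (A x))) (cong₂ _∨_ (E-A-right x z az) (E-A-right x y ay)))

  module Minority (k₁ p ℓ h : ℕ) .{{_ : NonZero p}} .{{_ : NonZero ℓ}} (57k₁≤ℓ : 57 * k₁ ≤ ℓ) (ℓ³≤p : ℓ * ℓ * ℓ ≤ p)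
      (H : ThreeGraph n) (H≡ : ∀ x y z → edge H x y z ≡ cylinder A E x y z)
      (C : Coloured p ℓ h A E t) (inhabited : ∀ i → ∃[ x ] Coloured.part C x ≡ i) where
    open Coloured C
    open Parts part colour
    open Triangles p ℓ ℓ³≤p E colour part

    s : Fin t → ℕ
    s = size part

    -- A part outside the exceptional pairs is pure, so one representative tells whether it lies in
    -- `A`.
    typeOf : Fin t → Bool
    typeOf i = A (proj₁ (inhabited i))

    typed : ∀ {i j} → Γ i j ≡ false → ∀ {x} → part x ≡ i → A x ≡ typeOf i
    typed {i} {j} e px = pure i j e _ _ px (proj₂ (inhabited i))

    K : ℕ
    K = k₁ * (ℓ * ℓ * ℓ)

    -- `K` is the reciprocal of `ε₁ d₂³` with `d₂ = 1/ℓ`. Six orderings times `37/4` make 55.5,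
    -- which is the origin of the condition `57 * k₁ ≤ ℓ`.
    6tri-small : ∀ {τ v} → 4 * (ℓ * ℓ * (ℓ * ℓ)) * τ ≤ 37 * v → K * (6 * τ) ≤ v
    6tri-small {τ} {v} le = *-cancelˡ-≤ (4 * ℓ) {{m*n≢0 4 ℓ}} (begin
      4 * ℓ * (K * (6 * τ))                 ≡⟨ ring₁ ℓ k₁ τ ⟩
      6 * k₁ * (4 * (ℓ * ℓ * (ℓ * ℓ)) * τ)  ≤⟨ *-monoʳ-≤ (6 * k₁) le ⟩
      6 * k₁ * (37 * v)                     ≡⟨ ring₂ k₁ v ⟩
      222 * k₁ * v                          ≤⟨ *-monoˡ-≤ v (*-monoˡ-≤ k₁ (m≤m+n 222 6)) ⟩
      228 * k₁ * v                          ≡⟨ ring₃ k₁ v ⟩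
      4 * (57 * k₁) * v                     ≤⟨ *-monoˡ-≤ v (*-monoʳ-≤ 4 57k₁≤ℓ) ⟩
      4 * ℓ * v                             ∎)
      where
      open ℕₚ.≤-Reasoning
      ring₁ : ∀ l k τ → 4 * l * (k * (l * l * l) * (6 * τ)) ≡ 6 * k * (4 * (l * l * (l * l)) * τ)
      ring₁ = solve-∀
      ring₂ : ∀ k v → 6 * k * (37 * v) ≡ 222 * k * v
      ring₂ = solve-∀
      ring₃ : ∀ k v → 228 * k * v ≡ 4 * (57 * k) * v
      ring₃ = solve-∀

    module _ {i j k : Fin t} (ijk : Distinct i j k)
             (Γij : Γ i j ≡ false) (Γik : Γ i k ≡ false) (Γjk : Γ j k ≡ false) (α β γ : Fin ℓ)
             (G : Graph n) (G-spec : ∀ x y → adj G x y ≡ pair i j α x y ∨ (pair i k β x y ∨ pair j k γ x y)) where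
      private
        open Triple ijk α β γ colour-sym G G-spec
        i≢j = proj₁ ijk
        i≢k = proj₁ (proj₂ ijk)
        j≢k = proj₂ (proj₂ ijk)
        Γji = trans (Γ-sym j i) Γij
        Γki = trans (Γ-sym k i) Γik
        Γkj = trans (Γ-sym k j) Γjk

      side : Bool → Fin n → Fin n → Fin n → Bool
      side e x y z = edge (K₃ G) x y z ∧ sel e (edge H x y z)

      private
        side-bound : ∀ e (J : Fin n → Fin n → Fin n → ℕ) →
          (∀ x y z → Link x y → Link x z → Link y z → sel e (edge H x y z) ≡ true →
            part x ≡ i → part y ≡ j → part z ≡ k → 1 ≤ J x y z) →
          triples (side e) ≤ 6 * ∑³ J
        side-bound e J J≥1 = triples≤6 part {i} {j} {k} (side e)
          (λ x y z → cong₂ (λ p q → p ∧ sel e q) (ThreeGraph.swap₁₂ (K₃ G) x y z) (ThreeGraph.swap₁₂ H x y z))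
          (λ x y z → cong₂ (λ p q → p ∧ sel e q) (ThreeGraph.swap₂₃ (K₃ G) x y z) (ThreeGraph.swap₂₃ H x y z))
          (λ x y z e′ → let l₁ , l₂ , l₃ = here e′ in link-≢ l₁ , link-≢ l₂ , link-≢ l₃)
          (λ x y z e′ → link-in (proj₁ (here e′)))
          J
          (λ x y z e′ px py pz → let l₁ , l₂ , l₃ = here e′ in
            J≥1 x y z l₁ l₂ l₃ (proj₂ (∧-true (edge (K₃ G) x y z) _ e′)) px py pz)
          where
          here : ∀ {x y z} → side e x y z ≡ true → Link x y × Link x z × Link y z
          here {x} {y} {z} e′ = links x y z (proj₁ (∧-true (edge (K₃ G) x y z) _ e′))

        empty : (∀ x y z → part x ≡ i → part y ≡ j → part z ≡ k → cylinder A E x y z ≡ false) →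
          K * triples (side true) ≤ s i * (s j * s k)
        empty none = ≤-trans (*-monoʳ-≤ K (side-bound true (λ _ _ _ → 0)
          (λ x y z _ _ _ e px py pz → contradiction (trans (sym e) (trans (H≡ x y z) (none x y z px py pz))) λ ())))
          (≤-trans (≤-reflexive (trans (cong (λ r → K * (6 * r)) zeros) (*-zeroʳ K))) z≤n)
          where
          zeros : ∑³ {n} (λ _ _ _ → 0) ≡ 0
          zeros = trans (sum-const n _) (trans (cong (n *_) (trans (sum-const n _)
            (trans (cong (n *_) (trans (sum-const n 0) (*-zeroʳ n))) (*-zeroʳ n)))) (*-zeroʳ n))

        via : ∀ e (J : Fin n → Fin n → Fin n → ℕ) {τ v} →
          triples (side e) ≤ 6 * ∑³ J → ∑³ J ≡ τ → 4 * (ℓ * ℓ * (ℓ * ℓ)) * τ ≤ 37 * v →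
          v ≡ s i * (s j * s k) → K * triples (side e) ≤ s i * (s j * s k)
        via e J {τ} bound refl le refl = ≤-trans (*-monoʳ-≤ K bound) (6tri-small {τ} le)

        all : ∀ {a b c d f g h : Bool} → a ≡ true → b ≡ true → c ≡ true → d ≡ true → f ≡ true → g ≡ true → h ≡ true →
          1 ≤ 𝟙 (a ∧ b ∧ c ∧ d ∧ f ∧ g ∧ h)
        all refl refl refl refl refl refl refl = s≤s z≤n

        is : ∀ {m} {a b : Fin m} → a ≡ b → does (a ≟ b) ≡ true
        is {a = a} {b} e = dec-true (a ≟ b) e

        flipped : ∀ {x y c} → colour x y ≡ c → does (colour y x ≟ c) ≡ true
        flipped {x} {y} e = is (trans (colour-sym y x) e)

        swap : ∀ e x y z {b} → sel e (edge H x y z) ≡ true → cylinder A E x y z ≡ b → sel e b ≡ true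
        swap e x y z se eq = trans (cong (sel e) (sym (trans (H≡ x y z) eq))) se

        -- With part `i` inside `A`, whether a triangle is an edge depends only on its pair opposite
        -- to `i`, of colour `γ`. The variants `apex₂` and `apex₃` read the same triad from `j` and
        -- from `k`, permuting the colours accordingly.
        apex₁ : typeOf i ≡ true → typeOf j ≡ false → typeOf k ≡ false →
          ∀ e → Sparse p ℓ E colour part e j k γ → K * triples (side e) ≤ s i * (s j * s k)
        apex₁ ti tj tk e sp = via e (ordered e i j k α β γ)
          (side-bound e (ordered e i j k α β γ) (λ x y z l₁ l₂ l₃ se px py pz →
            all (is px) (is py) (is pz) (is (link-ij l₁ px py)) (is (link-ik l₂ px pz))
              (swap e x y z se (cylinder₁ x y z (trans (typed Γij px) ti) (trans (typed Γjk py) tj) (trans (typed Γki pz) tk)))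
              (is (link-jk l₃ py pz))))
          (∑ordered e i j k α β γ)
          (tri≤ e i j k α β γ (proj₁ (good i j i≢j Γij α)) (proj₁ (good i k i≢k Γik β)) sp)
          refl

        apex₂ : typeOf i ≡ false → typeOf j ≡ true → typeOf k ≡ false →
          ∀ e → Sparse p ℓ E colour part e i k β → K * triples (side e) ≤ s i * (s j * s k)
        apex₂ ti tj tk e sp = via e (λ x y z → ordered e j i k α γ β y x z)
          (side-bound e (λ x y z → ordered e j i k α γ β y x z) (λ x y z l₁ l₂ l₃ se px py pz →
            all (is py) (is px) (is pz) (flipped (link-ij l₁ px py)) (is (link-jk l₃ py pz))
              (swap e x y z se (cylinder₂ x y z (trans (typed Γij px) ti) (trans (typed Γjk py) tj) (trans (typed Γki pz) tk)))
              (is (link-ik l₂ px pz))))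
          (trans (∑³-swap₁₂ (ordered e j i k α γ β)) (∑ordered e j i k α γ β))
          (tri≤ e j i k α γ β (proj₁ (good j i (i≢j ∘ sym) Γji α)) (proj₁ (good j k j≢k Γjk γ)) sp)
          (ring (s i) (s j) (s k))
          where
          ring : ∀ a b c → b * (a * c) ≡ a * (b * c)
          ring = solve-∀

        apex₃ : typeOf i ≡ false → typeOf j ≡ false → typeOf k ≡ true →
          ∀ e → Sparse p ℓ E colour part e i j α → K * triples (side e) ≤ s i * (s j * s k)
        apex₃ ti tj tk e sp = via e (λ x y z → ordered e k i j β γ α z x y)
          (side-bound e (λ x y z → ordered e k i j β γ α z x y) (λ x y z l₁ l₂ l₃ se px py pz →
            all (is pz) (is px) (is py) (flipped (link-ik l₂ px pz)) (flipped (link-jk l₃ py pz))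
              (swap e x y z se (cylinder₃ x y z (trans (typed Γij px) ti) (trans (typed Γjk py) tj) (trans (typed Γki pz) tk)))
              (is (link-ij l₁ px py))))
          (trans (∑³-swap₂₃ (λ x y z → ordered e k i j β γ α y x z))
            (trans (∑³-swap₁₂ (ordered e k i j β γ α)) (∑ordered e k i j β γ α)))
          (tri≤ e k i j β γ α (proj₁ (good k i (i≢k ∘ sym) Γki β)) (proj₁ (good k j (j≢k ∘ sym) Γkj γ)) sp)
          (ring (s i) (s j) (s k))
          where
          ring : ∀ a b c → c * (a * b) ≡ a * (b * c)
          ring = solve-∀

        pick : {P : Bool → Set} {B : Bool → Set} → (∀ e → P e → B e) → P true ⊎ P false → ∃[ e ] B e
        pick f = [ (λ q → true , f true q) , (λ q → false , f false q) ]′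

      -- Edges of `A × E` have exactly one vertex in `A`. If exactly one of the three parts lies in
      -- `A`, the sparse side of the opposite colour decides `e`; otherwise there are no edges at
      -- all.
      minority : ∃[ e ] K * triples (side e) ≤ s i * (s j * s k)
      minority = go (typeOf i) (typeOf j) (typeOf k) refl refl refl
        where
        go : ∀ a b c → typeOf i ≡ a → typeOf j ≡ b → typeOf k ≡ c → ∃[ e ] K * triples (side e) ≤ s i * (s j * s k)
        go true  false false ti tj tk = pick (apex₁ ti tj tk) (proj₂ (good j k j≢k Γjk γ))
        go false true  false ti tj tk = pick (apex₂ ti tj tk) (proj₂ (good i k i≢k Γik β))
        go false false true  ti tj tk = pick (apex₃ ti tj tk) (proj₂ (good i j i≢j Γij α))
        go false false false ti tj tk = true , empty (λ x y z px py pz →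
          cylinder₀ x y z (trans (typed Γij px) ti) (trans (typed Γjk py) tj) (trans (typed Γki pz) tk))
        go true  true  _     ti tj tk = true , empty (λ x y z px py pz →
          cylinder₁₂ x y z (trans (typed Γij px) ti) (trans (typed Γjk py) tj))
        go true  false true  ti tj tk = true , empty (λ x y z px py pz →
          cylinder₁₃ x y z (trans (typed Γij px) ti) (trans (typed Γki pz) tk))
        go false true  true  ti tj tk = true , empty (λ x y z px py pz →
          cylinder₂₃ x y z (trans (typed Γjk py) tj) (trans (typed Γki pz) tk))

-- The decomposition

reciprocal-pos : ∀ ℓ .{{_ : NonZero ℓ}} → 0ℚ ℚ.< + 1 ℚ./ ℓ
reciprocal-pos ℓ = ℚₚ.≰⇒> (λ d≤0 → 1≰0 (ℚₚ.≤-trans (ℚₚ.≤-reflexive (ratio-* 1 ℓ))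
  (ℚₚ.≤-trans (ℚₚ.*-monoʳ-≤-nonNeg (↑ ℓ) {{↑-nonNeg ℓ}} d≤0) (ℚₚ.≤-reflexive (ℚₚ.*-zeroˡ (↑ ℓ))))))

reciprocal≤1 : ∀ ℓ .{{_ : NonZero ℓ}} → + 1 ℚ./ ℓ ℚ.≤ 1ℚ
reciprocal≤1 ℓ = ℚₚ.*-cancelʳ-≤-pos (↑ ℓ) {{↑-pos ℓ}} (ℚₚ.≤-trans (ℚₚ.≤-reflexive (sym (ratio-* 1 ℓ)))
  (ℚₚ.≤-trans (↑-mono (n≢0⇒n>0 (ℕ.≢-nonZero⁻¹ ℓ))) (ℚₚ.≤-reflexive (sym (ℚₚ.*-identityˡ (↑ ℓ))))))

-- The factor `d₂³` in the error of `disc₂,₃`, with `d₂ = 1/ℓ`, turns `k` into `k ℓ³`.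
cube-scale : ∀ {ε k} ℓ .{{_ : NonZero ℓ}} → ↑ 1 ℚ.≤ ε ℚ.* ↑ k →
  ↑ 1 ℚ.≤ ε ℚ.* ((+ 1 ℚ./ ℓ) ℚ.* (+ 1 ℚ./ ℓ) ℚ.* (+ 1 ℚ./ ℓ)) ℚ.* ↑ (k * (ℓ * ℓ * ℓ))
cube-scale {ε} {k} ℓ 1≤εk = subst (↑ 1 ℚ.≤_) (sym eq) 1≤εk
  where
  d = + 1 ℚ./ ℓ
  open +-*-Solver
  eq : ε ℚ.* (d ℚ.* d ℚ.* d) ℚ.* ↑ (k * (ℓ * ℓ * ℓ)) ≡ ε ℚ.* ↑ k
  eq = trans (cong (ε ℚ.* (d ℚ.* d ℚ.* d) ℚ.*_)
      (trans (↑-* k (ℓ * ℓ * ℓ)) (cong (↑ k ℚ.*_) (trans (↑-* (ℓ * ℓ) ℓ) (cong (ℚ._* ↑ ℓ) (↑-* ℓ ℓ))))))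
    (trans (solve 4 (λ e d k l → e :* (d :* d :* d) :* (k :* (l :* l :* l)) := e :* k :* ((d :* l) :* (d :* l) :* (d :* l))) refl ε d (↑ k) (↑ ℓ))
      (trans (cong (λ s → ε ℚ.* ↑ k ℚ.* (s ℚ.* s ℚ.* s)) (sym (ratio-* 1 ℓ))) (ℚₚ.*-identityʳ (ε ℚ.* ↑ k))))

does-sym : (x y : Fin n) → not (does (x ≟ y)) ≡ not (does (y ≟ x))
does-sym x y with x ≟ y | y ≟ x
... | yes _ | yes _ = refl
... | no  _ | no  _ = refl
... | yes p | no  q = contradiction (sym p) q
... | no  p | yes q = contradiction (sym q) p

fromRelation : (R : Fin n → Fin n → Bool) → (∀ x y → R x y ≡ R y x) → Graph n
fromRelation R R-sym = record
  { adj     = λ x y → not (does (x ≟ y)) ∧ R x y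
  ; adj-sym = λ x y → cong₂ _∧_ (does-sym x y) (R-sym x y)
  ; irrefl  = λ x → cong (λ b → not b ∧ R x x) (dec-true (x ≟ x) refl)
  }

_∖³_ : ThreeGraph n → ThreeGraph n → ThreeGraph n
H ∖³ H′ = record
  { edge   = λ x y z → edge H x y z ∧ not (edge H′ x y z)
  ; swap₁₂ = λ x y z → cong₂ _∧_ (ThreeGraph.swap₁₂ H x y z) (cong not (ThreeGraph.swap₁₂ H′ x y z))
  ; swap₂₃ = λ x y z → cong₂ _∧_ (ThreeGraph.swap₂₃ H x y z) (cong not (ThreeGraph.swap₂₃ H′ x y z))
  ; irrefl = λ x z → cong (_∧ not (edge H′ x x z)) (ThreeGraph.irrefl H x z)
  }

not-true : ∀ b → not b ≡ true → b ≡ false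
not-true false _ = refl

module Decompose {n t : ℕ} (k₁ k₂ ℓ : ℕ) .{{_ : NonZero k₁}} .{{k₂≢0 : NonZero k₂}} .{{ℓ≢0 : NonZero ℓ}} (57k₁≤ℓ : 57 * k₁ ≤ ℓ)
    {ε₁ ε₂ : ℚ} (1≤ε₁k₁ : ↑ 1 ℚ.≤ ε₁ ℚ.* ↑ k₁) (1≤ε₂k₂ : ↑ 1 ℚ.≤ ε₂ ℚ.* ↑ k₂)
    (A : Fin n → Bool) (E : Fin n → Fin n → Bool)
    (E-sym : ∀ x y → E x y ≡ E y x) (E⇒¬A : ∀ x y → E x y ≡ true → A x ≡ false)
    (H : ThreeGraph n) (H≡ : ∀ x y z → edge H x y z ≡ cylinder A E x y z)
    (C : Coloured (2 * (k₂ * (ℓ * ℓ * ℓ))) ℓ (54 * k₁) A E t)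
    (h≤t : 54 * k₁ ≤ t) (1≤t : 1 ≤ t) (2t≤n : 2 * t ≤ n) where

  open Coloured C
  open Parts part colour

  private
    p h : ℕ
    p = 2 * (k₂ * (ℓ * ℓ * ℓ))
    h = 54 * k₁
    s : Fin t → ℕ
    s = size part

    instance
      ℓ³≢0 : NonZero (ℓ * ℓ * ℓ)
      ℓ³≢0 = m*n≢0 (ℓ * ℓ) ℓ {{m*n≢0 ℓ ℓ}}
      t≢0 : NonZero t
      t≢0 = >-nonZero 1≤t
      p≢0 : NonZero p
      p≢0 = m*n≢0 2 (k₂ * (ℓ * ℓ * ℓ)) {{_}} {{m*n≢0 k₂ (ℓ * ℓ * ℓ)}}

    ℓ³≤p : ℓ * ℓ * ℓ ≤ p
    ℓ³≤p = ≤-trans (m≤n*m (ℓ * ℓ * ℓ) k₂) (m≤n*m (k₂ * (ℓ * ℓ * ℓ)) 2)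

    1≤size : ∀ i → 1 ≤ s i
    1≤size i = ℕₚ.≤-pred (*-cancelˡ-≤ t (≤-trans (≤-reflexive (*-comm t 2)) (≤-trans 2t≤n (size-lower equitable i))))

    inhabited : ∀ i → ∃[ x ] part x ≡ i
    inhabited i = size>0⇒inhabited part i (1≤size i)

    #V : ∀ i → # (lookup (V i)) ≡ s i
    #V i = sum-cong-≗ {n} (λ x → cong 𝟙 (V-cell i x))

    cardV : ∀ i → card (V i) ≡ s i
    cardV i = trans (card≡# (V i)) (#V i)

    into-cell : ∀ {i} {U : Fin n → Bool} → U ⊆ᴮ lookup (V i) → U ⊆ᴮ cell part i
    into-cell {i} U⊆ x e = trans (sym (V-cell i x)) (U⊆ x e)

  pair-disc : ∀ {i j} → i ≢ j → Γ i j ≡ false → ∀ α (G : Graph n) → (∀ x y → adj G x y ≡ pair i j α x y) →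
    disc₂-at ε₂ (+ 1 ℚ./ ℓ) (V i) (V j) G
  pair-disc {i} {j} i≢j Γij α G spec = disc₂-at-uniform p k₂ (ℓ * ℓ * ℓ) ℓ refl {ε₂} 1≤ε₂k₂
    (subst NonZero (sym (cong₂ _*_ (#V i) (#V j))) (>-nonZero (*-mono-≤ (1≤size i) (1≤size j))))
    (λ {U′} {W′} U⊆ W⊆ → subst (λ m → p * (ℓ * cnt U′ W′ φ) ≤ p * (# U′ * # W′) + m × p * (# U′ * # W′) ≤ p * (ℓ * cnt U′ W′ φ) + m)
      (sym (cong₂ _*_ (#V i) (#V j))) (proj₁ (good i j i≢j Γij α) (into-cell {i} U⊆) (into-cell {j} W⊆)))
    where
    φ : Fin n → Fin n → Bool
    φ x y = does (colour x y ≟ α)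
    open Bipartite (V i) (V j) G φ
      (λ x p q → i≢j (trans (sym (V⇒≡ i x p)) (V⇒≡ j x q)))
      (λ x y p q → trans (spec x y) (cong (_∧ φ x y) (parts⇒K₂ x y i≢j (V⇒≡ i x p) (V⇒≡ j y q))))
      (λ x y e → [ (λ (p , q) → inj₁ (≡⇒V i x p , ≡⇒V j y q)) , (λ (p , q) → inj₂ (≡⇒V j x p , ≡⇒V i y q)) ]′
        (proj₁ (pair⇒ i j α x y (trans (sym (spec x y)) e))))

  triad-disc : ∀ {i j k} → Distinct i j k → Γ i j ≡ false → Γ i k ≡ false → Γ j k ≡ false → ∀ α β γ →
    (G : Graph n) → (∀ x y → adj G x y ≡ pair i j α x y ∨ (pair i k β x y ∨ pair j k γ x y)) →
    disc₂,₃ ε₁ ε₂ (V i) (V j) (V k) G (H ∩³ K₃ G)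
  triad-disc {i} {j} {k} ijk Γij Γik Γjk α β γ G spec =
    let e , few = minority
        d₃ , F≡ , close = one-sided H G {ε₁ ℚ.* (d₂ ℚ.* d₂ ℚ.* d₂)} {k₁ * (ℓ * ℓ * ℓ)} {card (V i) * card (V j) * card (V k)} (cube-scale {ε₁} {k₁} ℓ 1≤ε₁k₁) e
          (≤-trans few (≤-reflexive volume))
        same-ij , same-ik , same-jk = triad-pairs
    in d₃ , F≡ , + 1 ℚ./ ℓ , reciprocal-pos ℓ , reciprocal≤1 ℓ
     , pair-disc (proj₁ ijk) Γij α (G [ V i , V j ]) same-ij
     , pair-disc (proj₁ (proj₂ ijk)) Γik β (G [ V i , V k ]) same-ik
     , pair-disc (proj₂ (proj₂ ijk)) Γjk γ (G [ V j , V k ]) same-jk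
     , close
    where
    d₂ = + 1 ℚ./ ℓ
    open Triple ijk α β γ colour-sym G spec
    open Minority A E E-sym E⇒¬A k₁ p ℓ h 57k₁≤ℓ ℓ³≤p H H≡ C inhabited using ()
      renaming (minority to minority′)
    minority = minority′ ijk Γij Γik Γjk α β γ G spec
    volume : s i * (s j * s k) ≡ card (V i) * card (V j) * card (V k)
    volume = trans (sym (*-assoc (s i) (s j) (s k)))
      (sym (cong₂ _*_ (cong₂ _*_ (cardV i) (cardV j)) (cardV k)))

  goodPair : Fin n → Fin n → Bool
  goodPair x y = not (does (part x ≟ part y)) ∧ not (Γ (part x) (part y))

  goodGraph completeGraph : Graph n
  goodGraph = fromRelation goodPair (λ x y → cong₂ _∧_ (does-sym (part x) (part y)) (cong not (Γ-sym (part x) (part y))))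
  completeGraph = fromRelation (λ _ _ → true) (λ _ _ → refl)

  -- The triples with two vertices in one part or across a pair in `Γ`; the complete graph restricts
  -- to distinct vertices.
  exceptional : ThreeGraph n
  exceptional = K₃ completeGraph ∖³ K₃ goodGraph

  badPair : Fin n → Fin n → Bool
  badPair x y = does (part x ≟ part y) ∨ Γ (part x) (part y)

  private
    B : ℕ
    B = ∑[ x < n ] ∑[ y < n ] 𝟙 (badPair x y)

    #Γ-sum : ℕ
    #Γ-sum = ∑[ i < t ] ∑[ j < t ] 𝟙 (Γ i j)

    -- A vertex shares its part with at most `2n/t` vertices, and `h ≤ t`.
    same-part : h * ∑[ x < n ] ∑[ y < n ] 𝟙 (does (part x ≟ part y)) ≤ 2 * (n * n)
    same-part = begin
      h * ∑[ x < n ] ∑[ y < n ] 𝟙 (does (part x ≟ part y))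
        ≤⟨ *-mono-≤ h≤t (sum₂-mono (λ x y → 𝟙-mono (part x ≟ part y) (part y ≟ part x) sym)) ⟩
      t * ∑[ x < n ] s (part x)
        ≡⟨ *-distribˡ-sum t (λ x → s (part x)) ⟩
      ∑[ x < n ] (t * s (part x))
        ≤⟨ sum-bound {n} (λ x → size-upper equitable (part x)) ⟩
      n * (n + t)
        ≤⟨ *-monoʳ-≤ n (+-monoʳ-≤ n (≤-trans (m≤n*m t 2) 2t≤n)) ⟩
      n * (n + n)
        ≡⟨ ring n ⟩
      2 * (n * n) ∎
      where
      open ℕₚ.≤-Reasoning
      ring : ∀ n → n * (n + n) ≡ 2 * (n * n)
      ring = solve-∀

    -- At most `4t²/h` pairs of parts are in `Γ`, each with at most `(2n/t)²` pairs of vertices.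
    Γ-pairs : h * ∑[ x < n ] ∑[ y < n ] 𝟙 (Γ (part x) (part y)) ≤ 16 * (n * n)
    Γ-pairs = *-cancelˡ-≤ (t * t) {{m*n≢0 t t}} (begin
      t * t * (h * ∑[ x < n ] ∑[ y < n ] 𝟙 (Γ (part x) (part y)))
        ≡⟨ ring₁ (t * t) h _ ⟩
      h * (t * t * ∑[ x < n ] ∑[ y < n ] 𝟙 (Γ (part x) (part y)))
        ≡⟨ cong (λ q → h * (t * t * q)) by-cells ⟩
      h * (t * t * ∑[ i < t ] ∑[ j < t ] (s i * s j * 𝟙 (Γ i j)))
        ≡⟨ cong (h *_) (trans (*-distribˡ-sum (t * t) (λ i → ∑[ j < t ] (s i * s j * 𝟙 (Γ i j))))
             (sum-cong-≗ {t} (λ i → *-distribˡ-sum (t * t) (λ j → s i * s j * 𝟙 (Γ i j))))) ⟩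
      h * ∑[ i < t ] ∑[ j < t ] (t * t * (s i * s j * 𝟙 (Γ i j)))
        ≤⟨ *-monoʳ-≤ h (sum₂-mono (λ i j → ≤-trans (≤-reflexive (ring₂ t (s i) (s j) (𝟙 (Γ i j))))
             (*-monoˡ-≤ (𝟙 (Γ i j)) (*-mono-≤ (ts≤2n i) (ts≤2n j))))) ⟩
      h * ∑[ i < t ] ∑[ j < t ] (2 * n * (2 * n) * 𝟙 (Γ i j))
        ≡⟨ cong (h *_) (sym (trans (*-distribˡ-sum (2 * n * (2 * n)) (λ i → ∑[ j < t ] 𝟙 (Γ i j)))
             (sum-cong-≗ {t} (λ i → *-distribˡ-sum (2 * n * (2 * n)) (λ j → 𝟙 (Γ i j)))))) ⟩
      h * (2 * n * (2 * n) * #Γ-sum)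
        ≡⟨ ring₁ h (2 * n * (2 * n)) #Γ-sum ⟩
      2 * n * (2 * n) * (h * #Γ-sum)
        ≤⟨ *-monoʳ-≤ (2 * n * (2 * n)) #Γ ⟩
      2 * n * (2 * n) * (4 * (t * t))
        ≡⟨ ring₃ n (t * t) ⟩
      t * t * (16 * (n * n)) ∎)
      where
      open ℕₚ.≤-Reasoning
      ring₁ : ∀ a b c → a * (b * c) ≡ b * (a * c)
      ring₁ = solve-∀
      ring₂ : ∀ t a b g → t * t * (a * b * g) ≡ t * a * (t * b) * g
      ring₂ = solve-∀
      ring₃ : ∀ n w → 2 * n * (2 * n) * (4 * w) ≡ w * (16 * (n * n))
      ring₃ = solve-∀
      ts≤2n : ∀ i → t * s i ≤ 2 * n
      ts≤2n i = ≤-trans (size-upper equitable i) (≤-trans (+-monoʳ-≤ n (≤-trans (m≤n*m t 2) 2t≤n))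
        (≤-reflexive (cong (λ q → n + q) (sym (+-identityʳ n)))))
      by-cells : ∑[ x < n ] ∑[ y < n ] 𝟙 (Γ (part x) (part y)) ≡ ∑[ i < t ] ∑[ j < t ] (s i * s j * 𝟙 (Γ i j))
      by-cells = trans (sum-fibre₂ part part (λ i j _ _ → 𝟙 (Γ i j)))
        (sum₂-cong (λ i j → trans (sum₂-cong (λ x y → sym (*-assoc (𝟙 (cell part i x)) (𝟙 (cell part j y)) (𝟙 (Γ i j)))))
          (trans (sum-cong-≗ {n} (λ x → sym (*-distribʳ-sum (𝟙 (Γ i j)) (λ y → 𝟙 (cell part i x) * 𝟙 (cell part j y)))))
            (trans (sym (*-distribʳ-sum (𝟙 (Γ i j)) (λ x → ∑[ y < n ] (𝟙 (cell part i x) * 𝟙 (cell part j y)))))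
              (cong (_* 𝟙 (Γ i j)) (sum-∑∑ (𝟙 ∘ cell part i) (𝟙 ∘ cell part j)))))))

    hB≤ : h * B ≤ 18 * (n * n)
    hB≤ = begin
      h * B
        ≤⟨ *-monoʳ-≤ h (sum₂-mono (λ x y → 𝟙-∨ (does (part x ≟ part y)) (Γ (part x) (part y)))) ⟩
      h * ∑[ x < n ] ∑[ y < n ] (𝟙 (does (part x ≟ part y)) + 𝟙 (Γ (part x) (part y)))
        ≡⟨ trans (cong (h *_) (sum₂-distrib-+ (λ x y → 𝟙 (does (part x ≟ part y))) _)) (*-distribˡ-+ h _ _) ⟩
      h * ∑[ x < n ] ∑[ y < n ] 𝟙 (does (part x ≟ part y)) + h * ∑[ x < n ] ∑[ y < n ] 𝟙 (Γ (part x) (part y))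
        ≤⟨ +-mono-≤ same-part Γ-pairs ⟩
      2 * (n * n) + 16 * (n * n)
        ≡⟨ ring (n * n) ⟩
      18 * (n * n) ∎
      where
      open ℕₚ.≤-Reasoning
      ring : ∀ w → 2 * w + 16 * w ≡ 18 * w
      ring = solve-∀

    exceptional≤ : tripleCount exceptional ≤ 3 * (n * B)
    exceptional≤ = begin
      tripleCount exceptional
        ≤⟨ triples≤∑³ (edge exceptional) ⟩
      ∑³ (λ x y z → 𝟙 (edge exceptional x y z))
        ≤⟨ ∑³-mono pointwise ⟩
      ∑³ (λ x y z → β x y + (β x z + β y z))
        ≡⟨ trans (∑³-+ (λ x y z → β x y) _) (cong₂ _+_ last (trans (∑³-+ (λ x y z → β x z) _) (cong₂ _+_ middle first))) ⟩
      n * B + (n * B + n * B)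
        ≡⟨ ring (n * B) ⟩
      3 * (n * B) ∎
      where
      open ℕₚ.≤-Reasoning
      ring : ∀ w → w + (w + w) ≡ 3 * w
      ring = solve-∀
      β : Fin n → Fin n → ℕ
      β x y = 𝟙 (badPair x y)
      first : ∑³ {n} (λ x y z → β y z) ≡ n * B
      first = sum-const n B
      middle : ∑³ {n} (λ x y z → β x z) ≡ n * B
      middle = trans (∑³-swap₁₂ (λ x y z → β y z)) first
      last : ∑³ {n} (λ x y z → β x y) ≡ n * B
      last = trans (∑³-swap₂₃ (λ x y z → β x z)) middle
      triangle : ∀ a b c d e f g h i → 𝟙 ((not a ∧ true) ∧ ((not b ∧ true) ∧ (not c ∧ true)) ∧
          not ((not a ∧ (not d ∧ not e)) ∧ ((not b ∧ (not f ∧ not g)) ∧ (not c ∧ (not h ∧ not i)))))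
        ≤ 𝟙 (d ∨ e) + (𝟙 (f ∨ g) + 𝟙 (h ∨ i))
      triangle true  b     c     d e f g h i = z≤n
      triangle false true  c     d e f g h i = z≤n
      triangle false false true  d e f g h i = z≤n
      triangle false false false true  e     f g h i = s≤s z≤n
      triangle false false false false true  f g h i = s≤s z≤n
      triangle false false false false false true  g h i = s≤s z≤n
      triangle false false false false false false true  h i = s≤s z≤n
      triangle false false false false false false false true  i = s≤s z≤n
      triangle false false false false false false false false true = s≤s z≤n
      triangle false false false false false false false false false = z≤n
      reassoc : ∀ a b c → 𝟙 ((a ∧ b) ∧ c) ≡ 𝟙 (a ∧ b ∧ c)
      reassoc a b c = cong 𝟙 (𝔹ₚ.∧-assoc a b c)
      pointwise : ∀ x y z → 𝟙 (edge exceptional x y z) ≤ β x y + (β x z + β y z)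
      pointwise x y z = ≤-trans (≤-reflexive (reassoc (not (does (x ≟ y)) ∧ true) _ _))
        (triangle (does (x ≟ y)) (does (x ≟ z)) (does (y ≟ z))
          (does (part x ≟ part y)) (Γ (part x) (part y)) (does (part x ≟ part z)) (Γ (part x) (part z))
          (does (part y ≟ part z)) (Γ (part y) (part z)))

    -- An exceptional triple contains one of `B ≤ 18 n²/h` bad pairs, in one of three positions; 3
    -- times 18 explains the 54 in `h`.
    few : k₁ * tripleCount exceptional ≤ n ^ 3
    few = *-cancelˡ-≤ 54 (begin
      54 * (k₁ * tripleCount exceptional)   ≡⟨ *-assoc 54 k₁ _ ⟨
      h * tripleCount exceptional           ≤⟨ *-monoʳ-≤ h exceptional≤ ⟩
      h * (3 * (n * B))                     ≡⟨ ring₁ h n B ⟩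
      3 * n * (h * B)                       ≤⟨ *-monoʳ-≤ (3 * n) hB≤ ⟩
      3 * n * (18 * (n * n))                ≡⟨ ring₂ n ⟩
      54 * n ^ 3                            ∎)
      where
      open ℕₚ.≤-Reasoning
      ring₁ : ∀ h n B → h * (3 * (n * B)) ≡ 3 * n * (h * B)
      ring₁ = solve-∀
      ring₂ : ∀ n → 3 * n * (18 * (n * n)) ≡ 54 * (n * (n * (n * 1)))
      ring₂ = solve-∀

  ΓGraph : Graph t
  ΓGraph = fromRelation Γ Γ-sym

  Γ-few : ↑ (edgeCount ΓGraph) ℚ.≤ ε₁ ℚ.* ↑ (t ^ 2)
  Γ-few = scale≤ {ε₁} {k₁} {edgeCount ΓGraph} {t ^ 2} 1≤ε₁k₁ (*-cancelˡ-≤ 54 (begin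
    54 * (k₁ * edgeCount ΓGraph)   ≡⟨ *-assoc 54 k₁ _ ⟨
    h * edgeCount ΓGraph           ≤⟨ *-monoʳ-≤ h (sum₂-mono (λ i j → drop (does (i <? j)) (not (does (i ≟ j))) (Γ i j))) ⟩
    h * #Γ-sum                     ≤⟨ #Γ ⟩
    4 * (t * t)                    ≤⟨ *-monoˡ-≤ (t * t) (m≤m+n 4 50) ⟩
    54 * (t * t)                   ≡⟨ cong (λ q → 54 * (t * q)) (*-identityʳ t) ⟨
    54 * t ^ 2                     ∎))
    where
    open ℕₚ.≤-Reasoning
    drop : ∀ a b c → 𝟙 (a ∧ (b ∧ c)) ≤ 𝟙 c
    drop false b     c = z≤n
    drop true  false c = z≤n
    drop true  true  c = ℕₚ.≤-refl

  private
    goodGraph⇒ : ∀ {x y} → adj goodGraph x y ≡ true → part x ≢ part y × Γ (part x) (part y) ≡ false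
    goodGraph⇒ {x} {y} e =
      let p , q = ∧-true (not (does (part x ≟ part y))) _ (proj₂ (∧-true (not (does (x ≟ y))) _ e))
      in does⇒¬ (part x ≟ part y) (not-true _ p) , not-true _ q

    ordinary : ∀ x y z → Distinct x y z → edge exceptional x y z ≡ false →
      adj goodGraph x y ≡ true × adj goodGraph x z ≡ true × adj goodGraph y z ≡ true
    ordinary x y z (xy , xz , yz) e =
      let g = unnegate (edge (K₃ goodGraph) x y z) complete e
          p , q = ∧-true (adj goodGraph x y) _ g
      in p , ∧-true (adj goodGraph x z) _ q
      where
      unnegate : ∀ b {a} → a ≡ true → a ∧ not b ≡ false → b ≡ true
      unnegate true  _    _ = refl
      unnegate false refl ()
      distinct : ∀ {u v} → u ≢ v → adj completeGraph u v ≡ true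
      distinct {u} {v} u≢v = cong (λ b → not b ∧ true) (dec-false (u ≟ v) u≢v)
      complete : edge (K₃ completeGraph) x y z ≡ true
      complete = cong₂ _∧_ (distinct xy) (cong₂ _∧_ (distinct xz) (distinct yz))

    in-pair : ∀ {x y} → part x ≢ part y → pair (part x) (part y) (colour x y) x y ≡ true
    in-pair {x} {y} apart = cong₂ _∧_ (parts⇒K₂ x y apart refl refl) (dec-true (colour x y ≟ colour x y) refl)

  -- A copy of the graph `P` of the decomposition, available while that record is still being built.
  pairGraph : Fin t → Fin t → Fin ℓ → Graph n
  pairGraph i j α = record
    { adj     = pair i j α
    ; adj-sym = λ x y → cong₂ _∧_ (Graph.adj-sym (K₂ (V i) (V j)) x y) (cong (λ χ → does (χ ≟ α)) (colour-sym x y))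
    ; irrefl  = λ x → cong (_∧ does (colour x x ≟ α)) (Graph.irrefl (K₂ (V i) (V j)) x)
    }

  decomposition : Decomposition n t ℓ ε₁ ε₂
  decomposition = record
    { part = part
    ; colour = colour
    ; colour-sym = colour-sym
    ; sorted = λ i j i≤j → subst₂ _≤_ (sym (cardV i)) (sym (cardV j)) (Equitable.sorted equitable i j i≤j)
    ; balanced = λ i j → subst₂ _≤_ (sym (cardV j)) (cong suc (sym (cardV i))) (Equitable.balanced equitable i j)
    ; exceptional = exceptional
    ; fewExceptions = scale≤ {ε₁} {k₁} {tripleCount exceptional} {n ^ 3} 1≤ε₁k₁ few
    ; regular = λ x y z xyz e →
        let g₁ , g₂ , g₃ = ordinary x y z xyz e
            n₁ , Γ₁ = goodGraph⇒ g₁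
            n₂ , Γ₂ = goodGraph⇒ g₂
            n₃ , Γ₃ = goodGraph⇒ g₃
        in part x , part y , part z , (n₁ , n₂ , n₃) , colour x y , colour x z , colour y z
         , (in-pair n₁ , in-pair n₂ , in-pair n₃)
         , ( pair-disc n₁ Γ₁ (colour x y) (pairGraph (part x) (part y) (colour x y)) (λ _ _ → refl)
           , pair-disc n₂ Γ₂ (colour x z) (pairGraph (part x) (part z) (colour x z)) (λ _ _ → refl)
           , pair-disc n₃ Γ₃ (colour y z) (pairGraph (part y) (part z) (colour y z)) (λ _ _ → refl) )
    }

  triads-disc : ∀ i j k → Distinct i j k →
    adj ΓGraph i j ≡ false → adj ΓGraph i k ≡ false → adj ΓGraph j k ≡ false →
    ∀ α β γ → Decomposition.TriadDisc decomposition H i j k α β γ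
  triads-disc i j k ijk@(ij , ik , jk) e₁ e₂ e₃ α β γ =
    triad-disc ijk (nonadjacent ij e₁) (nonadjacent ik e₂) (nonadjacent jk e₃) α β γ (Decomposition.triad decomposition i j k α β γ) (λ _ _ → refl)
    where
    nonadjacent : ∀ {i j} → i ≢ j → adj ΓGraph i j ≡ false → Γ i j ≡ false
    nonadjacent {i} {j} i≢j e = trans (cong (λ b → not b ∧ Γ i j) (sym (dec-false (i ≟ j) i≢j))) e

-- The 3-graphs A × E, for a vertex set A and a graph E on the other vertices.
Cylindrical : ThreeGraph n → Set
Cylindrical {n} H = Σ[ A ∈ (Fin n → Bool) ] Σ[ E ∈ (Fin n → Fin n → Bool) ]
  (∀ x y → E x y ≡ E y x) × (∀ x y → E x y ≡ true → A x ≡ false) ×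
  (∀ x y z → edge H x y z ≡ cylinder A E x y z)

pullback : ∀ {m n} {H : ThreeGraph m} {H′ : ThreeGraph n} (φ : Fin m → Fin n) →
  (∀ x y z → edge H x y z ≡ edge H′ (φ x) (φ y) (φ z)) → Cylindrical H′ → Cylindrical H
pullback φ H≡ (A , E , E-sym , E⇒¬A , H′≡) =
  A ∘ φ , (λ x y → E (φ x) (φ y)) , (λ x y → E-sym (φ x) (φ y)) , (λ x y → E⇒¬A (φ x) (φ y))
  , λ x y z → trans (H≡ x y z) (H′≡ (φ x) (φ y) (φ z))

cylinders : HereditaryProperty
cylinders = record
  { Member         = Cylindrical
  ; closed-≅       = λ {_} {_} {H} {H′} (f , H≡) → pullback {H = H′} {H} (Inverse.from f) (λ x y z →
      trans (sym (cong₂ (λ u (v , w) → edge H′ u v w) (Inverse.strictlyInverseˡ f x)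
        (cong₂ _,_ (Inverse.strictlyInverseˡ f y) (Inverse.strictlyInverseˡ f z))))
        (sym (H≡ (Inverse.from f x) (Inverse.from f y) (Inverse.from f z))))
  ; closed-induced = λ {_} {_} {H} {H′} (f , H≡) → pullback {H = H} {H′} (Injection.to f) H≡
  }

cylinders-admit : AdmitsBinaryDisc₂,₃Error cylinders
cylinders-admit t₀ ℓ₀ t₀≥1 ℓ₀≥1 ε₁ ε₁>0 ε₂ ε₂-range = N , T , ℓ₁ , λ {n} H → decompose H
  where
  k₁ ℓ₁ k₂ t₀′ : ℕ
  k₁ = suc (proj₁ (archimedean ε₁ ε₁>0))
  -- The same number of colours serves all 3-graphs, so `ℓ₁` is also the upper bound `L`.
  ℓ₁ = ℓ₀ + 57 * k₁
  -- As `ℓ₁` is fixed already, `ε₂` is needed at this one value only.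
  k₂ = suc (proj₁ (archimedean (ε₂ ℓ₁) (proj₁ (ε₂-range ℓ₁))))
  -- The extra parts give `h ≤ t`, which makes pairs inside a part rare.
  t₀′ = t₀ + 54 * k₁
  instance
    ℓ≢0 : NonZero ℓ₁
    ℓ≢0 = >-nonZero (≤-trans ℓ₀≥1 (m≤m+n ℓ₀ (57 * k₁)))
    p≢0 : NonZero (2 * (k₂ * (ℓ₁ * ℓ₁ * ℓ₁)))
    p≢0 = m*n≢0 2 (k₂ * (ℓ₁ * ℓ₁ * ℓ₁)) {{_}} {{m*n≢0 k₂ (ℓ₁ * ℓ₁ * ℓ₁) {{_}} {{m*n≢0 (ℓ₁ * ℓ₁) ℓ₁ {{m*n≢0 ℓ₁ ℓ₁}}}}}}
    h≢0 : NonZero (54 * k₁)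
    h≢0 = m*n≢0 54 k₁
  open Construct t₀′ (2 * (k₂ * (ℓ₁ * ℓ₁ * ℓ₁))) ℓ₁ (54 * k₁) using (N; T; colouredPartition)
  decompose : ∀ {n} (H : ThreeGraph n) → Cylindrical H → n ≥ N →
    ∃[ t ] ∃[ ℓ′ ] (t₀ ≤ t × t ≤ T) × (ℓ₀ ≤ ℓ′ × ℓ′ ≤ ℓ₁) ×
    (Σ[ 𝓟 ∈ Decomposition n t ℓ′ ε₁ (ε₂ ℓ′) ] Σ[ Γ ∈ Graph t ]
      ↑ (edgeCount Γ) ℚ.≤ ε₁ ℚ.* ↑ (t ^ 2) ×
      (∀ i j k → Distinct i j k →
        adj Γ i j ≡ false → adj Γ i k ≡ false → adj Γ j k ≡ false →
        ∀ α β γ → Decomposition.TriadDisc 𝓟 H i j k α β γ))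
  decompose H (A , E , E-sym , E⇒¬A , H≡) n≥N =
    let t , (t₀′≤t , t≤T , 2t≤n) , C = colouredPartition n≥N A E E-sym
        t₀≤t = ≤-trans (m≤m+n t₀ (54 * k₁)) t₀′≤t
        open Decompose k₁ k₂ ℓ₁ (m≤n+m (57 * k₁) ℓ₀) {ε₁} {ε₂ ℓ₁} (proj₂ (archimedean ε₁ ε₁>0))
          (proj₂ (archimedean (ε₂ ℓ₁) (proj₁ (ε₂-range ℓ₁)))) A E E-sym E⇒¬A H H≡ C
          (≤-trans (m≤n+m (54 * k₁) t₀) t₀′≤t) (≤-trans t₀≥1 t₀≤t) 2t≤n
    in t , ℓ₁ , (t₀≤t , t≤T) , (m≤m+n ℓ₀ (57 * k₁) , ℕₚ.≤-refl)
     , decomposition , ΓGraph , Γ-few , triads-disc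

-- Membership of `j` in `S` does not involve `i`, so `A` consists of all the `aᵢ`, and `E` joins
-- `b_S` to `cⱼ` for `j ∈ S`.
Ū-cylindrical : ∀ k → Cylindrical (Ū k)
Ū-cylindrical k = (λ x → isA (v x)) , (λ x y → bc (v x) (v y)) , (λ x y → bc-sym (v x) (v y))
  , (λ x y → bc⇒¬A (v x) (v y)) , (λ x y z → agree (v x) (v y) (v z))
  where
  open Vertex
  v = vertex k
  isA : Vertex k → Bool
  isA (a _) = true
  isA (b _) = false
  isA (c _) = false
  bc : Vertex k → Vertex k → Bool
  bc (b S) (c j) = lookup S j
  bc (c j) (b S) = lookup S j
  bc _     _     = false
  bc-sym : ∀ u w → bc u w ≡ bc w u
  bc-sym (a _) (a _) = refl
  bc-sym (a _) (b _) = refl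
  bc-sym (a _) (c _) = refl
  bc-sym (b _) (a _) = refl
  bc-sym (b _) (b _) = refl
  bc-sym (b _) (c _) = refl
  bc-sym (c _) (a _) = refl
  bc-sym (c _) (b _) = refl
  bc-sym (c _) (c _) = refl
  bc⇒¬A : ∀ u w → bc u w ≡ true → isA u ≡ false
  bc⇒¬A (b _) _ _ = refl
  bc⇒¬A (c _) _ _ = refl
  ab : ∀ x u w → symmetrise abcEdge (a x) u w ≡ bc u w ∨ ((isA u ∧ false) ∨ (isA w ∧ false))
  ab x (a _) (a _) = refl
  ab x (a _) (b _) = refl
  ab x (a _) (c _) = refl
  ab x (b _) (a _) = refl
  ab x (b _) (b _) = refl
  ab x (b S) (c j) with lookup S j
  ... | true  = refl
  ... | false = refl
  ab x (c _) (a _) = refl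
  ab x (c j) (b S) with lookup S j
  ... | true  = refl
  ... | false = refl
  ab x (c _) (c _) = refl
  agree : ∀ x y z → symmetrise abcEdge x y z ≡ (isA x ∧ bc y z) ∨ ((isA y ∧ bc x z) ∨ (isA z ∧ bc x y))
  agree (a x) (a y) (a z) = refl
  agree (a x) (a y) (b z) = refl
  agree (a x) (a y) (c z) = refl
  agree (a x) (b y) (a z) = refl
  agree (a x) (b y) (b z) = refl
  agree (a x) (b y) (c z) = ab x (b y) (c z)
  agree (a x) (c y) (a z) = refl
  agree (a x) (c y) (b z) = ab x (c y) (b z)
  agree (a x) (c y) (c z) = refl
  agree (b x) (a y) (a z) = refl
  agree (b x) (a y) (b z) = refl
  agree (b S) (a y) (c j) with lookup S j
  ... | true  = refl
  ... | false = refl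
  agree (b x) (b y) (a z) = refl
  agree (b x) (b y) (b z) = refl
  agree (b x) (b y) (c z) = refl
  agree (b S) (c j) (a z) with lookup S j
  ... | true  = refl
  ... | false = refl
  agree (b x) (c y) (b z) = refl
  agree (b x) (c y) (c z) = refl
  agree (c x) (a y) (a z) = refl
  agree (c j) (a y) (b S) with lookup S j
  ... | true  = refl
  ... | false = refl
  agree (c x) (a y) (c z) = refl
  agree (c j) (b S) (a z) with lookup S j
  ... | true  = refl
  ... | false = refl
  agree (c x) (b y) (b z) = refl
  agree (c x) (b y) (c z) = refl
  agree (c x) (c y) (a z) = refl
  agree (c x) (c y) (b z) = refl
  agree (c x) (c y) (c z) = refl

proposition2p60 : Σ[ 𝓗 ∈ HereditaryProperty ]
    AdmitsBinaryDisc₂,₃Error 𝓗 × ((k : ℕ) → k ≥ 1 → Ū k ∈ᴾ 𝓗)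
proposition2p60 = cylinders , cylinders-admit , λ k _ → Ū-cylindrical k
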